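{- Every symmetric function in $\mathbb Z[q]\otimes\Lambda_n$ has the form $Y_q(g)$ for some element $g\in\mathbb Q(q)\otimes H_n(q)$, where $Y_q(g)=\sum_{\lambda\vdash n}\epsilon_q^\lambda(g)m_\lambda$.
   Context: $\Lambda_n$ is the $\mathbb Z$-module of homogeneous degree-$n$ symmetric functions with integer coefficients, and $m_\lambda$ the monomial symmetric functions. $H_n(q)$ is the type $A$ Hecke algebra with generators $T_{s_1},\dots,T_{s_{n-1}}$ and relations $T_{s_i}^2=(q-1)T_{s_i}+q$, $T_{s_i}T_{s_j}=T_{s_j}T_{s_i}$ for $|i-j|\ge2$, $T_{s_i}T_{s_j}T_{s_i}=T_{s_j}T_{s_i}T_{s_j}$ for $|i-j|=1$, with natural basis $\{T_w: w\in\mathfrak S_n\}$. $\mathbb Q(q)\otimes H_n(q)$ is this algebra over $\mathbb Q(q)$ (with $\mathbb Q(q)$-basis $\{T_w\}$). $\epsilon_q^\lambda$ is the character of $H_n(q)$ induced from the sign character $T_w\mapsto(-1)^{\ell(w)}$ of the parabolic subalgebra $H_\lambda(q)$ corresponding to the Young subgroup $\mathfrak S_\lambda$, extended $\mathbb Q(q)$-linearly. -}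

module Defs where

open import Algebra.Bundles.Raw using (RawRing)
open import Algebra.Module.Bundles.Raw using (RawLeftModule)
import Algebra.Definitions.RawMonoid as RawMonoidSum
open import Data.Bool.Base using (if_then_else_)
open import Data.Fin.Base using (Fin; toℕ)
open import Data.Integer.Base as ℤ using (ℤ)
open import Data.List.Base as List
  using (List; []; _∷_; _++_; applyUpTo; cartesianProductWith; concatMap; filter; foldr; upTo)
import Data.List.Properties as List
open import Data.List.Relation.Binary.Permutation.Propositional using (_↭_)
open import Data.List.Relation.Unary.All as All using (All)
open import Data.List.Relation.Unary.Linked as Linked using (Linked)
import Data.List.Sort as Sort
open import Data.Nat.Base as ℕ using (ℕ; zero; suc; pred; _∸_; ∣_-_∣)
import Data.Nat.ListAction as ListAction
import Data.Nat.Properties as ℕ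
open import Data.Product.Base using (Σ; ∃; _×_; _,_; proj₁)
open import Data.Rational.Base as ℚ using (ℚ; 0ℚ)
import Data.Rational.Properties as ℚ
open import Data.Vec.Functional using (Vector)
open import Level using (0ℓ)
import Relation.Binary.Construct.Flip.EqAndOrd as Flip
open import Relation.Binary.PropositionalEquality
  using (_≡_; _≢_; refl; sym; trans; cong; cong₂)
open import Relation.Nullary using (¬_; Dec; yes; no; _×-dec_; contradiction)
open import Relation.Nullary.Decidable using (does)

------------------------------------------------------------------------
-- Polynomials in one variable

-- A polynomial is the list of its coefficients, lowest degree first.  Two
-- lists are equal when all their coefficients agree, so trailing zeros
-- are insignificant.
module Polynomial (R : RawRing 0ℓ 0ℓ) where
  open RawRing R

  infix  4 _≈ᵖ_
  infixl 6 _+ᵖ_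
  infixl 7 _·ᵖ_ _*ᵖ_

  coeff : List Carrier → ℕ → Carrier
  coeff []      _       = 0#
  coeff (a ∷ p) zero    = a
  coeff (a ∷ p) (suc k) = coeff p k

  _≈ᵖ_ : List Carrier → List Carrier → Set
  p ≈ᵖ r = ∀ k → coeff p k ≈ coeff r k

  _+ᵖ_ : List Carrier → List Carrier → List Carrier
  []      +ᵖ r       = r
  (a ∷ p) +ᵖ []      = a ∷ p
  (a ∷ p) +ᵖ (b ∷ r) = (a + b) ∷ (p +ᵖ r)

  _·ᵖ_ : Carrier → List Carrier → List Carrier
  a ·ᵖ p = List.map (a *_) p

  _*ᵖ_ : List Carrier → List Carrier → List Carrier
  []      *ᵖ r = []
  (a ∷ p) *ᵖ r = (a ·ᵖ r) +ᵖ (0# ∷ (p *ᵖ r))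

  rawRing : RawRing 0ℓ 0ℓ
  rawRing = record
    { Carrier = List Carrier
    ; _≈_     = _≈ᵖ_
    ; _+_     = _+ᵖ_
    ; _*_     = _*ᵖ_
    ; -_      = List.map -_
    ; 0#      = []
    ; 1#      = 1# ∷ []
    }

ℤ[q] : RawRing 0ℓ 0ℓ
ℤ[q] = Polynomial.rawRing ℤ.+-*-rawRing

ℚ[q] : RawRing 0ℓ 0ℓ
ℚ[q] = Polynomial.rawRing ℚ.+-*-rawRing

------------------------------------------------------------------------
-- ℚ[q] has no zero divisors

module _ where
  open Polynomial ℚ.+-*-rawRing

  private
    ℚ-domain : ∀ a b → a ≢ 0ℚ → a ℚ.* b ≡ 0ℚ → b ≡ 0ℚ
    ℚ-domain a b a≢0 ab≡0 = trans (sym (ℚ.*-identityˡ b))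
      (trans (cong (ℚ._* b) (sym (ℚ.*-inverseˡ a)))
      (trans (ℚ.*-assoc (ℚ.1/ a) a b)
      (trans (cong (ℚ.1/ a ℚ.*_) ab≡0) (ℚ.*-zeroʳ (ℚ.1/ a)))))
      where instance _ = ℚ.≢-nonZero a≢0

    coeff-+ : ∀ p r k → coeff (p +ᵖ r) k ≡ coeff p k ℚ.+ coeff r k
    coeff-+ []      r       k       = sym (ℚ.+-identityˡ _)
    coeff-+ (a ∷ p) []      k       = sym (ℚ.+-identityʳ _)
    coeff-+ (a ∷ p) (b ∷ r) zero    = refl
    coeff-+ (a ∷ p) (b ∷ r) (suc k) = coeff-+ p r k

    coeff-· : ∀ a p k → coeff (a ·ᵖ p) k ≡ a ℚ.* coeff p k
    coeff-· a []      k       = sym (ℚ.*-zeroʳ a)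
    coeff-· a (b ∷ p) zero    = refl
    coeff-· a (b ∷ p) (suc k) = coeff-· a p k

    coeff-* : ∀ a p r k → coeff ((a ∷ p) *ᵖ r) k ≡ a ℚ.* coeff r k ℚ.+ coeff (0ℚ ∷ p *ᵖ r) k
    coeff-* a p r k = trans (coeff-+ (a ·ᵖ r) (0ℚ ∷ p *ᵖ r) k)
      (cong (ℚ._+ coeff (0ℚ ∷ p *ᵖ r) k) (coeff-· a r k))

    -- The case of a factor with nonzero constant term: the coefficients
    -- of r vanish one after the other.
    unit-cancel : ∀ a p r → a ≢ 0ℚ → (a ∷ p) *ᵖ r ≈ᵖ [] → r ≈ᵖ []
    unit-cancel a p []      a≢0 eq = λ _ → refl
    unit-cancel a p (b ∷ r) a≢0 eq = λ
      { zero    → b≡0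
      ; (suc k) → unit-cancel a p r a≢0 tail k }
      where
      b≡0 : b ≡ 0ℚ
      b≡0 = ℚ-domain a b a≢0
        (trans (sym (trans (coeff-* a p (b ∷ r) 0) (ℚ.+-identityʳ _))) (eq 0))

      shift : ∀ p k → coeff (p *ᵖ (b ∷ r)) k ≡ coeff (0ℚ ∷ p *ᵖ r) k
      shift [] zero    = refl
      shift [] (suc k) = refl
      shift (c ∷ p) zero = trans (coeff-* c p (b ∷ r) 0)
        (trans (ℚ.+-identityʳ _) (trans (cong (c ℚ.*_) b≡0) (ℚ.*-zeroʳ c)))
      shift (c ∷ p) (suc k) = trans (coeff-* c p (b ∷ r) (suc k))
        (trans (cong (c ℚ.* coeff r k ℚ.+_) (shift p k)) (sym (coeff-* c p r k)))

      tail : (a ∷ p) *ᵖ r ≈ᵖ []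
      tail k = trans (sym (shift (a ∷ p) (suc k))) (eq (suc k))

  *ᵖ-≉0 : ∀ p r → ¬ p ≈ᵖ [] → ¬ r ≈ᵖ [] → ¬ p *ᵖ r ≈ᵖ []
  *ᵖ-≉0 []      r p≉0 r≉0 eq = p≉0 (λ _ → refl)
  *ᵖ-≉0 (a ∷ p) r p≉0 r≉0 eq with a ℚ.≟ 0ℚ
  ... | no  a≢0  = r≉0 (unit-cancel a p r a≢0 eq)
  ... | yes refl = *ᵖ-≉0 p r
    (λ p≈0 → p≉0 λ { zero → refl ; (suc k) → p≈0 k }) r≉0
    (λ k → trans (sym (trans (coeff-* 0ℚ p r (suc k))
      (trans (cong (ℚ._+ coeff (p *ᵖ r) k) (ℚ.*-zeroˡ (coeff r (suc k)))) (ℚ.+-identityˡ _))))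
      (eq (suc k)))

------------------------------------------------------------------------
-- The field of rational functions ℚ(q), as the field of fractions of ℚ[q]

private module P = RawRing ℚ[q]

record Fraction : Set where
  constructor fraction
  field
    num   : P.Carrier
    den   : P.Carrier
    den≉0 : ¬ den P.≈ P.0#

open Fraction

fromPoly : P.Carrier → Fraction
fromPoly p = fraction p P.1# (λ eq → contradiction (eq 0) λ ())

ℚ⟨q⟩ : RawRing 0ℓ 0ℓ
ℚ⟨q⟩ = record
  { Carrier = Fraction
  ; _≈_     = λ x y → num x P.* den y P.≈ num y P.* den x
  ; _+_     = λ x y → fraction (num x P.* den y P.+ num y P.* den x) (den x P.* den y)
                               (*ᵖ-≉0 (den x) (den y) (den≉0 x) (den≉0 y))
  ; _*_     = λ x y → fraction (num x P.* num y) (den x P.* den y)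
                               (*ᵖ-≉0 (den x) (den y) (den≉0 x) (den≉0 y))
  ; -_      = λ x → fraction (P.- num x) (den x) (den≉0 x)
  ; 0#      = fromPoly P.0#
  ; 1#      = fromPoly P.1#
  }

module K = RawRing ℚ⟨q⟩

q : K.Carrier
q = fromPoly (0ℚ ∷ ℚ.1ℚ ∷ [])

ι : RawRing.Carrier ℤ[q] → K.Carrier
ι p = fromPoly (List.map (ℚ._/ 1) p)

------------------------------------------------------------------------
-- Traces and characters

module _ (M : RawLeftModule K.Carrier 0ℓ 0ℓ) where
  open RawLeftModule M
  open RawMonoidSum +ᴹ-rawMonoid using () renaming (sum to sumᴹ)
  open RawMonoidSum K.+-rawMonoid using (sum)

  record FiniteBasis : Set where
    field
      {dim}       : ℕ
      basis       : Vector Carrierᴹ dim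
      spanning    : ∀ x → ∃ λ (c : Vector K.Carrier dim) → x ≈ᴹ sumᴹ (λ i → c i *ₗ basis i)
      independent : ∀ (c : Vector K.Carrier dim) →
                    sumᴹ (λ i → c i *ₗ basis i) ≈ᴹ 0ᴹ → ∀ i → c i K.≈ K.0#

    coordinate : Carrierᴹ → Vector K.Carrier dim
    coordinate x = proj₁ (spanning x)

  trace : FiniteBasis → (Carrierᴹ → Carrierᴹ) → K.Carrier
  trace B φ = sum λ i → coordinate (φ (basis i)) i
    where open FiniteBasis B

------------------------------------------------------------------------
-- The Hecke algebra, by generators and relations

-- Expressions denoting elements of a unital associative ℚ(q)-algebra with
-- generators indexed by I; κ embeds the scalars.
data Expr (I : Set) : Set where
  T       : I → Expr I
  κ       : K.Carrier → Expr I
  _⊕_ _⊛_ : Expr I → Expr I → Expr I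
  ⊖_      : Expr I → Expr I

infixl 6 _⊕_
infixl 7 _⊛_
infix  8 ⊖_

-- The Young subgroup of μ = (μ₁, μ₂, …) permutes the first μ₁ positions
-- among themselves, then the next μ₂, and so on; block μ k is the index
-- of the block containing position k.
block : List ℕ → ℕ → ℕ
block []      k = 0
block (l ∷ μ) k = if k ℕ.<ᵇ l then 0 else suc (block μ (k ∸ l))

module Hecke (n : ℕ) where

  -- The index i stands for the transposition exchanging the positions
  -- toℕ i and suc (toℕ i), where positions are counted from 0.
  Gen : Set
  Gen = Fin (pred n)

  H : Set
  H = Expr Gen

  infix 4 _≈ᴴ_

  -- The least ℚ(q)-algebra congruence containing the Hecke relations.
  data _≈ᴴ_ : H → H → Set where
    reflᴴ  : ∀ {a} → a ≈ᴴ a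
    symᴴ   : ∀ {a b} → a ≈ᴴ b → b ≈ᴴ a
    transᴴ : ∀ {a b c} → a ≈ᴴ b → b ≈ᴴ c → a ≈ᴴ c
    ⊕-cong : ∀ {a a′ b b′} → a ≈ᴴ a′ → b ≈ᴴ b′ → a ⊕ b ≈ᴴ a′ ⊕ b′
    ⊛-cong : ∀ {a a′ b b′} → a ≈ᴴ a′ → b ≈ᴴ b′ → a ⊛ b ≈ᴴ a′ ⊛ b′
    ⊖-cong : ∀ {a a′} → a ≈ᴴ a′ → ⊖ a ≈ᴴ ⊖ a′
    κ-cong : ∀ {c d} → c K.≈ d → κ c ≈ᴴ κ d

    ⊕-assoc     : ∀ a b c → (a ⊕ b) ⊕ c ≈ᴴ a ⊕ (b ⊕ c)
    ⊕-comm      : ∀ a b → a ⊕ b ≈ᴴ b ⊕ a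
    ⊕-identityˡ : ∀ a → κ K.0# ⊕ a ≈ᴴ a
    ⊖-inverseˡ  : ∀ a → ⊖ a ⊕ a ≈ᴴ κ K.0#
    ⊛-assoc     : ∀ a b c → (a ⊛ b) ⊛ c ≈ᴴ a ⊛ (b ⊛ c)
    ⊛-identityˡ : ∀ a → κ K.1# ⊛ a ≈ᴴ a
    ⊛-identityʳ : ∀ a → a ⊛ κ K.1# ≈ᴴ a
    ⊛-distribˡ  : ∀ a b c → a ⊛ (b ⊕ c) ≈ᴴ a ⊛ b ⊕ a ⊛ c
    ⊛-distribʳ  : ∀ a b c → (b ⊕ c) ⊛ a ≈ᴴ b ⊛ a ⊕ c ⊛ a
    κ-+         : ∀ c d → κ (c K.+ d) ≈ᴴ κ c ⊕ κ d
    κ-*         : ∀ c d → κ (c K.* d) ≈ᴴ κ c ⊛ κ d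
    κ-central   : ∀ c a → κ c ⊛ a ≈ᴴ a ⊛ κ c

    quadratic : ∀ i → T i ⊛ T i ≈ᴴ κ (q K.+ K.- K.1#) ⊛ T i ⊕ κ q
    commute   : ∀ i j → 2 ℕ.≤ ∣ toℕ i - toℕ j ∣ → T i ⊛ T j ≈ᴴ T j ⊛ T i
    braid     : ∀ i j → ∣ toℕ i - toℕ j ∣ ≡ 1 → T i ⊛ T j ⊛ T i ≈ᴴ T j ⊛ T i ⊛ T j

  module Parabolic (μ : List ℕ) where

    -- The simple transpositions lying in the Young subgroup of μ.
    YoungGen : Set
    YoungGen = Σ Gen λ i → block μ (toℕ i) ≡ block μ (suc (toℕ i))

    -- The subalgebra spanned by the T_w with w in the Young subgroup is the
    -- one generated by the T_s for these transpositions s; its elements are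
    -- the values of include.
    Hμ : Set
    Hμ = Expr YoungGen

    include : Hμ → H
    include (T (i , _)) = T i
    include (κ c)       = κ c
    include (a ⊕ b)     = include a ⊕ include b
    include (a ⊛ b)     = include a ⊛ include b
    include (⊖ a)       = ⊖ include a

    -- The algebra map with T_s ↦ -1, hence T_w ↦ (-1)^ℓ(w).
    sgn : Hμ → K.Carrier
    sgn (T _)   = K.- K.1#
    sgn (κ c)   = c
    sgn (a ⊕ b) = sgn a K.+ sgn b
    sgn (a ⊛ b) = sgn a K.* sgn b
    sgn (⊖ a)   = K.- sgn a

    -- The tensor product of H with the sign module over the parabolic
    -- subalgebra
    data Induced : Set where
      _⊗_  : H → K.Carrier → Induced
      0ᵗ   : Induced
      _+ᵗ_ : Induced → Induced → Induced
      -ᵗ_  : Induced → Induced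

    infix  9 _⊗_
    infixl 6 _+ᵗ_
    infix  8 -ᵗ_
    infix  4 _≈ᵗ_

    data _≈ᵗ_ : Induced → Induced → Set where
      reflᵗ    : ∀ {x} → x ≈ᵗ x
      symᵗ     : ∀ {x y} → x ≈ᵗ y → y ≈ᵗ x
      transᵗ   : ∀ {x y z} → x ≈ᵗ y → y ≈ᵗ z → x ≈ᵗ z
      +-cong   : ∀ {x x′ y y′} → x ≈ᵗ x′ → y ≈ᵗ y′ → x +ᵗ y ≈ᵗ x′ +ᵗ y′
      neg-cong : ∀ {x x′} → x ≈ᵗ x′ → -ᵗ x ≈ᵗ -ᵗ x′
      ⊗-cong   : ∀ {a a′ k k′} → a ≈ᴴ a′ → k K.≈ k′ → a ⊗ k ≈ᵗ a′ ⊗ k′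

      +-assoc      : ∀ x y z → (x +ᵗ y) +ᵗ z ≈ᵗ x +ᵗ (y +ᵗ z)
      +-comm       : ∀ x y → x +ᵗ y ≈ᵗ y +ᵗ x
      +-identityˡ  : ∀ x → 0ᵗ +ᵗ x ≈ᵗ x
      neg-inverseˡ : ∀ x → -ᵗ x +ᵗ x ≈ᵗ 0ᵗ

      ⊗-distribʳ : ∀ a b k → (a ⊕ b) ⊗ k ≈ᵗ a ⊗ k +ᵗ b ⊗ k
      ⊗-distribˡ : ∀ a k l → a ⊗ (k K.+ l) ≈ᵗ a ⊗ k +ᵗ a ⊗ l
      balanced   : ∀ a (b : Hμ) k → (a ⊛ include b) ⊗ k ≈ᵗ a ⊗ (sgn b K.* k)

    infixr 7 _▷_

    _▷_ : H → Induced → Induced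
    h ▷ (a ⊗ k)  = (h ⊛ a) ⊗ k
    h ▷ 0ᵗ       = 0ᵗ
    h ▷ (x +ᵗ y) = h ▷ x +ᵗ h ▷ y
    h ▷ (-ᵗ x)   = -ᵗ (h ▷ x)

    inducedModule : RawLeftModule K.Carrier 0ℓ 0ℓ
    inducedModule = record
      { Carrierᴹ = Induced
      ; _≈ᴹ_     = _≈ᵗ_
      ; _+ᴹ_     = _+ᵗ_
      ; _*ₗ_     = λ c x → κ c ▷ x
      ; 0ᴹ       = 0ᵗ
      ; -ᴹ_      = -ᵗ_
      }

    -- χ is the character of H induced from the sign character of the
    -- parabolic subalgebra of μ.  Any two such χ agree up to equality in ℚ(q).
    IsInducedSignCharacter : (H → K.Carrier) → Set
    IsInducedSignCharacter χ =
      FiniteBasis M × (∀ (B : FiniteBasis M) h → χ h K.≈ trace M B (h ▷_))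
      where M = inducedModule

------------------------------------------------------------------------
-- Partitions

infix 4 _⊢_ _⊢?_

_⊢_ : List ℕ → ℕ → Set
μ ⊢ n = Linked ℕ._≥_ μ × All (0 ℕ.<_) μ × ListAction.sum μ ≡ n

_⊢?_ : ∀ μ n → Dec (μ ⊢ n)
μ ⊢? n = Linked.linked? ℕ._≥?_ μ ×-dec All.all? (0 ℕ.<?_) μ ×-dec (ListAction.sum μ ℕ.≟ n)

words : List ℕ → ℕ → List (List ℕ)
words letters zero    = [] ∷ []
words letters (suc l) = cartesianProductWith _∷_ letters (words letters l)

-- A partition of n has at most n parts, each of them between 1 and n.
partitions : ℕ → List (List ℕ)
partitions n = filter (_⊢? n) (concatMap (words (applyUpTo suc n)) (upTo (suc n)))

------------------------------------------------------------------------
-- Symmetric functions in countably many variables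

-- A formal series is given by its coefficients: the list (α₁, …, α_k)
-- stands for the monomial x₁^α₁ ⋯ x_k^α_k, so a series must not
-- distinguish lists which differ by trailing zeros.
record SymmetricFunction (R : RawRing 0ℓ 0ℓ) (n : ℕ) : Set where
  open RawRing R
  field
    coefficient : List ℕ → Carrier
    padding     : ∀ α → coefficient (α ++ 0 ∷ []) ≈ coefficient α
    symmetric   : ∀ {α β} → α ↭ β → coefficient α ≈ coefficient β
    homogeneous : ∀ α → ListAction.sum α ≢ n → coefficient α ≈ 0#

open SymmetricFunction public

open Sort (Flip.decTotalOrder ℕ.≤-decTotalOrder) using () renaming (sort to sortDown)

-- Coefficients of m_μ, the sum of all distinct monomials whose exponents
-- are, up to order and zeros, the parts of μ.
monomial : List ℕ → List ℕ → K.Carrier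
monomial μ α =
  if does (List.≡-dec ℕ._≟_ (sortDown (filter (0 ℕ.<?_) α)) μ) then K.1# else K.0#

-- Coefficients of Y_q(g) = Σ_{μ ⊢ n} ε_q^μ(g) m_μ.
Y : ∀ n → (List ℕ → Hecke.H n → K.Carrier) → Hecke.H n → List ℕ → K.Carrier
Y n ε g α = foldr K._+_ K.0# (List.map (λ μ → ε μ g K.* monomial μ α) (partitions n))

-- Realise the module induced from the sign character of H_μ on the words w
-- with content μ: T_i sends w to -w, to s_i w, or to q s_i w + (q - 1) w,
-- according to w_i = w_{i+1}, w_i < w_{i+1} or w_i > w_{i+1}.
--
-- For a partition ν let u be the reading word 0 1 … 0 1 … of the columns of
-- its diagram, and let g be the product of 1 + T_i over the ascents i of u.
-- At q = 0 the trace of g on the module of μ is the number of words with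
-- content μ which ascend wherever u does.  Each such word is bounded below by u
-- letter by letter.  Hence the trace vanishes at q = 0 unless the sum of
-- the letters is larger for μ than for ν or μ = ν, and in the latter case it is
-- 1.  So the matrix of the traces is unitriangular at q = 0, which makes it
-- invertible over ℚ(q).
module Submission where

open import Defs
open import Algebra.Bundles
  using (CommutativeRing; AbelianGroup; CommutativeMonoid)
open import Algebra.Module.Bundles using (LeftModule)
open import Data.Bool.Base using (if_then_else_; true; false)
open import Data.Empty using (⊥-elim)
open import Data.Fin.Base using (Fin; zero; suc; toℕ)
open import Data.Fin.Permutation using (Permutation′; permutation)
open import Data.Fin.Properties as Fin using (any?; toℕ-injective)
open import Data.Integer.Base as ℤ using (ℤ)
open import Data.List.Base as List
  using (List; []; _∷_; filter; lookup; length; upTo; cartesianProductWith; _++_;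
    replicate; applyUpTo; foldr; allFin; concatMap)
open import Data.List.Membership.Propositional using (_∈_)
open import Data.List.Membership.Propositional.Properties
  using (∈-lookup; ∈-filter⁺; ∈-filter⁻; ∈-cartesianProductWith⁺; ∈-upTo⁺; ∈-allFin;
    ∈-applyUpTo⁺; ∈-cartesianProductWith⁻; ∈-concatMap⁺)
import Data.List.Properties as List
open import Data.List.Relation.Binary.Disjoint.Propositional using (Disjoint)
open import Data.List.Relation.Binary.Permutation.Propositional as Perm
  using (_↭_; ↭-refl; ↭-sym; ↭-trans; ↭-reflexive; module PermutationReasoning)
open import Data.List.Relation.Binary.Permutation.Propositional.Properties
  using (All-resp-↭; ↭-length; shift; ++⁺ˡ; ++⁺ʳ; ++-comm; map⁺)
open import Data.List.Relation.Binary.Pointwise using (Pointwise-≡⇒≡)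
open import Data.List.Relation.Unary.All as All using (All; []; _∷_)
open import Data.List.Relation.Unary.All.Properties as All using (all-filter)
open import Data.List.Relation.Unary.AllPairs as AllPairs using ([]; _∷_; AllPairs)
import Data.List.Relation.Unary.AllPairs.Properties as AllPairs
open import Data.List.Relation.Unary.Any as Any using (here; there)
open import Data.List.Relation.Unary.Any.Properties using (lookup-index)
open import Data.List.Relation.Unary.Linked as Linked using (Linked; []; [-]; _∷_)
open import Data.List.Relation.Unary.Linked.Properties using (Linked⇒AllPairs)
open import Data.List.Relation.Unary.Sorted.TotalOrder.Properties using (↗↭↗⇒≋)
open import Data.List.Relation.Unary.Unique.Propositional using (Unique)
import Data.List.Relation.Unary.Unique.Propositional.Properties as Unique
import Data.List.Sort as Sort
open import Data.Nat.Base as ℕ using (zero; suc; ℕ; pred; _<_; _≤_; z≤n; s≤s; z<s; s<s; ∣_-_∣)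
open import Data.Nat.Induction using (<-wellFounded)
import Data.Nat.ListAction as ListAction
open import Data.Nat.ListAction.Properties using (sum-↭; sum-++)
import Data.Nat.Properties as ℕ
import Data.Nat.Solver as ℕSolver
open import Data.Product.Base using (∃; _×_; _,_; proj₁; proj₂; ∃-syntax)
open import Data.Rational.Base as ℚ using (ℚ; 0ℚ; 1ℚ)
import Data.Rational.Properties as ℚ
import Data.Rational.Solver as ℚSolver
open import Data.Sum.Base using (_⊎_; inj₁; inj₂; [_,_]′)
open import Data.Unit.Base using (⊤; tt)
open import Data.Vec.Base using (Vec; []; _∷_; toList; tabulate)
open import Data.Vec.Functional using (Vector)
import Data.Vec.Properties as Vec
open import Function.Base using (id)
open import Induction.WellFounded using (Acc; acc)
open import Level using (0ℓ)
import Relation.Binary.Construct.Flip.EqAndOrd as Flip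
import Relation.Binary.Construct.On as On
open import Relation.Binary.PropositionalEquality as ≡ using (_≡_; _≢_)
open import Relation.Nullary using (¬_; yes; no; contradiction; Dec; ofʸ; ofⁿ; does)
open import Relation.Nullary.Decidable using (decidable-stable; map′; dec-true; dec-false)

-- The algebra and the induced modules are given by generators and relations, so their size is not
-- known in advance and no basis `T_w` is at hand. Two maps between an induced module and functions
-- on words settle this. `coordinates` exists because the action on words satisfies the relations
-- and the sorted word spans a sign representation of the parabolic subalgebra; it yields linear
-- independence. `expand` sends a word to a product of generators applied to `1 ⊗ 1`; that the
-- result does not depend on how the word is sorted is shown by induction on words, in place of the
-- theory of reduced expressions. It yields spanning.
--
-- Setting q = 0 is not a map on ℚ(q), and the reciprocal of a polynomial with constant term 1 is
-- usually not a polynomial. Hence the value at q = 0 is a relation, and some elimination is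
-- unavoidable: the entries that vanish at q = 0 need not vanish over ℚ(q). For n = 3, ν = (1,1,1)
-- and μ = (2,1) the trace is q.

-- Polynomial rings over a commutative ring

module PolynomialRing (R : CommutativeRing 0ℓ 0ℓ) where

  open CommutativeRing R hiding (_-_)
  open import Algebra.Properties.Ring ring using (-0#≈0#)
  open Polynomial rawRing hiding (rawRing)

  infix 4 _≋_

  -- Unlike p ≈ᵖ r, which unfolds to a function type, p ≋ r determines p and r.
  record _≋_ (p r : List Carrier) : Set where
    constructor pointwise
    field at : p ≈ᵖ r

  open _≋_ public

  private
    Poly : Set
    Poly = List Carrier

    refl≈ : ∀ {p} → p ≋ p
    refl≈ = pointwise λ _ → refl

    sym≈ : ∀ {p r} → p ≋ r → r ≋ p
    sym≈ e = pointwise λ k → sym (at e k)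

    trans≈ : ∀ {p r s} → p ≋ r → r ≋ s → p ≋ s
    trans≈ e f = pointwise λ k → trans (at e k) (at f k)

    ∷-cong : ∀ {a b p r} → a ≈ b → p ≋ r → a ∷ p ≋ b ∷ r
    ∷-cong e f = pointwise λ { zero → e ; (suc k) → at f k }

    coeff-+ : ∀ p r k → coeff (p +ᵖ r) k ≈ coeff p k + coeff r k
    coeff-+ []      r       k       = sym (+-identityˡ _)
    coeff-+ (a ∷ p) []      k       = sym (+-identityʳ _)
    coeff-+ (a ∷ p) (b ∷ r) zero    = refl
    coeff-+ (a ∷ p) (b ∷ r) (suc k) = coeff-+ p r k

    coeff-· : ∀ a p k → coeff (a ·ᵖ p) k ≈ a * coeff p k
    coeff-· a []      k       = sym (zeroʳ a)
    coeff-· a (b ∷ p) zero    = refl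
    coeff-· a (b ∷ p) (suc k) = coeff-· a p k

    coeff-neg : ∀ p k → coeff (List.map -_ p) k ≈ - coeff p k
    coeff-neg []      k       = sym -0#≈0#
    coeff-neg (b ∷ p) zero    = refl
    coeff-neg (b ∷ p) (suc k) = coeff-neg p k

    +-cong′ : ∀ {p p′ r r′} → p ≋ p′ → r ≋ r′ → p +ᵖ r ≋ p′ +ᵖ r′
    +-cong′ {p} {p′} {r} {r′} e f = pointwise λ k →
      trans (coeff-+ p r k) (trans (+-cong (at e k) (at f k)) (sym (coeff-+ p′ r′ k)))

    +-assoc′ : ∀ p r s → (p +ᵖ r) +ᵖ s ≋ p +ᵖ (r +ᵖ s)
    +-assoc′ p r s = pointwise λ k → trans (coeff-+ (p +ᵖ r) s k) (trans (+-congʳ (coeff-+ p r k))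
      (trans (+-assoc _ _ _) (sym (trans (coeff-+ p (r +ᵖ s) k) (+-congˡ (coeff-+ r s k))))))

    +-comm′ : ∀ p r → p +ᵖ r ≋ r +ᵖ p
    +-comm′ p r = pointwise λ k → trans (coeff-+ p r k) (trans (+-comm _ _) (sym (coeff-+ r p k)))

    +-identityʳ′ : ∀ p → p +ᵖ [] ≋ p
    +-identityʳ′ p = +-comm′ p []

    -‿inverseˡ′ : ∀ p → List.map -_ p +ᵖ p ≋ []
    -‿inverseˡ′ p = pointwise λ k → trans (coeff-+ (List.map -_ p) p k)
      (trans (+-congʳ (coeff-neg p k)) (-‿inverseˡ _))

    neg-cong′ : ∀ {p r} → p ≋ r → List.map -_ p ≋ List.map -_ r
    neg-cong′ {p} {r} e = pointwise λ k → trans (coeff-neg p k) (trans (-‿cong (at e k)) (sym (coeff-neg r k)))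

    interchange : ∀ p r s t → (p +ᵖ r) +ᵖ (s +ᵖ t) ≋ (p +ᵖ s) +ᵖ (r +ᵖ t)
    interchange p r s t =
      trans≈ (+-assoc′ p r (s +ᵖ t))
      (trans≈ (+-cong′ (refl≈ {p}) (trans≈ (sym≈ (+-assoc′ r s t))
        (trans≈ (+-cong′ (+-comm′ r s) (refl≈ {t})) (+-assoc′ s r t))))
      (sym≈ (+-assoc′ p s (r +ᵖ t))))

    ·-cong : ∀ {a b p r} → a ≈ b → p ≋ r → a ·ᵖ p ≋ b ·ᵖ r
    ·-cong {a} {b} {p} {r} e f = pointwise λ k →
      trans (coeff-· a p k) (trans (*-cong e (at f k)) (sym (coeff-· b r k)))

    ·-distribˡ : ∀ a p r → a ·ᵖ (p +ᵖ r) ≋ a ·ᵖ p +ᵖ a ·ᵖ r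
    ·-distribˡ a p r = pointwise λ k → trans (coeff-· a (p +ᵖ r) k) (trans (*-congˡ (coeff-+ p r k))
      (trans (distribˡ a _ _) (sym (trans (coeff-+ (a ·ᵖ p) (a ·ᵖ r) k)
        (+-cong (coeff-· a p k) (coeff-· a r k))))))

    ·-· : ∀ a b p → a ·ᵖ (b ·ᵖ p) ≋ (a * b) ·ᵖ p
    ·-· a b p = pointwise λ k → trans (coeff-· a (b ·ᵖ p) k) (trans (*-congˡ (coeff-· b p k))
      (trans (sym (*-assoc _ _ _)) (sym (coeff-· (a * b) p k))))

    ·-shift : ∀ a p → a ·ᵖ (0# ∷ p) ≋ 0# ∷ a ·ᵖ p
    ·-shift a p = ∷-cong (zeroʳ a) refl≈

    shift-+ : ∀ p r → 0# ∷ (p +ᵖ r) ≋ (0# ∷ p) +ᵖ (0# ∷ r)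
    shift-+ p r = ∷-cong (sym (+-identityˡ 0#)) refl≈

    *-congˡ′ : ∀ p {r r′} → r ≋ r′ → p *ᵖ r ≋ p *ᵖ r′
    *-congˡ′ []      e = refl≈
    *-congˡ′ (a ∷ p) e = +-cong′ (·-cong refl e) (∷-cong refl (*-congˡ′ p e))

    *-zeroʳ′ : ∀ p → p *ᵖ [] ≋ []
    *-zeroʳ′ []      = refl≈
    *-zeroʳ′ (a ∷ p) = pointwise λ { zero → refl ; (suc k) → at (*-zeroʳ′ p) k }

    -- Multiplication is defined by recursion on the left factor, and this is the mirror recursion.
    -- It turns commutativity into an induction, from which congruence and distributivity in the
    -- left factor follow.
    *-∷ʳ : ∀ p b r → p *ᵖ (b ∷ r) ≋ b ·ᵖ p +ᵖ (0# ∷ p *ᵖ r)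
    *-∷ʳ []      b r = pointwise λ { zero → refl ; (suc k) → refl }
    *-∷ʳ (a ∷ p) b r = ∷-cong (+-congʳ (*-comm a b)) (trans≈
      (+-cong′ (refl≈ {a ·ᵖ r}) (*-∷ʳ p b r))
      (trans≈ (sym≈ (+-assoc′ (a ·ᵖ r) (b ·ᵖ p) _))
      (trans≈ (+-cong′ (+-comm′ (a ·ᵖ r) (b ·ᵖ p)) (refl≈ {0# ∷ p *ᵖ r}))
      (+-assoc′ (b ·ᵖ p) (a ·ᵖ r) _))))

    *-comm′ : ∀ p r → p *ᵖ r ≋ r *ᵖ p
    *-comm′ []      r = sym≈ (*-zeroʳ′ r)
    *-comm′ (a ∷ p) r =
      trans≈ (+-cong′ (refl≈ {a ·ᵖ r}) (∷-cong refl (*-comm′ p r))) (sym≈ (*-∷ʳ r a p))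

    *-cong′ : ∀ {p p′ r r′} → p ≋ p′ → r ≋ r′ → p *ᵖ r ≋ p′ *ᵖ r′
    *-cong′ {p} {p′} {r} {r′} e f = trans≈ (*-congˡ′ p f)
      (trans≈ (*-comm′ p r′) (trans≈ (*-congˡ′ r′ e) (*-comm′ r′ p′)))

    distribˡ′ : ∀ p r s → p *ᵖ (r +ᵖ s) ≋ p *ᵖ r +ᵖ p *ᵖ s
    distribˡ′ []      r s = refl≈
    distribˡ′ (a ∷ p) r s = trans≈
      (+-cong′ (·-distribˡ a r s) (trans≈ (∷-cong refl (distribˡ′ p r s)) (shift-+ (p *ᵖ r) (p *ᵖ s))))
      (interchange (a ·ᵖ r) (a ·ᵖ s) (0# ∷ p *ᵖ r) (0# ∷ p *ᵖ s))

    distribʳ′ : ∀ p r s → (r +ᵖ s) *ᵖ p ≋ r *ᵖ p +ᵖ s *ᵖ p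
    distribʳ′ p r s = trans≈ (*-comm′ (r +ᵖ s) p)
      (trans≈ (distribˡ′ p r s) (+-cong′ (*-comm′ p r) (*-comm′ p s)))

    ·-* : ∀ a p r → (a ·ᵖ p) *ᵖ r ≋ a ·ᵖ (p *ᵖ r)
    ·-* a []      r = refl≈
    ·-* a (b ∷ p) r = trans≈
      (+-cong′ (sym≈ (·-· a b r)) (trans≈ (∷-cong refl (·-* a p r)) (sym≈ (·-shift a (p *ᵖ r)))))
      (sym≈ (·-distribˡ a (b ·ᵖ r) (0# ∷ p *ᵖ r)))

    0·ᵖ : ∀ p → 0# ·ᵖ p ≋ []
    0·ᵖ p = pointwise λ k → trans (coeff-· 0# p k) (zeroˡ _)

    shift-* : ∀ p r → (0# ∷ p) *ᵖ r ≋ 0# ∷ (p *ᵖ r)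
    shift-* p r = +-cong′ (0·ᵖ r) (refl≈ {0# ∷ (p *ᵖ r)})

    *-assoc′ : ∀ p r s → (p *ᵖ r) *ᵖ s ≋ p *ᵖ (r *ᵖ s)
    *-assoc′ []      r s = refl≈
    *-assoc′ (a ∷ p) r s = trans≈ (distribʳ′ s (a ·ᵖ r) (0# ∷ p *ᵖ r))
      (+-cong′ (·-* a r s) (trans≈ (shift-* (p *ᵖ r) s) (∷-cong refl (*-assoc′ p r s))))

    *-identityˡ′ : ∀ p → (1# ∷ []) *ᵖ p ≋ p
    *-identityˡ′ p = pointwise λ k → trans (coeff-+ (1# ·ᵖ p) (0# ∷ []) k)
      (trans (+-cong (trans (coeff-· 1# p k) (*-identityˡ _)) (at 0∷[] k)) (+-identityʳ _))
      where
      0∷[] : 0# ∷ [] ≋ []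
      0∷[] = pointwise λ { zero → refl ; (suc k) → refl }

  coeff₀-+ : ∀ p r → coeff (p +ᵖ r) 0 ≈ coeff p 0 + coeff r 0
  coeff₀-+ p r = coeff-+ p r 0

  coeff₀-neg : ∀ p → coeff (List.map -_ p) 0 ≈ - coeff p 0
  coeff₀-neg p = coeff-neg p 0

  coeff₀-* : ∀ p r → coeff (p *ᵖ r) 0 ≈ coeff p 0 * coeff r 0
  coeff₀-* []      r = sym (zeroˡ _)
  coeff₀-* (a ∷ p) r = trans (coeff-+ (a ·ᵖ r) (0# ∷ p *ᵖ r) 0)
    (trans (+-identityʳ _) (coeff-· a r 0))

  polynomialRing : CommutativeRing 0ℓ 0ℓ
  polynomialRing = record
    { Carrier = Poly ; _≈_ = _≋_ ; _+_ = _+ᵖ_ ; _*_ = _*ᵖ_ ; -_ = List.map -_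
    ; 0# = [] ; 1# = 1# ∷ []
    ; isCommutativeRing = record
      { isRing = record
        { +-isAbelianGroup = record
          { isGroup = record
            { isMonoid = record
              { isSemigroup = record
                { isMagma = record
                  { isEquivalence = isEquivalence′
                  ; ∙-cong = +-cong′ }
                ; assoc = +-assoc′ }
              ; identity = (λ p → refl≈) , +-identityʳ′ }
            ; inverse = -‿inverseˡ′ , λ p → trans≈ (+-comm′ p (List.map -_ p)) (-‿inverseˡ′ p)
            ; ⁻¹-cong = neg-cong′ }
          ; comm = +-comm′ }
        ; *-cong = *-cong′
        ; *-assoc = *-assoc′
        ; *-identity = *-identityˡ′ , λ p → trans≈ (*-comm′ p (1# ∷ [])) (*-identityˡ′ p)
        ; distrib = distribˡ′ , distribʳ′ }
      ; *-comm = *-comm′ }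
    }
    where
    open import Relation.Binary.Structures using (IsEquivalence)
    isEquivalence′ : IsEquivalence _≋_
    isEquivalence′ = record { refl = λ {p} → refl≈ {p} ; sym = sym≈ ; trans = trans≈ }

-- Arithmetic of fractions

module FractionIdentities (R : CommutativeRing 0ℓ 0ℓ) where
  open CommutativeRing R
  open import Algebra.Properties.Ring ring using (-‿distribˡ-*)
  open import Relation.Binary.Reasoning.Setoid setoid
  open import Algebra.Solver.Ring.NaturalCoefficients.Default commutativeSemiring

  sum-cong : ∀ {a b c d a′ b′ c′ d′} → a * b′ ≈ a′ * b → c * d′ ≈ c′ * d →
             (a * d + c * b) * (b′ * d′) ≈ (a′ * d′ + c′ * b′) * (b * d)
  sum-cong {a} {b} {c} {d} {a′} {b′} {c′} {d′} e f = begin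
    (a * d + c * b) * (b′ * d′)
      ≈⟨ solve 6 (λ a b c d b′ d′ → (a :* d :+ c :* b) :* (b′ :* d′) :=
           (a :* b′) :* (d :* d′) :+ (c :* d′) :* (b :* b′)) refl a b c d b′ d′ ⟩
    (a * b′) * (d * d′) + (c * d′) * (b * b′)
      ≈⟨ +-cong (*-congʳ e) (*-congʳ f) ⟩
    (a′ * b) * (d * d′) + (c′ * d) * (b * b′)
      ≈⟨ solve 6 (λ a′ b c′ d b′ d′ → (a′ :* b) :* (d :* d′) :+ (c′ :* d) :* (b :* b′) :=
           (a′ :* d′ :+ c′ :* b′) :* (b :* d)) refl a′ b c′ d b′ d′ ⟩
    (a′ * d′ + c′ * b′) * (b * d) ∎

  product-cong : ∀ {a b c d a′ b′ c′ d′} → a * b′ ≈ a′ * b → c * d′ ≈ c′ * d →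
                 (a * c) * (b′ * d′) ≈ (a′ * c′) * (b * d)
  product-cong {a} {b} {c} {d} {a′} {b′} {c′} {d′} e f = begin
    (a * c) * (b′ * d′)   ≈⟨ exchange a c b′ d′ ⟩
    (a * b′) * (c * d′)   ≈⟨ *-cong e f ⟩
    (a′ * b) * (c′ * d)   ≈⟨ exchange a′ b c′ d ⟩
    (a′ * c′) * (b * d)   ∎
    where
    exchange : ∀ a b c d → (a * b) * (c * d) ≈ (a * c) * (b * d)
    exchange = solve 4 (λ a b c d → (a :* b) :* (c :* d) := (a :* c) :* (b :* d)) refl

  neg-cong : ∀ {a b a′ b′} → a * b′ ≈ a′ * b → (- a) * b′ ≈ (- a′) * b
  neg-cong {a} {b} {a′} {b′} e =
    trans (sym (-‿distribˡ-* a b′)) (trans (-‿cong e) (-‿distribˡ-* a′ b))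

  sum-assoc : ∀ a b c d e f →
    ((a * d + c * b) * f + e * (b * d)) * (b * (d * f)) ≈
    (a * (d * f) + (c * f + e * d) * b) * ((b * d) * f)
  sum-assoc = solve 6 (λ a b c d e f →
    ((a :* d :+ c :* b) :* f :+ e :* (b :* d)) :* (b :* (d :* f)) :=
    (a :* (d :* f) :+ (c :* f :+ e :* d) :* b) :* ((b :* d) :* f)) refl

  sum-comm : ∀ a b c d → (a * d + c * b) * (d * b) ≈ (c * b + a * d) * (b * d)
  sum-comm = solve 4 (λ a b c d → (a :* d :+ c :* b) :* (d :* b) := (c :* b :+ a :* d) :* (b :* d)) refl

  sum-identityˡ : ∀ a b → (0# * b + a * 1#) * b ≈ a * (1# * b)
  sum-identityˡ = solve 2 (λ a b → (con 0 :* b :+ a :* con 1) :* b := a :* (con 1 :* b)) refl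

  sum-inverseˡ : ∀ a b → ((- a) * b + a * b) * 1# ≈ 0# * (b * b)
  sum-inverseˡ a b = begin
    ((- a) * b + a * b) * 1# ≈⟨ *-identityʳ _ ⟩
    (- a) * b + a * b        ≈⟨ sym (distribʳ b (- a) a) ⟩
    (- a + a) * b            ≈⟨ *-congʳ (-‿inverseˡ a) ⟩
    0# * b                   ≈⟨ zeroˡ b ⟩
    0#                       ≈⟨ sym (zeroˡ (b * b)) ⟩
    0# * (b * b)             ∎

  product-assoc : ∀ a b c d e f → ((a * c) * e) * (b * (d * f)) ≈ (a * (c * e)) * ((b * d) * f)
  product-assoc = solve 6 (λ a b c d e f →
    ((a :* c) :* e) :* (b :* (d :* f)) := (a :* (c :* e)) :* ((b :* d) :* f)) refl

  product-comm : ∀ a b c d → (a * c) * (d * b) ≈ (c * a) * (b * d)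
  product-comm = solve 4 (λ a b c d → (a :* c) :* (d :* b) := (c :* a) :* (b :* d)) refl

  product-identityˡ : ∀ a b → (1# * a) * b ≈ a * (1# * b)
  product-identityˡ = solve 2 (λ a b → (con 1 :* a) :* b := a :* (con 1 :* b)) refl

  product-distribˡ : ∀ a b c d e f →
    (a * (c * f + e * d)) * ((b * d) * (b * f)) ≈
    ((a * c) * (b * f) + (a * e) * (b * d)) * (b * (d * f))
  product-distribˡ = solve 6 (λ a b c d e f →
    (a :* (c :* f :+ e :* d)) :* ((b :* d) :* (b :* f)) :=
    ((a :* c) :* (b :* f) :+ (a :* e) :* (b :* d)) :* (b :* (d :* f))) refl

  -- Equality of fractions by cross-multiplication is transitive only up to the middle denominator
  -- `d`. It is left standing as a common factor here and cancelled in `≃-trans`, where it is a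
  -- nonzero element of a domain.
  cross-trans : ∀ a b c d e f → a * d ≈ c * b → c * f ≈ e * d → d * (a * f) ≈ d * (e * b)
  cross-trans a b c d e f p r = begin
    d * (a * f)   ≈⟨ solve 3 (λ a d f → d :* (a :* f) := (a :* d) :* f) refl a d f ⟩
    (a * d) * f   ≈⟨ *-congʳ p ⟩
    (c * b) * f   ≈⟨ solve 3 (λ c b f → (c :* b) :* f := (c :* f) :* b) refl c b f ⟩
    (c * f) * b   ≈⟨ *-congʳ r ⟩
    (e * d) * b   ≈⟨ solve 3 (λ e d b → (e :* d) :* b := d :* (e :* b)) refl e d b ⟩
    d * (e * b)   ∎

  +-fromPoly : ∀ a b → (a * 1# + b * 1#) * 1# ≈ (a + b) * (1# * 1#)
  +-fromPoly = solve 2 (λ a b → (a :* con 1 :+ b :* con 1) :* con 1 := (a :+ b) :* (con 1 :* con 1)) refl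

  *-fromPoly : ∀ a b → (a * b) * 1# ≈ (a * b) * (1# * 1#)
  *-fromPoly = solve 2 (λ a b → (a :* b) :* con 1 := (a :* b) :* (con 1 :* con 1)) refl

  inverse-fromPoly : ∀ a → (a * 1#) * 1# ≈ 1# * (1# * a)
  inverse-fromPoly = solve 1 (λ a → (a :* con 1) :* con 1 := con 1 :* (con 1 :* a)) refl

-- The field ℚ(q) and evaluation at q = 0

module RationalFunctions where
  module ℚPoly = PolynomialRing ℚ.+-*-commutativeRing
  open ℚPoly using (_≋_; pointwise; at)
  private
    module PR = CommutativeRing ℚPoly.polynomialRing
    module FI = FractionIdentities ℚPoly.polynomialRing
  open Polynomial ℚ.+-*-rawRing using (coeff; _≈ᵖ_)
  open Fraction

  *-cancelˡ-poly : ∀ d p r → ¬ d ≈ᵖ [] → d PR.* p ≋ d PR.* r → p ≋ r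
  *-cancelˡ-poly d p r d≉0 e = PR.trans (PR.sym (difference p r))
    (PR.trans (PR.+-congʳ {r} difference≈0) (PR.+-identityˡ r))
    where
    open import Algebra.Properties.Ring PR.ring using (-‿distribʳ-*)
    difference : ∀ p r → (p PR.+ (PR.- r)) PR.+ r ≋ p
    difference p r = PR.trans (PR.+-assoc p (PR.- r) r)
      (PR.trans (PR.+-congˡ {p} (PR.-‿inverseˡ r)) (PR.+-identityʳ p))
    product≈0 : d PR.* (p PR.+ (PR.- r)) ≋ PR.0#
    product≈0 = PR.trans (PR.distribˡ d p (PR.- r))
      (PR.trans (PR.+-cong e (PR.sym (-‿distribʳ-* d r))) (PR.-‿inverseʳ (d PR.* r)))
    difference≈0 : p PR.+ (PR.- r) ≋ PR.0#
    -- The absence of zero divisors is available as a refutation only, so each coefficient is shown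
    -- to vanish by contradiction, which decidable equality in ℚ permits.
    difference≈0 = pointwise λ k → decidable-stable (_ ℚ.≟ _) λ ≢0 →
      *ᵖ-≉0 d (p PR.+ (PR.- r)) d≉0 (λ z → ≢0 (z k)) (at product≈0)

  infix 4 _≃_

  -- Equality in ℚ(q), wrapped for the same reason as _≋_.
  record _≃_ (x y : K.Carrier) : Set where
    constructor mk≃
    field equal : x K.≈ y

  open _≃_ public

  open import Algebra.Structures _≃_ using (IsCommutativeRing)

  abstract
    private
      cross : ∀ {x y} → x ≃ y → num x PR.* den y ≋ num y PR.* den x
      cross e = pointwise (equal e)

      uncross : ∀ {x y} → num x PR.* den y ≋ num y PR.* den x → x ≃ y
      uncross e = mk≃ (at e)

    ≃-refl : ∀ {x} → x ≃ x
    ≃-refl = mk≃ (λ _ → ≡.refl)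

    ≃-sym : ∀ {x y} → x ≃ y → y ≃ x
    ≃-sym e = uncross (PR.sym (cross e))

    ≃-trans : ∀ {x y z} → x ≃ y → y ≃ z → x ≃ z
    ≃-trans {x} {y} {z} e f = uncross (*-cancelˡ-poly (den y) _ _ (den≉0 y)
      (FI.cross-trans (num x) (den x) (num y) (den y) (num z) (den z) (cross e) (cross f)))

    private
      +-cong : ∀ {x x′ y y′} → x ≃ x′ → y ≃ y′ → (x K.+ y) ≃ (x′ K.+ y′)
      +-cong {x} {x′} {y} {y′} e f = uncross
        (FI.sum-cong {num x} {den x} {num y} {den y} {num x′} {den x′} {num y′} {den y′} (cross e) (cross f))

      *-cong : ∀ {x x′ y y′} → x ≃ x′ → y ≃ y′ → (x K.* y) ≃ (x′ K.* y′)
      *-cong {x} {x′} {y} {y′} e f = uncross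
        (FI.product-cong {num x} {den x} {num y} {den y} {num x′} {den x′} {num y′} {den y′} (cross e) (cross f))

      neg-cong : ∀ {x y} → x ≃ y → (K.- x) ≃ (K.- y)
      neg-cong {x} {y} e = uncross (FI.neg-cong {num x} {den x} {num y} {den y} (cross e))

      +-assoc : ∀ x y z → ((x K.+ y) K.+ z) ≃ (x K.+ (y K.+ z))
      +-assoc x y z = uncross (FI.sum-assoc (num x) (den x) (num y) (den y) (num z) (den z))

      +-comm : ∀ x y → (x K.+ y) ≃ (y K.+ x)
      +-comm x y = uncross (FI.sum-comm (num x) (den x) (num y) (den y))

      +-identityˡ : ∀ x → (K.0# K.+ x) ≃ x
      +-identityˡ x = uncross (FI.sum-identityˡ (num x) (den x))

      -‿inverseˡ : ∀ x → ((K.- x) K.+ x) ≃ K.0#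
      -‿inverseˡ x = uncross (FI.sum-inverseˡ (num x) (den x))

      *-assoc : ∀ x y z → ((x K.* y) K.* z) ≃ (x K.* (y K.* z))
      *-assoc x y z = uncross (FI.product-assoc (num x) (den x) (num y) (den y) (num z) (den z))

      *-comm : ∀ x y → (x K.* y) ≃ (y K.* x)
      *-comm x y = uncross (FI.product-comm (num x) (den x) (num y) (den y))

      *-identityˡ : ∀ x → (K.1# K.* x) ≃ x
      *-identityˡ x = uncross (FI.product-identityˡ (num x) (den x))

      distribˡ : ∀ x y z → (x K.* (y K.+ z)) ≃ ((x K.* y) K.+ (x K.* z))
      distribˡ x y z = uncross (FI.product-distribˡ (num x) (den x) (num y) (den y) (num z) (den z))

      distribʳ : ∀ x y z → ((y K.+ z) K.* x) ≃ ((y K.* x) K.+ (z K.* x))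
      distribʳ x y z = ≃-trans (*-comm (y K.+ z) x)
        (≃-trans (distribˡ x y z) (+-cong (*-comm x y) (*-comm x z)))

    ℚ⟨q⟩-isCommutativeRing : IsCommutativeRing K._+_ K._*_ K.-_ K.0# K.1#
    ℚ⟨q⟩-isCommutativeRing = record
      { isRing = record
        { +-isAbelianGroup = record
          { isGroup = record
            { isMonoid = record
              { isSemigroup = record
                { isMagma = record
                  { isEquivalence = record { refl = ≃-refl ; sym = ≃-sym ; trans = ≃-trans }
                  ; ∙-cong = +-cong }
                ; assoc = +-assoc }
              ; identity = +-identityˡ , λ x → ≃-trans (+-comm x K.0#) (+-identityˡ x) }
            ; inverse = -‿inverseˡ , λ x → ≃-trans (+-comm x (K.- x)) (-‿inverseˡ x)
            ; ⁻¹-cong = neg-cong }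
          ; comm = +-comm }
        ; *-cong = *-cong
        ; *-assoc = *-assoc
        ; *-identity = *-identityˡ , λ x → ≃-trans (*-comm x K.1#) (*-identityˡ x)
        ; distrib = distribˡ , distribʳ }
      ; *-comm = *-comm }

  ℚ⟨q⟩-ring : CommutativeRing 0ℓ 0ℓ
  ℚ⟨q⟩-ring = record { isCommutativeRing = ℚ⟨q⟩-isCommutativeRing }

  module F = CommutativeRing ℚ⟨q⟩-ring

  -- Evaluation at q = 0 on the image of ℚ[q] in ℚ(q). It is a relation because a fraction such as
  -- q/q equals a polynomial without being written as one. The traces lie in this image, and the
  -- elimination keeps its entries there.
  ConstantTerm : K.Carrier → ℚ → Set
  ConstantTerm x r = ∃ λ p → x ≃ fromPoly p × coeff p 0 ≡ r

  abstract
    constantTerm-≃ : ∀ {x y r} → x ≃ y → ConstantTerm x r → ConstantTerm y r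
    constantTerm-≃ e (p , f , c) = p , F.trans (F.sym e) f , c

    constantTerm-0 : ConstantTerm K.0# 0ℚ
    constantTerm-0 = [] , F.refl , ≡.refl

    constantTerm-1 : ConstantTerm K.1# 1ℚ
    constantTerm-1 = 1ℚ ∷ [] , F.refl , ≡.refl

    constantTerm-q : ConstantTerm q 0ℚ
    constantTerm-q = 0ℚ ∷ 1ℚ ∷ [] , F.refl , ≡.refl

    constantTerm-+ : ∀ {x y r s} → ConstantTerm x r → ConstantTerm y s → ConstantTerm (x K.+ y) (r ℚ.+ s)
    constantTerm-+ (p , e , c) (p′ , e′ , c′) = p PR.+ p′
      , F.trans (F.+-cong e e′) (mk≃ (at (FI.+-fromPoly p p′)))
      , ≡.trans (ℚPoly.coeff₀-+ p p′) (≡.cong₂ ℚ._+_ c c′)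

    constantTerm-* : ∀ {x y r s} → ConstantTerm x r → ConstantTerm y s → ConstantTerm (x K.* y) (r ℚ.* s)
    constantTerm-* (p , e , c) (p′ , e′ , c′) = p PR.* p′
      , F.trans (F.*-cong e e′) (mk≃ (at (FI.*-fromPoly p p′)))
      , ≡.trans (ℚPoly.coeff₀-* p p′) (≡.cong₂ ℚ._*_ c c′)

    constantTerm-neg : ∀ {x r} → ConstantTerm x r → ConstantTerm (K.- x) (ℚ.- r)
    constantTerm-neg (p , e , c) = PR.- p
      , F.trans (F.-‿cong e) F.refl
      , ≡.trans (ℚPoly.coeff₀-neg p) (≡.cong ℚ.-_ c)

    -- A polynomial with nonzero constant term is nonzero, so it may serve as a denominator. The
    -- inverse is a mere element of ℚ(q) and comes without a constant term of its own.
    invertible : ∀ {x r} → ConstantTerm x r → r ≢ 0ℚ → ∃ λ y → x F.* y F.≈ K.1#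
    invertible (p , e , c) r≢0 = fraction (1ℚ ∷ []) p p≉0
      , F.trans (F.*-congʳ {fraction (1ℚ ∷ []) p p≉0} e) (mk≃ (at (FI.inverse-fromPoly p)))
      where
      p≉0 : ¬ p ≈ᵖ []
      p≉0 p≈0 = r≢0 (≡.trans (≡.sym c) (p≈0 0))

    private
      coeff-map : ∀ p k → coeff (List.map (ℚ._/ 1) p) k ≡ (Polynomial.coeff ℤ.+-*-rawRing p k) ℚ./ 1
      coeff-map []      k       = ≡.refl
      coeff-map (a ∷ p) zero    = ≡.refl
      coeff-map (a ∷ p) (suc k) = coeff-map p k

    fromPoly-cong : ∀ {p r} → p ≋ r → fromPoly p ≃ fromPoly r
    fromPoly-cong {p} {r} e = mk≃ (at (PR.*-congʳ {PR.1#} {p} {r} e))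

    ι-cong : ∀ {p r} → Polynomial._≈ᵖ_ ℤ.+-*-rawRing p r → ι p ≃ ι r
    ι-cong {p} {r} e = fromPoly-cong {List.map (ℚ._/ 1) p} {List.map (ℚ._/ 1) r} (pointwise λ k →
      ≡.trans (coeff-map p k) (≡.trans (≡.cong (ℚ._/ 1) (e k)) (≡.sym (coeff-map r k))))

open RationalFunctions

-- Words, descents and adjacent swaps

module Words where
  open import Data.Nat.Base using (_+_; _*_)
  open import Relation.Binary.PropositionalEquality

  data Order : Set where
    lt eq gt : Order

  flip : Order → Order
  flip lt = gt
  flip eq = eq
  flip gt = lt

  order : ℕ → ℕ → Order
  order zero    zero    = eq
  order zero    (suc b) = lt
  order (suc a) zero    = gt
  order (suc a) (suc b) = order a b

  order-flip : ∀ a b → order b a ≡ flip (order a b)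
  order-flip zero    zero    = refl
  order-flip zero    (suc b) = refl
  order-flip (suc a) zero    = refl
  order-flip (suc a) (suc b) = order-flip a b

  order-refl : ∀ a → order a a ≡ eq
  order-refl zero    = refl
  order-refl (suc a) = order-refl a

  order-eq : ∀ a b → order a b ≡ eq → a ≡ b
  order-eq zero    zero    _ = refl
  order-eq (suc a) (suc b) p = cong suc (order-eq a b p)

  order-lt : ∀ a b → order a b ≡ lt → a < b
  order-lt zero    (suc b) _ = z<s
  order-lt (suc a) (suc b) p = s<s (order-lt a b p)

  order-gt : ∀ a b → order a b ≡ gt → b < a
  order-gt a b p = order-lt b a (trans (order-flip a b) (cong flip p))

  order-<⇒lt : ∀ {a b} → a < b → order a b ≡ lt
  order-<⇒lt {zero}  {suc b} _       = refl
  order-<⇒lt {suc a} {suc b} (s≤s p) = order-<⇒lt p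

  -- The possible values of (order a b , order b c , order a c).
  data Consistent : Order → Order → Order → Set where
    eqˡ   : ∀ {o} → Consistent eq o o
    eqʳ   : ∀ {o} → o ≢ eq → Consistent o eq o
    lt-lt : Consistent lt lt lt
    gt-gt : Consistent gt gt gt
    lt-gt : ∀ {o} → Consistent lt gt o
    gt-lt : ∀ {o} → Consistent gt lt o

  consistent : ∀ a b c → Consistent (order a b) (order b c) (order a c)
  consistent zero    zero    c       = eqˡ
  consistent zero    (suc b) zero    = lt-gt
  consistent (suc a) zero    (suc c) = gt-lt
  consistent (suc a) zero    zero    = eqʳ λ ()
  consistent (suc a) (suc b) (suc c) = consistent a b c
  consistent zero    (suc b) (suc c) with order b c
  ... | lt = lt-lt
  ... | eq = eqʳ λ ()
  ... | gt = lt-gt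
  consistent (suc a) (suc b) zero    with order a b
  ... | lt = lt-gt
  ... | eq = eqˡ
  ... | gt = gt-gt

  consistent-comm : ∀ {o₁ o₂ o₃} → Consistent o₁ o₂ o₃ → Consistent o₂ o₁ o₃
  consistent-comm {o₂ = lt} eqˡ     = eqʳ λ ()
  consistent-comm {o₂ = eq} eqˡ     = eqˡ
  consistent-comm {o₂ = gt} eqˡ     = eqʳ λ ()
  consistent-comm (eqʳ _) = eqˡ
  consistent-comm lt-lt   = lt-lt
  consistent-comm gt-gt   = gt-gt
  consistent-comm lt-gt   = gt-lt
  consistent-comm gt-lt   = lt-gt

  Word : ℕ → Set
  Word = Vec ℕ

  orderAt : ∀ {n} → Fin (pred n) → Word n → Order
  orderAt {suc (suc n)} zero    (a ∷ b ∷ w) = order a b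
  orderAt {suc (suc n)} (suc i) (a ∷ w)     = orderAt i w

  swap : ∀ {n} → Fin (pred n) → Word n → Word n
  swap {suc (suc n)} zero    (a ∷ b ∷ w) = b ∷ a ∷ w
  swap {suc (suc n)} (suc i) (a ∷ w)     = a ∷ swap i w

  swap-involutive : ∀ {n} (i : Fin (pred n)) (w : Word n) → swap i (swap i w) ≡ w
  swap-involutive {suc (suc n)} zero    (a ∷ b ∷ w) = refl
  swap-involutive {suc (suc n)} (suc i) (a ∷ w)     = cong (a ∷_) (swap-involutive i w)

  orderAt-swap : ∀ {n} (i : Fin (pred n)) (w : Word n) → orderAt i (swap i w) ≡ flip (orderAt i w)
  orderAt-swap {suc (suc n)} zero    (a ∷ b ∷ w) = order-flip a b
  orderAt-swap {suc (suc n)} (suc i) (a ∷ w)     = orderAt-swap i w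

  swap-↭ : ∀ {n} (i : Fin (pred n)) (w : Word n) → toList (swap i w) ↭ toList w
  swap-↭ {suc (suc n)} zero    (a ∷ b ∷ w) = Perm.↭-swap b a Perm.↭-refl
  swap-↭ {suc (suc n)} (suc i) (a ∷ w)     = Perm.prep a (swap-↭ i w)

  swap-eq : ∀ {n} (i : Fin (pred n)) (w : Word n) → orderAt i w ≡ eq → swap i w ≡ w
  swap-eq {suc (suc n)} zero    (a ∷ b ∷ w) p rewrite order-eq a b p = refl
  swap-eq {suc (suc n)} (suc i) (a ∷ w)     p = cong (a ∷_) (swap-eq i w p)

  swap-comm : ∀ {n} (i j : Fin (pred n)) → 2 ≤ ∣ toℕ i - toℕ j ∣ → ∀ (w : Word n) →
              swap i (swap j w) ≡ swap j (swap i w)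
  swap-comm {suc (suc (suc n))} zero (suc (suc j)) _ (a ∷ b ∷ w) = refl
  swap-comm {suc (suc (suc n))} (suc (suc i)) zero _ (a ∷ b ∷ w) = refl
  swap-comm {suc (suc (suc n))} zero    (suc zero) (s≤s ()) w
  swap-comm {suc (suc (suc n))} (suc zero) zero (s≤s ()) w
  swap-comm {suc (suc n)} zero zero () w
  swap-comm {suc (suc n)}       (suc i) (suc j)       d (a ∷ w) = cong (a ∷_) (swap-comm i j d w)

  orderAt-far : ∀ {n} (i j : Fin (pred n)) → 2 ≤ ∣ toℕ i - toℕ j ∣ → ∀ (w : Word n) →
                orderAt i (swap j w) ≡ orderAt i w
  orderAt-far {suc (suc (suc n))} zero (suc (suc j)) _ (a ∷ b ∷ w) = refl
  orderAt-far {suc (suc (suc n))} (suc (suc i)) zero _ (a ∷ b ∷ w) = refl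
  orderAt-far {suc (suc (suc n))} zero    (suc zero) (s≤s ()) w
  orderAt-far {suc (suc (suc n))} (suc zero) zero (s≤s ()) w
  orderAt-far {suc (suc n)} zero zero () w
  orderAt-far {suc (suc n)}       (suc i) (suc j)       d (a ∷ w) = orderAt-far i j d w

  -- For the letters a, b, c at two adjacent positions: `outer` compares a with c in two ways, and
  -- the moved pairs are the original neighbours after the third letter has passed across them. The
  -- formulation is symmetric in i and j, so it covers both j = i + 1 and i = j + 1.
  record BraidPattern {n} (i j : Fin (pred n)) (w : Word n) : Set where
    field
      swap-braid : swap i (swap j (swap i w)) ≡ swap j (swap i (swap j w))
      outer      : orderAt j (swap i w) ≡ orderAt i (swap j w)
      movedʲ     : orderAt i (swap j (swap i w)) ≡ orderAt j w
      movedⁱ     : orderAt j (swap i (swap j w)) ≡ orderAt i w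
      triple     : Consistent (orderAt i w) (orderAt j w) (orderAt i (swap j w))

  braidPattern : ∀ {n} (i j : Fin (pred n)) → ∣ toℕ i - toℕ j ∣ ≡ 1 → ∀ (w : Word n) → BraidPattern i j w
  braidPattern {suc (suc (suc n))} zero (suc zero) _ (a ∷ b ∷ c ∷ w) = record
    { swap-braid = refl ; outer = refl ; movedʲ = refl ; movedⁱ = refl ; triple = consistent a b c }
  braidPattern {suc (suc (suc n))} (suc zero) zero _ (a ∷ b ∷ c ∷ w) = record
    { swap-braid = refl ; outer = refl ; movedʲ = refl ; movedⁱ = refl
    ; triple = consistent-comm (consistent a b c) }
  braidPattern {suc (suc n)} zero zero () w
  braidPattern {suc (suc n)} (suc i) (suc j) d (a ∷ w) = record
    { swap-braid = cong (a ∷_) swap-braid ; outer = outer ; movedʲ = movedʲ ; movedⁱ = movedⁱ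
    ; triple = triple }
    where open BraidPattern (braidPattern i j d w)

  -- A substitute for the number of inversions: each letter is multiplied by the number of positions
  -- to its right, so undoing a descent a > b lowers the weight by a - b. It is the measure for all
  -- inductions on sorting and also the order in which values at q = 0 are triangular.
  weight : ∀ {n} → Word n → ℕ
  weight {zero}  []      = 0
  weight {suc n} (a ∷ w) = n * a + weight w

  weight-swap : ∀ {n} (i : Fin (pred n)) (w : Word n) → orderAt i w ≡ gt → weight (swap i w) < weight w
  weight-swap {suc (suc n)} (suc i) (a ∷ w) p = ℕ.+-monoʳ-< (suc n * a) (weight-swap i w p)
  weight-swap {suc (suc n)} zero (a ∷ b ∷ w) p =
    subst₂ _<_ (move b a) (move′ a b) (ℕ.+-monoˡ-< (n * a + n * b + weight w) (order-gt a b p))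
    where
    move : ∀ b a → b + (n * a + n * b + weight w) ≡ suc n * b + (n * a + weight w)
    move b a = solve 4 (λ x y b z → b :+ (x :+ y :+ z) := (b :+ y) :+ (x :+ z)) refl (n * a) (n * b) b (weight w)
      where open ℕSolver.+-*-Solver
    move′ : ∀ a b → a + (n * a + n * b + weight w) ≡ suc n * a + (n * b + weight w)
    move′ a b = solve 4 (λ x y b z → b :+ (x :+ y :+ z) := (b :+ x) :+ (y :+ z)) refl (n * a) (n * b) a (weight w)
      where open ℕSolver.+-*-Solver

open Words

-- The operators T_i on functions on words

module LocalAction (R : CommutativeRing 0ℓ 0ℓ) (p q m : CommutativeRing.Carrier R) where
  open CommutativeRing R
  open import Relation.Binary.Reasoning.Setoid setoid
  open import Algebra.Solver.Ring.NaturalCoefficients.Default commutativeSemiring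

  -- (T_i v)(w) in terms of v w and v (s_i w), given the order of the letters
  -- of w at i and i + 1, where T_i² = p T_i + q and m is a root of this equation.
  mix : Order → Carrier → Carrier → Carrier
  mix lt x y = q * y
  mix eq x y = m * x
  mix gt x y = y + p * x

  -- The column of the matrix of T_i at a word w: the coefficients of w and of s_i w in T_i w. Since
  -- `mix` reads the same matrix by rows, the entry that comes from s_i w carries the flipped order
  -- in `mix-matrix`.
  diagonal offDiagonal : Order → Carrier
  diagonal lt = 0#
  diagonal eq = m
  diagonal gt = p
  offDiagonal lt = 1#
  offDiagonal eq = 0#
  offDiagonal gt = q

  mix-matrix : ∀ o x y → x * diagonal o + y * offDiagonal (flip o) ≈ mix o x y
  mix-matrix lt = solve 3 (λ q x y → x :* con 0 :+ y :* q := q :* y) refl q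
  mix-matrix eq = solve 3 (λ m x y → x :* m :+ y :* con 0 := m :* x) refl m
  mix-matrix gt = solve 3 (λ p x y → x :* p :+ y :* con 1 := y :+ p :* x) refl p

  mix-cong : ∀ o {x x′ y y′} → x ≈ x′ → y ≈ y′ → mix o x y ≈ mix o x′ y′
  mix-cong lt e f = *-congˡ f
  mix-cong eq e f = *-congˡ e
  mix-cong gt e f = +-cong f (*-congˡ e)

  mix-+ : ∀ o x y x′ y′ → mix o (x + x′) (y + y′) ≈ mix o x y + mix o x′ y′
  mix-+ lt x y x′ y′ = distribˡ q y y′
  mix-+ eq x y x′ y′ = distribˡ m x x′
  mix-+ gt = solve 5 (λ p x y x′ y′ → y :+ y′ :+ p :* (x :+ x′) := (y :+ p :* x) :+ (y′ :+ p :* x′)) refl p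

  mix-* : ∀ o c x y → mix o (c * x) (c * y) ≈ c * mix o x y
  mix-* lt c x y = solve 3 (λ q c y → q :* (c :* y) := c :* (q :* y)) refl q c y
  mix-* eq c x y = solve 3 (λ q c y → q :* (c :* y) := c :* (q :* y)) refl m c x
  mix-* gt = solve 4 (λ p c x y → c :* y :+ p :* (c :* x) := c :* (y :+ p :* x)) refl p

  mix-zero : ∀ o → mix o 0# 0# ≈ 0#
  mix-zero lt = zeroʳ q
  mix-zero eq = zeroʳ m
  mix-zero gt = trans (+-identityˡ _) (zeroʳ p)

  -- Linearity of `mix o′` lets it pass through `mix o`. The four values are those at w, s_i w, s_j
  -- w and s_i s_j w for distant i and j.
  mix-comm : ∀ o o′ x₁ x₂ x₃ x₄ →
    mix o (mix o′ x₁ x₃) (mix o′ x₂ x₄) ≈ mix o′ (mix o x₁ x₂) (mix o x₃ x₄)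
  mix-comm lt o′ x₁ x₂ x₃ x₄ = sym (mix-* o′ q x₂ x₄)
  mix-comm eq o′ x₁ x₂ x₃ x₄ = sym (mix-* o′ m x₁ x₃)
  mix-comm gt o′ x₁ x₂ x₃ x₄ = begin
    mix o′ x₂ x₄ + p * mix o′ x₁ x₃             ≈⟨ +-congˡ (sym (mix-* o′ p x₁ x₃)) ⟩
    mix o′ x₂ x₄ + mix o′ (p * x₁) (p * x₃)     ≈⟨ sym (mix-+ o′ x₂ x₄ (p * x₁) (p * x₃)) ⟩
    mix o′ (x₂ + p * x₁) (x₄ + p * x₃)          ∎

  module _ (root : m * m ≈ p * m + q) where

    mix-quadratic : ∀ o x y → mix o (mix o x y) (mix (flip o) y x) ≈ p * mix o x y + q * x
    mix-quadratic lt = solve 4 (λ p q x y → q :* (x :+ p :* y) := p :* (q :* y) :+ q :* x) refl p q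
    mix-quadratic eq x y = begin
      m * (m * x)           ≈⟨ sym (*-assoc m m x) ⟩
      m * m * x             ≈⟨ *-congʳ root ⟩
      (p * m + q) * x       ≈⟨ solve 4 (λ p q m x → (p :* m :+ q) :* x := p :* (m :* x) :+ q :* x) refl p q m x ⟩
      p * (m * x) + q * x   ∎
    mix-quadratic gt = solve 4 (λ p q x y → q :* x :+ p :* (y :+ p :* x) := p :* (y :+ p :* x) :+ q :* x) refl p q

    -- With a, b, c the letters involved, x₁ … x₆ are the values at
    -- abc, bac, acb, bca, cab, cba.
    mix-braid : ∀ {o₁ o₂ o₃} → Consistent o₁ o₂ o₃ → ∀ x₁ x₂ x₃ x₄ x₅ x₆ →
      mix o₁ (mix o₂ (mix o₁ x₁ x₂) (mix o₃ x₃ x₅)) (mix o₃ (mix (flip o₁) x₂ x₁) (mix o₂ x₄ x₆)) ≈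
      mix o₂ (mix o₁ (mix o₂ x₁ x₃) (mix o₃ x₂ x₄)) (mix o₃ (mix (flip o₂) x₃ x₁) (mix o₁ x₅ x₆))
    mix-braid (eqˡ {lt}) x₁ x₂ x₃ x₄ x₅ x₆ =
      solve 3 (λ q m x₅ → m :* (q :* (q :* x₅)) := q :* (q :* (m :* x₅))) refl q m x₅
    mix-braid (eqˡ {eq}) x₁ x₂ x₃ x₄ x₅ x₆ = refl
    -- Here the two sides differ by p x₁ (m² - p m - q), so the equation for m enters; likewise in
    -- the mirror case `eqʳ {gt}`. The other cases are identities in free p, q and m.
    mix-braid (eqˡ {gt}) x₁ x₂ x₃ x₄ x₅ x₆ = begin
      m * (x₅ + p * x₃ + p * (m * x₁))
        ≈⟨ solve 5 (λ p m x₁ x₃ x₅ → m :* (x₅ :+ p :* x₃ :+ p :* (m :* x₁)) :=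
             m :* x₅ :+ p :* (m :* x₃) :+ p :* x₁ :* (m :* m)) refl p m x₁ x₃ x₅ ⟩
      m * x₅ + p * (m * x₃) + p * x₁ * (m * m)
        ≈⟨ +-congˡ (*-congˡ root) ⟩
      m * x₅ + p * (m * x₃) + p * x₁ * (p * m + q)
        ≈⟨ solve 6 (λ p q m x₁ x₃ x₅ → m :* x₅ :+ p :* (m :* x₃) :+ p :* x₁ :* (p :* m :+ q) :=
             m :* x₅ :+ p :* (q :* x₁) :+ p :* (m :* (x₃ :+ p :* x₁))) refl p q m x₁ x₃ x₅ ⟩
      m * x₅ + p * (q * x₁) + p * (m * (x₃ + p * x₁)) ∎
    mix-braid (eqʳ {lt} _) x₁ x₂ x₃ x₄ x₅ x₆ =
      solve 3 (λ q m x₄ → q :* (q :* (m :* x₄)) := m :* (q :* (q :* x₄))) refl q m x₄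
    mix-braid (eqʳ {eq} ≢) x₁ x₂ x₃ x₄ x₅ x₆ = ⊥-elim (≢ ≡.refl)
    mix-braid (eqʳ {gt} _) x₁ x₂ x₃ x₄ x₅ x₆ = sym (begin
      m * (x₄ + p * x₂ + p * (m * x₁))
        ≈⟨ solve 5 (λ p m x₁ x₃ x₅ → m :* (x₅ :+ p :* x₃ :+ p :* (m :* x₁)) :=
             m :* x₅ :+ p :* (m :* x₃) :+ p :* x₁ :* (m :* m)) refl p m x₁ x₂ x₄ ⟩
      m * x₄ + p * (m * x₂) + p * x₁ * (m * m)
        ≈⟨ +-congˡ (*-congˡ root) ⟩
      m * x₄ + p * (m * x₂) + p * x₁ * (p * m + q)
        ≈⟨ solve 6 (λ p q m x₁ x₃ x₅ → m :* x₅ :+ p :* (m :* x₃) :+ p :* x₁ :* (p :* m :+ q) :=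
             m :* x₅ :+ p :* (q :* x₁) :+ p :* (m :* (x₃ :+ p :* x₁))) refl p q m x₁ x₂ x₄ ⟩
      m * x₄ + p * (q * x₁) + p * (m * (x₂ + p * x₁)) ∎)
    mix-braid lt-lt x₁ x₂ x₃ x₄ x₅ x₆ = refl
    mix-braid gt-gt = solve 9 (λ p q m x₁ x₂ x₃ x₄ x₅ x₆ →
      ((x₆ :+ p :* x₄) :+ p :* (q :* x₁)) :+ p :* ((x₅ :+ p :* x₃) :+ p :* (x₂ :+ p :* x₁)) :=
      ((x₆ :+ p :* x₅) :+ p :* (q :* x₁)) :+ p :* ((x₄ :+ p :* x₂) :+ p :* (x₃ :+ p :* x₁))) refl p q m
    mix-braid (lt-gt {lt}) = solve 9 (λ p q m x₁ x₂ x₃ x₄ x₅ x₆ →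
      q :* (q :* (x₆ :+ p :* x₄)) :=
      (q :* (q :* x₆)) :+ p :* (q :* (q :* x₄))) refl p q m
    mix-braid (lt-gt {eq}) = solve 9 (λ p q m x₁ x₂ x₃ x₄ x₅ x₆ →
      q :* (m :* (x₁ :+ p :* x₂)) :=
      (m :* (q :* x₁)) :+ p :* (q :* (m :* x₂))) refl p q m
    mix-braid (lt-gt {gt}) = solve 9 (λ p q m x₁ x₂ x₃ x₄ x₅ x₆ →
      q :* ((x₆ :+ p :* x₄) :+ p :* (x₁ :+ p :* x₂)) :=
      ((q :* x₆) :+ p :* (q :* x₁)) :+ p :* (q :* (x₄ :+ p :* x₂))) refl p q m
    mix-braid (gt-lt {lt}) = solve 9 (λ p q m x₁ x₂ x₃ x₄ x₅ x₆ →
      (q :* (q :* x₆)) :+ p :* (q :* (q :* x₅)) :=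
      q :* (q :* (x₆ :+ p :* x₅))) refl p q m
    mix-braid (gt-lt {eq}) = solve 9 (λ p q m x₁ x₂ x₃ x₄ x₅ x₆ →
      (m :* (q :* x₁)) :+ p :* (q :* (m :* x₃)) :=
      q :* (m :* (x₁ :+ p :* x₃))) refl p q m
    mix-braid (gt-lt {gt}) = solve 9 (λ p q m x₁ x₂ x₃ x₄ x₅ x₆ →
      ((q :* x₆) :+ p :* (q :* x₁)) :+ p :* (q :* (x₅ :+ p :* x₃)) :=
      q :* ((x₆ :+ p :* x₅) :+ p :* (x₁ :+ p :* x₃))) refl p q m

  module _ {n : ℕ} where

    infix 4 _≋_

    _≋_ : (u v : Word n → Carrier) → Set
    u ≋ v = ∀ w → u w ≈ v w

    T· : Fin (pred n) → (Word n → Carrier) → Word n → Carrier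
    T· i v w = mix (orderAt i w) (v w) (v (swap i w))

    T·-cong : ∀ i {u v} → u ≋ v → T· i u ≋ T· i v
    T·-cong i e w = mix-cong (orderAt i w) (e w) (e (swap i w))

    _≟ʷ_ : (u v : Word n) → Dec (u ≡ v)
    _≟ʷ_ = Vec.≡-dec ℕ._≟_

    δ : Word n → Word n → Carrier
    δ u w = if does (w ≟ʷ u) then 1# else 0#

    δ-≡ : ∀ {u w} → w ≡ u → δ u w ≈ 1#
    δ-≡ {u} {w} e = reflexive (≡.cong (if_then 1# else 0#) (dec-true (w ≟ʷ u) e))

    δ-≢ : ∀ {u w} → w ≢ u → δ u w ≈ 0#
    δ-≢ {u} {w} w≢u = reflexive (≡.cong (if_then 1# else 0#) (dec-false (w ≟ʷ u) w≢u))

    private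
      gt-not-lt : ∀ {o} {A : Set} → o ≡ gt → flip o ≡ gt → A
      gt-not-lt ≡.refl ()

      swap-adjoint : ∀ i {u w : Word n} → swap i w ≡ u → w ≡ swap i u
      swap-adjoint i {u} {w} e = ≡.trans (≡.sym (swap-involutive i w)) (≡.cong (swap i) e)

      T·-at : ∀ i v w {o} → orderAt i w ≡ o → T· i v w ≈ mix o (v w) (v (swap i w))
      T·-at i v w ≡.refl = refl

      T·-vanish : ∀ i v w → v w ≈ 0# → v (swap i w) ≈ 0# → T· i v w ≈ 0#
      T·-vanish i v w z z′ = trans (mix-cong (orderAt i w) z z′) (mix-zero (orderAt i w))

    T·-δ-eq : ∀ i u → orderAt i u ≡ eq → ∀ w → T· i (δ u) w ≈ m * δ u w
    T·-δ-eq i u e w = go (w ≟ʷ u)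
      where
      go : Dec (w ≡ u) → T· i (δ u) w ≈ m * δ u w
      go (yes ≡.refl) = T·-at i (δ u) u e
      go (no w≢u) = trans
        (T·-vanish i (δ u) w (δ-≢ w≢u) (δ-≢ λ e′ → w≢u (≡.trans (swap-adjoint i e′) (swap-eq i u e))))
        (sym (trans (*-congˡ (δ-≢ w≢u)) (zeroʳ m)))

    -- The counterpart on functions of the constructor `step` of `Standard`: the word u is produced
    -- from the word with this descent removed. The coordinates of standard vectors follow by the
    -- same recursion.
    T·-δ-gt : ∀ i u → orderAt i u ≡ gt → ∀ w → T· i (δ (swap i u)) w ≈ δ u w
    T·-δ-gt i u e w = go (w ≟ʷ u) (w ≟ʷ swap i u)
      where
      u≢su : u ≢ swap i u
      u≢su e′ = gt-not-lt e (≡.trans (≡.sym (orderAt-swap i u))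
        (≡.trans (≡.sym (≡.cong (orderAt i) e′)) e))
      go : Dec (w ≡ u) → Dec (w ≡ swap i u) → T· i (δ (swap i u)) w ≈ δ u w
      go (yes ≡.refl) _ = begin
        T· i (δ (swap i u)) u                               ≈⟨ T·-at i (δ (swap i u)) u e ⟩
        δ (swap i u) (swap i u) + p * δ (swap i u) u        ≈⟨ +-cong (δ-≡ {swap i u} ≡.refl) (*-congˡ (δ-≢ u≢su)) ⟩
        1# + p * 0#                                         ≈⟨ trans (+-congˡ (zeroʳ p)) (+-identityʳ 1#) ⟩
        1#                                                  ≈⟨ sym (δ-≡ {u} ≡.refl) ⟩
        δ u u                                               ∎
      go (no w≢u) (yes ≡.refl) = begin
        T· i (δ (swap i u)) (swap i u)                      ≈⟨ T·-at i (δ (swap i u)) (swap i u)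
                                                                 (≡.trans (orderAt-swap i u) (≡.cong flip e)) ⟩
        q * δ (swap i u) (swap i (swap i u))                ≈⟨ *-congˡ (δ-≢ λ e′ → w≢u
                                                                 (≡.trans (≡.sym e′) (swap-involutive i u))) ⟩
        q * 0#                                              ≈⟨ trans (zeroʳ q) (sym (δ-≢ w≢u)) ⟩
        δ u (swap i u)                                      ∎
      go (no w≢u) (no w≢su) = trans
        (T·-vanish i (δ (swap i u)) w (δ-≢ w≢su)
          (δ-≢ λ e′ → w≢u (≡.trans (swap-adjoint i e′) (swap-involutive i u))))
        (sym (δ-≢ w≢u))

    module _ (root : m * m ≈ p * m + q) where

      T·-quadratic : ∀ i v w → T· i (T· i v) w ≈ p * T· i v w + q * v w
      T·-quadratic i v w rewrite swap-involutive i w | orderAt-swap i w =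
        mix-quadratic root (orderAt i w) (v w) (v (swap i w))

      T·-commute : ∀ i j → 2 ℕ.≤ ∣ toℕ i - toℕ j ∣ → 2 ℕ.≤ ∣ toℕ j - toℕ i ∣ →
                   ∀ v → T· i (T· j v) ≋ T· j (T· i v)
      T·-commute i j d d′ v w
        rewrite orderAt-far i j d w | orderAt-far j i d′ w | swap-comm i j d w =
        mix-comm (orderAt i w) (orderAt j w) (v w) (v (swap i w)) (v (swap j w)) (v (swap j (swap i w)))

      T·-braid : ∀ i j → ∣ toℕ i - toℕ j ∣ ≡ 1 →
                 ∀ v → T· i (T· j (T· i v)) ≋ T· j (T· i (T· j v))
      T·-braid i j d v w
        -- The rewriting leaves only the six rearrangements of the three letters as arguments of v,
        -- and only their three pairwise comparisons as orders.
        rewrite swap-involutive i w | swap-involutive j w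
              | orderAt-swap i w | orderAt-swap j w
              | BraidPattern.outer (braidPattern i j d w)
              | BraidPattern.movedʲ (braidPattern i j d w)
              | BraidPattern.movedⁱ (braidPattern i j d w)
              | BraidPattern.swap-braid (braidPattern i j d w) =
        mix-braid root (BraidPattern.triple (braidPattern i j d w))
          (v w) (v (swap i w)) (v (swap j w)) (v (swap j (swap i w))) (v (swap i (swap j w)))
          (v (swap j (swap i (swap j w))))

-- The Hecke algebra acting on words

module TensorAction where
  module _ (R : CommutativeRing 0ℓ 0ℓ) where
    open CommutativeRing R
    open import Algebra.Properties.Ring ring using (-‿distribʳ-*; -1*x≈-x; -‿involutive)
    open import Relation.Binary.Reasoning.Setoid setoid

    -- The quadratic relation factors as (T + 1)(T - q) = 0. Of the two scalars by which a generator
    -- may act on equal letters, -1 is the one that matches the sign character.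
    -1-root : ∀ q → - 1# * - 1# ≈ (q + - 1#) * - 1# + q
    -1-root q = begin
      - 1# * - 1#              ≈⟨ trans (-1*x≈-x (- 1#)) (-‿involutive 1#) ⟩
      1#                       ≈⟨ sym (+-identityʳ 1#) ⟩
      1# + 0#                  ≈⟨ +-congˡ (sym (-‿inverseˡ q)) ⟩
      1# + (- q + q)           ≈⟨ sym (+-assoc 1# (- q) q) ⟩
      1# + - q + q             ≈⟨ +-congʳ (+-comm 1# (- q)) ⟩
      - q + 1# + q             ≈⟨ +-congʳ (+-cong (trans (-‿cong (sym (*-identityʳ q))) (-‿distribʳ-* q 1#))
                                    (sym (trans (-1*x≈-x (- 1#)) (-‿involutive 1#)))) ⟩
      q * - 1# + - 1# * - 1# + q ≈⟨ +-congʳ (sym (distribʳ (- 1#) q (- 1#))) ⟩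
      (q + - 1#) * - 1# + q    ∎

  p -1ᴷ : K.Carrier
  p   = q K.+ K.- K.1#
  -1ᴷ = K.- K.1#

  open LocalAction ℚ⟨q⟩-ring p q -1ᴷ public

  root : -1ᴷ F.* -1ᴷ F.≈ p F.* -1ᴷ F.+ q
  root = -1-root ℚ⟨q⟩-ring q

  module HeckeAction (n : ℕ) where
    open Hecke n
    open import Algebra.Properties.Ring F.ring using (-‿distribʳ-*; -‿+-comm)

    Tensor : Set
    Tensor = Word n → K.Carrier

    -- The functions live on all words of length n, so one representation serves every μ: swaps
    -- preserve the content, and the words of a single content carry the induced module.
    act : H → Tensor → Tensor
    act (T i)   v   = T· i v
    act (κ c)   v w = c K.* v w
    act (a ⊕ b) v w = act a v w K.+ act b v w
    act (a ⊛ b) v   = act a (act b v)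
    act (⊖ a)   v w = K.- act a v w

    act-cong : ∀ a {u v} → u ≋ v → act a u ≋ act a v
    act-cong (T i)   e   = T·-cong i e
    act-cong (κ c)   e w = F.*-congˡ {c} (e w)
    act-cong (a ⊕ b) e w = F.+-cong (act-cong a e w) (act-cong b e w)
    act-cong (a ⊛ b) e   = act-cong a (act-cong b e)
    act-cong (⊖ a)   e w = F.-‿cong (act-cong a e w)

    act-+ : ∀ a u v → act a (λ w → u w K.+ v w) ≋ λ w → act a u w K.+ act a v w
    act-+ (T i)   u v w = mix-+ (orderAt i w) _ _ _ _
    act-+ (κ c)   u v w = F.distribˡ c (u w) (v w)
    act-+ (a ⊕ b) u v w = F.trans (F.+-cong (act-+ a u v w) (act-+ b u v w))
      (interchange (act a u w) (act a v w) (act b u w) (act b v w))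
      where open import Algebra.Properties.CommutativeSemigroup F.+-commutativeSemigroup using (interchange)
    act-+ (a ⊛ b) u v w = F.trans (act-cong a (act-+ b u v) w) (act-+ a (act b u) (act b v) w)
    act-+ (⊖ a)   u v w = F.trans (F.-‿cong (act-+ a u v w)) (F.sym (-‿+-comm (act a u w) (act a v w)))

    act-* : ∀ a c v → act a (λ w → c K.* v w) ≋ λ w → c K.* act a v w
    act-* (T i)   c v w = mix-* (orderAt i w) c _ _
    act-* (κ d)   c v w = x∙yz≈y∙xz d c (v w)
      where open import Algebra.Properties.CommutativeSemigroup F.*-commutativeSemigroup using (x∙yz≈y∙xz)
    act-* (a ⊕ b) c v w = F.trans (F.+-cong (act-* a c v w) (act-* b c v w))
      (F.sym (F.distribˡ c (act a v w) (act b v w)))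
    act-* (a ⊛ b) c v w = F.trans (act-cong a (act-* b c v) w) (act-* a c (act b v) w)
    act-* (⊖ a)   c v w = F.trans (F.-‿cong (act-* a c v w)) (-‿distribʳ-* c (act a v w))

    -- The operators satisfy the defining relations, so `act` descends to the presented algebra.
    -- Lower bounds on the induced modules come from here, since a presentation alone does not show
    -- that two elements differ.
    act-≈ : ∀ {a b} → a ≈ᴴ b → ∀ v → act a v ≋ act b v
    act-≈ reflᴴ           v w = F.refl
    act-≈ (symᴴ e)        v w = F.sym (act-≈ e v w)
    act-≈ (transᴴ e f)    v w = F.trans (act-≈ e v w) (act-≈ f v w)
    act-≈ (⊕-cong e f)    v w = F.+-cong (act-≈ e v w) (act-≈ f v w)
    act-≈ (⊛-cong {a} {a′} {b} {b′} e f) v w = F.trans (act-cong a (act-≈ f v) w) (act-≈ e (act b′ v) w)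
    act-≈ (⊖-cong e)      v w = F.-‿cong (act-≈ e v w)
    act-≈ (κ-cong {c} {d} e) v w = F.*-congʳ {v w} {c} {d} (mk≃ e)
    act-≈ (⊕-assoc a b c) v w = F.+-assoc (act a v w) (act b v w) (act c v w)
    act-≈ (⊕-comm a b)    v w = F.+-comm (act a v w) (act b v w)
    act-≈ (⊕-identityˡ a) v w = F.trans (F.+-congʳ {act a v w} (F.zeroˡ (v w))) (F.+-identityˡ (act a v w))
    act-≈ (⊖-inverseˡ a)  v w = F.trans (F.-‿inverseˡ (act a v w)) (F.sym (F.zeroˡ (v w)))
    act-≈ (⊛-assoc a b c) v w = F.refl
    act-≈ (⊛-identityˡ a) v w = F.*-identityˡ (act a v w)
    act-≈ (⊛-identityʳ a) v w = act-cong a (λ w → F.*-identityˡ (v w)) w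
    act-≈ (⊛-distribˡ a b c) v w = act-+ a (act b v) (act c v) w
    act-≈ (⊛-distribʳ a b c) v w = F.refl
    act-≈ (κ-+ c d)       v w = F.distribʳ (v w) c d
    act-≈ (κ-* c d)       v w = F.*-assoc c d (v w)
    act-≈ (κ-central c a) v w = F.sym (act-* a c v w)
    act-≈ (quadratic i)   v w = T·-quadratic root i v w
    act-≈ (commute i j d) v w =
      T·-commute root i j d (≡.subst (2 ℕ.≤_) (ℕ.∣-∣-comm (toℕ i) (toℕ j)) d) v w
    act-≈ (braid i j d)   v w = T·-braid root i j d v w

open TensorAction

-- Bases and traces over a commutative ring

module ModuleSums (R : CommutativeRing 0ℓ 0ℓ) (M : LeftModule (CommutativeRing.ring R) 0ℓ 0ℓ) where
  open CommutativeRing R using (Carrier; _≈_; _+_; _*_; 0#; 1#; -_)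
  private module R = CommutativeRing R
  open import Algebra.Properties.Semiring.Sum R.semiring using (sum; sum-cong-≋; ∑-comm)
  open LeftModule M
  open import Algebra.Properties.CommutativeMonoid.Sum +ᴹ-commutativeMonoid using () renaming
    ( sum to sumᴹ ; sum-cong-≋ to sumᴹ-cong ; ∑-comm to ∑ᴹ-comm ; ∑-distrib-+ to ∑ᴹ-distrib-+) public
  open import Algebra.Properties.Group R.+-group using (x∙y⁻¹≈ε⇒x≈y)
  import Relation.Binary.Reasoning.Setoid as Reasoning

  *ₗ-distribˡ-sumᴹ : ∀ {d} a (y : Vector Carrierᴹ d) → a *ₗ sumᴹ y ≈ᴹ sumᴹ (λ i → a *ₗ y i)
  *ₗ-distribˡ-sumᴹ {zero}  a y = *ₗ-zeroʳ a
  *ₗ-distribˡ-sumᴹ {suc d} a y =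
    ≈ᴹ-trans (*ₗ-distribˡ a (y zero) _) (+ᴹ-congˡ (*ₗ-distribˡ-sumᴹ a (λ i → y (suc i))))

  sum-*ₗ : ∀ {d} (a : Vector Carrier d) y → sum a *ₗ y ≈ᴹ sumᴹ (λ i → a i *ₗ y)
  sum-*ₗ {zero}  a y = *ₗ-zeroˡ y
  sum-*ₗ {suc d} a y =
    ≈ᴹ-trans (*ₗ-distribʳ y (a zero) _) (+ᴹ-congˡ (sum-*ₗ (λ i → a (suc i)) y))

  record IsLinear (φ : Carrierᴹ → Carrierᴹ) : Set where
    field
      φ-cong : ∀ {x y} → x ≈ᴹ y → φ x ≈ᴹ φ y
      φ-+    : ∀ x y → φ (x +ᴹ y) ≈ᴹ φ x +ᴹ φ y
      φ-0    : φ 0ᴹ ≈ᴹ 0ᴹ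
      φ-*ₗ   : ∀ a x → φ (a *ₗ x) ≈ᴹ a *ₗ φ x

    φ-sum : ∀ {d} (a : Vector Carrier d) (y : Vector Carrierᴹ d) → φ (sumᴹ (λ i → a i *ₗ y i)) ≈ᴹ sumᴹ (λ i → a i *ₗ φ (y i))
    φ-sum {zero}  a y = φ-0
    φ-sum {suc d} a y = ≈ᴹ-trans (φ-+ _ _)
      (+ᴹ-cong (φ-*ₗ (a zero) (y zero)) (φ-sum (λ i → a (suc i)) (λ i → y (suc i))))

  record Basis (d : ℕ) : Set where
    field
      basis       : Vector Carrierᴹ d
      coordinate  : Carrierᴹ → Vector Carrier d
      expansion   : ∀ x → x ≈ᴹ sumᴹ (λ i → coordinate x i *ₗ basis i)
      independent : ∀ (c : Vector Carrier d) → sumᴹ (λ i → c i *ₗ basis i) ≈ᴹ 0ᴹ → ∀ i → c i ≈ 0#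

    -- The function `coordinate` is an arbitrary choice of coefficients, with no assumption that it
    -- is linear or respects equality. Independence, applied to the difference of two expansions,
    -- forces both.
    coordinate-unique : ∀ {x} (a : Vector Carrier d) → x ≈ᴹ sumᴹ (λ i → a i *ₗ basis i) →
                        ∀ i → coordinate x i ≈ a i
    coordinate-unique {x} a e i = x∙y⁻¹≈ε⇒x≈y _ _ (independent (λ i → coordinate x i + - a i) vanishing i)
      where
      open Reasoning ≈ᴹ-setoid
      c = coordinate x
      vanishing : sumᴹ (λ i → (c i + - a i) *ₗ basis i) ≈ᴹ 0ᴹ
      vanishing = begin
        sumᴹ (λ i → (c i + - a i) *ₗ basis i)
          ≈⟨ sumᴹ-cong (λ i → *ₗ-distribʳ (basis i) (c i) (- a i)) ⟩
        sumᴹ (λ i → c i *ₗ basis i +ᴹ - a i *ₗ basis i)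
          ≈⟨ ∑ᴹ-distrib-+ (λ i → c i *ₗ basis i) (λ i → - a i *ₗ basis i) ⟩
        sumᴹ (λ i → c i *ₗ basis i) +ᴹ sumᴹ (λ i → - a i *ₗ basis i)
          ≈⟨ +ᴹ-congʳ (≈ᴹ-trans (≈ᴹ-sym (expansion x)) e) ⟩
        sumᴹ (λ i → a i *ₗ basis i) +ᴹ sumᴹ (λ i → - a i *ₗ basis i)
          ≈⟨ ≈ᴹ-sym (∑ᴹ-distrib-+ (λ i → a i *ₗ basis i) (λ i → - a i *ₗ basis i)) ⟩
        sumᴹ (λ i → a i *ₗ basis i +ᴹ - a i *ₗ basis i)
          ≈⟨ sumᴹ-cong (λ i → ≈ᴹ-sym (*ₗ-distribʳ (basis i) (a i) (- a i))) ⟩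
        sumᴹ (λ i → (a i + - a i) *ₗ basis i)
          ≈⟨ sumᴹ-cong (λ i → *ₗ-congʳ (R.-‿inverseʳ (a i))) ⟩
        sumᴹ (λ i → 0# *ₗ basis i)
          ≈⟨ ≈ᴹ-sym (*ₗ-distribˡ-sumᴹ 0# basis) ⟩
        0# *ₗ sumᴹ basis
          ≈⟨ *ₗ-zeroˡ _ ⟩
        0ᴹ ∎

    coordinate-linear : ∀ {e x} (a : Vector Carrier e) (y : Vector Carrierᴹ e) →
                        x ≈ᴹ sumᴹ (λ j → a j *ₗ y j) →
                        ∀ i → coordinate x i ≈ sum (λ j → a j * coordinate (y j) i)
    coordinate-linear {x = x} a y x≈ = coordinate-unique _ (begin
      x
        ≈⟨ x≈ ⟩
      sumᴹ (λ j → a j *ₗ y j)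
        ≈⟨ sumᴹ-cong (λ j → *ₗ-congˡ (expansion (y j))) ⟩
      sumᴹ (λ j → a j *ₗ sumᴹ (λ i → c j i *ₗ basis i))
        ≈⟨ sumᴹ-cong (λ j → *ₗ-distribˡ-sumᴹ (a j) (λ i → c j i *ₗ basis i)) ⟩
      sumᴹ (λ j → sumᴹ (λ i → a j *ₗ (c j i *ₗ basis i)))
        ≈⟨ ∑ᴹ-comm (λ j i → a j *ₗ (c j i *ₗ basis i)) ⟩
      sumᴹ (λ i → sumᴹ (λ j → a j *ₗ (c j i *ₗ basis i)))
        ≈⟨ sumᴹ-cong (λ i → sumᴹ-cong (λ j → ≈ᴹ-sym (*ₗ-assoc (a j) (c j i) (basis i)))) ⟩
      sumᴹ (λ i → sumᴹ (λ j → (a j * c j i) *ₗ basis i))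
        ≈⟨ sumᴹ-cong (λ i → ≈ᴹ-sym (sum-*ₗ (λ j → a j * c j i) (basis i))) ⟩
      sumᴹ (λ i → sum (λ j → a j * c j i) *ₗ basis i) ∎)
      where
      open Reasoning ≈ᴹ-setoid
      c = λ j → coordinate (y j)

  -- This is tr(XY) = tr(YX), where X holds the coordinates of the vectors of B in C and Y those of
  -- the images under `φ` of the vectors of C in B. The matrices are rectangular, so the lengths d
  -- and e are not compared.
  trace-invariant : ∀ {d e} (B : Basis d) (C : Basis e) {φ} → IsLinear φ →
    sum (λ i → Basis.coordinate B (φ (Basis.basis B i)) i) ≈
    sum (λ j → Basis.coordinate C (φ (Basis.basis C j)) j)
  trace-invariant B C {φ} linear = begin
    sum (λ i → β (φ (b i)) i)
      ≈⟨ sum-cong-≋ (λ i → Basis.coordinate-linear B (γ (b i)) (λ j → φ (c j))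
           (≈ᴹ-trans (φ-cong (Basis.expansion C (b i))) (φ-sum (γ (b i)) c)) i) ⟩
    sum (λ i → sum (λ j → γ (b i) j * β (φ (c j)) i))
      ≈⟨ ∑-comm (λ i j → γ (b i) j * β (φ (c j)) i) ⟩
    sum (λ j → sum (λ i → γ (b i) j * β (φ (c j)) i))
      ≈⟨ sum-cong-≋ (λ j → sum-cong-≋ (λ i → R.*-comm (γ (b i) j) (β (φ (c j)) i))) ⟩
    sum (λ j → sum (λ i → β (φ (c j)) i * γ (b i) j))
      ≈⟨ sum-cong-≋ (λ j → R.sym (Basis.coordinate-linear C (β (φ (c j))) b (Basis.expansion B (φ (c j))) j)) ⟩
    sum (λ j → γ (φ (c j)) j) ∎
    where
    open Reasoning R.setoid
    open IsLinear linear
    open Basis B using () renaming (basis to b ; coordinate to β)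
    open Basis C using () renaming (basis to c ; coordinate to γ)

-- The induced module as a ℚ(q)-vector space with action

module InducedModule (n : ℕ) (μ : List ℕ) where
  open Hecke n
  open Parabolic μ

  induced-+-abelianGroup : AbelianGroup 0ℓ 0ℓ
  induced-+-abelianGroup = record
    { Carrier = Induced ; _≈_ = _≈ᵗ_ ; _∙_ = _+ᵗ_ ; ε = 0ᵗ ; _⁻¹ = -ᵗ_
    ; isAbelianGroup = record
      { isGroup = record
        { isMonoid = record
          { isSemigroup = record
            { isMagma = record
              { isEquivalence = record { refl = reflᵗ ; sym = symᵗ ; trans = transᵗ }
              ; ∙-cong = +-cong }
            ; assoc = +-assoc }
          ; identity = +-identityˡ , λ x → transᵗ (+-comm x 0ᵗ) (+-identityˡ x) }
        ; inverse = neg-inverseˡ , λ x → transᵗ (+-comm x (-ᵗ x)) (neg-inverseˡ x)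
        ; ⁻¹-cong = neg-cong }
      ; comm = +-comm } }

  open AbelianGroup induced-+-abelianGroup using (commutativeSemigroup)
  open import Algebra.Properties.AbelianGroup induced-+-abelianGroup using (⁻¹-∙-comm; inverseˡ-unique; ∙-cancelˡ)
  open import Algebra.Properties.CommutativeSemigroup commutativeSemigroup using (interchange)

  ⊗-congˡ : ∀ {a b k} → a ≈ᴴ b → a ⊗ k ≈ᵗ b ⊗ k
  ⊗-congˡ {k = k} e = ⊗-cong {k = k} {k} e (≃-refl {k} .equal)

  ⊗-congʳ : ∀ a {k l} → k ≃ l → a ⊗ k ≈ᵗ a ⊗ l
  ⊗-congʳ a {k} {l} e = ⊗-cong {k = k} {l} reflᴴ (e .equal)

  ▷-congʳ : ∀ {h h′} → h ≈ᴴ h′ → ∀ x → h ▷ x ≈ᵗ h′ ▷ x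
  ▷-congʳ e (a ⊗ k)  = ⊗-congˡ (⊛-cong e reflᴴ)
  ▷-congʳ e 0ᵗ       = reflᵗ
  ▷-congʳ e (x +ᵗ y) = +-cong (▷-congʳ e x) (▷-congʳ e y)
  ▷-congʳ e (-ᵗ x)   = neg-cong (▷-congʳ e x)

  ▷-congˡ : ∀ h {x y} → x ≈ᵗ y → h ▷ x ≈ᵗ h ▷ y
  ▷-congˡ h reflᵗ          = reflᵗ
  ▷-congˡ h (symᵗ e)       = symᵗ (▷-congˡ h e)
  ▷-congˡ h (transᵗ e f)   = transᵗ (▷-congˡ h e) (▷-congˡ h f)
  ▷-congˡ h (+-cong e f)   = +-cong (▷-congˡ h e) (▷-congˡ h f)
  ▷-congˡ h (neg-cong e)   = neg-cong (▷-congˡ h e)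
  ▷-congˡ h (⊗-cong {k = k} {k′} e f) = ⊗-cong {k = k} {k′} (⊛-cong reflᴴ e) f
  ▷-congˡ h (+-assoc x y z)    = +-assoc _ _ _
  ▷-congˡ h (+-comm x y)       = +-comm _ _
  ▷-congˡ h (+-identityˡ x)    = +-identityˡ _
  ▷-congˡ h (neg-inverseˡ x)   = neg-inverseˡ _
  ▷-congˡ h (⊗-distribʳ a b k) =
    transᵗ (⊗-congˡ (⊛-distribˡ h a b)) (⊗-distribʳ _ _ k)
  ▷-congˡ h (⊗-distribˡ a k l) = ⊗-distribˡ _ k l
  ▷-congˡ h (balanced a b k)   =
    transᵗ (⊗-congˡ (symᴴ (⊛-assoc h a (include b)))) (balanced _ b k)

  ▷-⊛ : ∀ a b x → (a ⊛ b) ▷ x ≈ᵗ a ▷ b ▷ x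
  ▷-⊛ a b (c ⊗ k)  = ⊗-congˡ (⊛-assoc a b c)
  ▷-⊛ a b 0ᵗ       = reflᵗ
  ▷-⊛ a b (x +ᵗ y) = +-cong (▷-⊛ a b x) (▷-⊛ a b y)
  ▷-⊛ a b (-ᵗ x)   = neg-cong (▷-⊛ a b x)

  ▷-⊕ : ∀ a b x → (a ⊕ b) ▷ x ≈ᵗ a ▷ x +ᵗ b ▷ x
  ▷-⊕ a b (c ⊗ k)  = transᵗ (⊗-congˡ (⊛-distribʳ c a b)) (⊗-distribʳ _ _ k)
  ▷-⊕ a b 0ᵗ       = symᵗ (+-identityˡ 0ᵗ)
  ▷-⊕ a b (x +ᵗ y) = transᵗ (+-cong (▷-⊕ a b x) (▷-⊕ a b y)) (interchange _ _ _ _)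
  ▷-⊕ a b (-ᵗ x)   = transᵗ (neg-cong (▷-⊕ a b x)) (symᵗ (⁻¹-∙-comm _ _))

  ▷-identity : ∀ x → κ K.1# ▷ x ≈ᵗ x
  ▷-identity (a ⊗ k)  = ⊗-congˡ (⊛-identityˡ a)
  ▷-identity 0ᵗ       = reflᵗ
  ▷-identity (x +ᵗ y) = +-cong (▷-identity x) (▷-identity y)
  ▷-identity (-ᵗ x)   = neg-cong (▷-identity x)

  -- Distributivity gives 0x + 0x = 0x, and cancellation finishes. On a pure tensor the action of
  -- the scalar 0 is again a pure tensor, so `0ᵗ` has to be reached through the group law.
  ▷-zero : ∀ x → κ K.0# ▷ x ≈ᵗ 0ᵗ
  ▷-zero x = ∙-cancelˡ (κ K.0# ▷ x) _ _ (transᵗ (symᵗ (▷-⊕ (κ K.0#) (κ K.0#) x))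
    (transᵗ (▷-congʳ (⊕-identityˡ (κ K.0#)) x)
      (transᵗ (symᵗ (+-identityˡ _)) (+-comm _ _))))

  ▷-⊖ : ∀ a x → (⊖ a) ▷ x ≈ᵗ -ᵗ (a ▷ x)
  ▷-⊖ a x = inverseˡ-unique _ _ (transᵗ (symᵗ (▷-⊕ (⊖ a) a x))
    (transᵗ (▷-congʳ (⊖-inverseˡ a) x) (▷-zero x)))

  inducedLeftModule : LeftModule F.ring 0ℓ 0ℓ
  inducedLeftModule = record
    { Carrierᴹ = Induced ; _≈ᴹ_ = _≈ᵗ_ ; _+ᴹ_ = _+ᵗ_ ; _*ₗ_ = λ c x → κ c ▷ x
    ; 0ᴹ = 0ᵗ ; -ᴹ_ = -ᵗ_
    ; isLeftModule = record
      { isLeftSemimodule = record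
        { +ᴹ-isCommutativeMonoid = AbelianGroup.isCommutativeMonoid induced-+-abelianGroup
        ; isPreleftSemimodule = record
          { *ₗ-cong      = λ {c} {d} {x} {y} e f → transᵗ (▷-congʳ (κ-cong {c} {d} (e .equal)) x) (▷-congˡ (κ d) f)
          ; *ₗ-zeroˡ     = ▷-zero
          ; *ₗ-distribʳ  = λ x c d → transᵗ (▷-congʳ (κ-+ c d) x) (▷-⊕ (κ c) (κ d) x)
          ; *ₗ-identityˡ = ▷-identity
          ; *ₗ-assoc     = λ c d x → transᵗ (▷-congʳ (κ-* c d) x) (▷-⊛ (κ c) (κ d) x)
          ; *ₗ-zeroʳ     = λ c → reflᵗ
          ; *ₗ-distribˡ  = λ c x y → reflᵗ } }
      ; -ᴹ‿cong = neg-cong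
      ; -ᴹ‿inverse = neg-inverseˡ , λ x → transᵗ (+-comm x (-ᵗ x)) (neg-inverseˡ x) } }

  open ModuleSums ℚ⟨q⟩-ring inducedLeftModule public

  ▷-linear : ∀ h → IsLinear (h ▷_)
  ▷-linear h = record
    { φ-cong = ▷-congˡ h
    ; φ-+    = λ x y → reflᵗ
    ; φ-0    = reflᵗ
    ; φ-*ₗ   = λ c x → transᵗ (symᵗ (▷-⊛ h (κ c) x))
                 (transᵗ (▷-congʳ (symᴴ (κ-central c h)) x) (▷-⊛ (κ c) h x)) }

  finiteBasis⇒basis : (B : FiniteBasis inducedModule) → Basis (FiniteBasis.dim B)
  finiteBasis⇒basis B = record
    { basis       = FiniteBasis.basis B
    ; coordinate  = FiniteBasis.coordinate B
    ; expansion   = λ x → FiniteBasis.spanning B x .proj₂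
    ; independent = λ c e i → mk≃ (FiniteBasis.independent B c e i) }

  basis⇒finiteBasis : ∀ {d} → Basis d → FiniteBasis inducedModule
  basis⇒finiteBasis B = record
    { basis       = Basis.basis B
    ; spanning    = λ x → Basis.coordinate B x , Basis.expansion B x
    ; independent = λ c e i → Basis.independent B c e i .equal }

  trace-isInducedSignCharacter : ∀ {d} (B : Basis d) →
    IsInducedSignCharacter (λ h → trace inducedModule (basis⇒finiteBasis B) (h ▷_))
  trace-isInducedSignCharacter B = basis⇒finiteBasis B , λ C h →
    trace-invariant B (finiteBasis⇒basis C) (▷-linear h) .equal

-- Sorted words and standard vectors

module SortedWords where
  open import Data.Nat.Base using (_∸_)
  open import Relation.Binary.PropositionalEquality using (refl)

  Sorted : ∀ {n} → Word n → Set
  Sorted w = ∀ i → orderAt i w ≢ gt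

  gt? : ∀ o → Dec (o ≡ gt)
  gt? lt = no λ ()
  gt? eq = no λ ()
  gt? gt = yes refl

  descent? : ∀ {n} (w : Word n) → (∃ λ i → orderAt i w ≡ gt) ⊎ Sorted w
  descent? w with any? (λ i → gt? (orderAt i w))
  ... | yes d = inj₁ d
  ... | no ¬d = inj₂ λ i e → ¬d (i , e)

  order-≢gt⇒≤ : ∀ a b → order a b ≢ gt → a ≤ b
  order-≢gt⇒≤ zero    b       _ = z≤n
  order-≢gt⇒≤ (suc a) zero    p = contradiction refl p
  order-≢gt⇒≤ (suc a) (suc b) p = s≤s (order-≢gt⇒≤ a b p)

  order-≤⇒≢gt : ∀ {a b} → a ≤ b → order a b ≢ gt
  order-≤⇒≢gt {a} {b} a≤b e = ℕ.<⇒≱ (order-gt a b e) a≤b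

  sorted⇒linked : ∀ {n} (w : Word n) → Sorted w → Linked _≤_ (toList w)
  sorted⇒linked []          s = []
  sorted⇒linked (a ∷ [])    s = [-]
  sorted⇒linked (a ∷ b ∷ w) s = order-≢gt⇒≤ a b (s zero) ∷ sorted⇒linked (b ∷ w) (λ i → s (suc i))

  toList-injective : ∀ {A : Set} {n} (u v : Vec A n) → toList u ≡ toList v → u ≡ v
  toList-injective u v e = ≡.trans (≡.sym (Vec.cast-is-id refl u)) (Vec.toList-injective refl u v e)

  sorted-unique : ∀ {n} (u v : Word n) → Sorted u → Sorted v → toList u ↭ toList v → u ≡ v
  sorted-unique u v su sv p = toList-injective u v
    (Pointwise-≡⇒≡ (↗↭↗⇒≋ ℕ.≤-totalOrder (sorted⇒linked u su) (sorted⇒linked v sv) (Perm.↭⇒↭ₛ p)))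

  orderAt-tabulate : ∀ {n} (f : ℕ → ℕ) (i : Fin (pred n)) →
    orderAt i (tabulate {n = n} (λ k → f (toℕ k))) ≡ order (f (toℕ i)) (f (suc (toℕ i)))
  orderAt-tabulate {suc (suc n)} f zero    = refl
  orderAt-tabulate {suc (suc n)} f (suc i) = orderAt-tabulate {suc n} (λ k → f (suc k)) i

  block-mono : ∀ μ k → block μ k ≤ block μ (suc k)
  block-mono []      k = z≤n
  block-mono (l ∷ μ) k with k ℕ.<ᵇ l | ℕ.<ᵇ-reflects-< k l | suc k ℕ.<ᵇ l | ℕ.<ᵇ-reflects-< (suc k) l
  ... | true  | _         | _     | _         = z≤n
  ... | false | ofⁿ k≮l   | true  | ofʸ k+1<l = contradiction (ℕ.<-trans (ℕ.n<1+n k) k+1<l) k≮l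
  ... | false | ofⁿ k≮l   | false | _
    rewrite ℕ.+-∸-assoc 1 (ℕ.≮⇒≥ k≮l) = s≤s (block-mono μ (k ∸ l))

  -- The generator `T i` belongs to the parabolic subalgebra exactly when the letters of this word
  -- at i and i + 1 agree. The word stands for the trivial coset, that is, for `1 ⊗ 1`.
  blockWord : ∀ n → List ℕ → Word n
  blockWord n μ = tabulate (λ k → block μ (toℕ k))

  blockWord-sorted : ∀ n μ → Sorted (blockWord n μ)
  blockWord-sorted n μ i e =
    order-≤⇒≢gt (block-mono μ (toℕ i)) (≡.trans (≡.sym (orderAt-tabulate {n} (block μ) i)) e)

  data Separation {n} (i j : Fin n) : Set where
    same     : i ≡ j → Separation i j
    adjacent : ∣ toℕ i - toℕ j ∣ ≡ 1 → ∣ toℕ j - toℕ i ∣ ≡ 1 → Separation i j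
    distant  : 2 ≤ ∣ toℕ i - toℕ j ∣ → 2 ≤ ∣ toℕ j - toℕ i ∣ → Separation i j

  separation : ∀ {n} (i j : Fin n) → Separation i j
  separation i j with ∣ toℕ i - toℕ j ∣ in e
  ... | zero        = same (toℕ-injective (ℕ.∣m-n∣≡0⇒m≡n e))
  ... | suc zero    = adjacent e (≡.trans (ℕ.∣-∣-comm (toℕ j) (toℕ i)) e)
  ... | suc (suc d) = distant (≡.subst (2 ≤_) (≡.sym e) (s≤s (s≤s z≤n)))
    (≡.subst (2 ≤_) (≡.trans (≡.sym e) (ℕ.∣-∣-comm (toℕ i) (toℕ j))) (s≤s (s≤s z≤n)))

  both-gt : ∀ {o} → Consistent gt gt o → o ≡ gt
  both-gt gt-gt = refl

  module StandardVectors (n : ℕ) (μ : List ℕ) where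
    open Hecke n
    open Parabolic μ
    open InducedModule n μ

    v₀ : Word n
    v₀ = blockWord n μ

    -- x is T_w ⊗ 1 for a reduced expression of the permutation that takes
    -- the sorted word to w.
    data Standard : Word n → Induced → Set where
      base : ∀ {w} → Sorted w → Standard w (κ K.1# ⊗ K.1#)
      step : ∀ {w x} i → orderAt i w ≡ gt → Standard (swap i w) x → Standard w (T i ▷ x)

    private
      standard-acc : ∀ w → Acc _<_ (weight w) → ∃ (Standard w)
      standard-acc w (acc rs) with descent? w
      ... | inj₂ s       = _ , base s
      ... | inj₁ (i , d) = _ , step i d (proj₂ (standard-acc (swap i w) (rs (weight-swap i w d))))

    abstract
      vector : Word n → Induced
      vector w = proj₁ (standard-acc w (<-wellFounded _))

      vector-standard : ∀ w → Standard w (vector w)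
      vector-standard w = proj₂ (standard-acc w (<-wellFounded _))

    TTT : ∀ i j → ∣ toℕ i - toℕ j ∣ ≡ 1 → ∀ x → T i ▷ T j ▷ T i ▷ x ≈ᵗ T j ▷ T i ▷ T j ▷ x
    TTT i j d x = transᵗ (symᵗ (regroup i j)) (transᵗ (▷-congʳ (braid i j d) x) (regroup j i))
      where
      regroup : ∀ i j → (T i ⊛ T j ⊛ T i) ▷ x ≈ᵗ T i ▷ T j ▷ T i ▷ x
      regroup i j = transᵗ (▷-⊛ (T i ⊛ T j) (T i) x) (▷-⊛ (T i) (T j) (T i ▷ x))

    TT : ∀ i j → 2 ≤ ∣ toℕ i - toℕ j ∣ → ∀ x → T i ▷ T j ▷ x ≈ᵗ T j ▷ T i ▷ x
    TT i j d x = transᵗ (symᵗ (▷-⊛ (T i) (T j) x)) (transᵗ (▷-congʳ (commute i j d) x) (▷-⊛ (T j) (T i) x))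

    private
      -- Local confluence, in the role of Matsumoto's theorem. Two derivations for w may begin with
      -- different descents i and j. Removing both leads to a common word `u`; the induction
      -- hypothesis at `swap i w` and at `swap j w` reroutes each derivation through `u`, and the
      -- two routes then differ by a commutation or a braid relation.
      unique-acc : ∀ {w x y} → Acc _<_ (weight w) → Standard w x → Standard w y → x ≈ᵗ y
      unique-acc _ (base s)     (base _)     = reflᵗ
      unique-acc _ (base s)     (step i d _) = contradiction d (s i)
      unique-acc _ (step i d _) (base s)     = contradiction d (s i)
      unique-acc {w} (acc rs) (step {x = x} i di sx) (step {x = y} j dj sy) with separation i j
      ... | same refl = ▷-congˡ (T i) (unique-acc (rs (weight-swap i w di)) sx sy)
      ... | distant f f′ = transᵗ (▷-congˡ (T i) x≈) (transᵗ (TT i j f z) (symᵗ (▷-congˡ (T j) y≈)))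
        where
        u = swap j (swap i w)
        z = vector u
        x≈ : x ≈ᵗ T j ▷ z
        x≈ = unique-acc (rs (weight-swap i w di)) sx
          (step j (≡.trans (orderAt-far j i f′ w) dj) (vector-standard u))
        y≈ : y ≈ᵗ T i ▷ z
        y≈ = unique-acc (rs (weight-swap j w dj)) sy
          (step i (≡.trans (orderAt-far i j f w) di)
            (≡.subst (λ u → Standard u z) (swap-comm j i f′ w) (vector-standard u)))
      ... | adjacent a a′ = transᵗ (▷-congˡ (T i) x≈) (transᵗ (TTT i j a z) (symᵗ (▷-congˡ (T j) y≈)))
        where
        open BraidPattern (braidPattern i j a w)
        u = swap i (swap j (swap i w))
        z = vector u
        -- Descents at both adjacent positions mean letters a > b > c, so a > c as well, and each
        -- route can go on until the three letters are reversed.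
        o≡gt : orderAt i (swap j w) ≡ gt
        o≡gt = both-gt (≡.subst₂ (λ o o′ → Consistent o o′ (orderAt i (swap j w))) di dj triple)
        x≈ : x ≈ᵗ T j ▷ T i ▷ z
        x≈ = unique-acc (rs (weight-swap i w di)) sx
          (step j (≡.trans outer o≡gt) (step i (≡.trans movedʲ dj) (vector-standard u)))
        y≈ : y ≈ᵗ T i ▷ T j ▷ z
        y≈ = unique-acc (rs (weight-swap j w dj)) sy
          (step i o≡gt (step j (≡.trans movedⁱ di)
            (≡.subst (λ u → Standard u z) swap-braid (vector-standard u))))

    standard-unique : ∀ {w x y} → Standard w x → Standard w y → x ≈ᵗ y
    standard-unique = unique-acc (<-wellFounded _)

    vector-descent : ∀ i w → orderAt i w ≡ gt → vector w ≈ᵗ T i ▷ vector (swap i w)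
    vector-descent i w d = standard-unique (vector-standard w) (step i d (vector-standard (swap i w)))

    T-vector-lt : ∀ i w → orderAt i w ≡ lt → T i ▷ vector w ≈ᵗ vector (swap i w)
    T-vector-lt i w e = symᵗ (≡.subst (λ u → vector (swap i w) ≈ᵗ T i ▷ vector u) (swap-involutive i w)
      (vector-descent i (swap i w) (≡.trans (orderAt-swap i w) (≡.cong flip e))))

    T-vector-gt : ∀ i w → orderAt i w ≡ gt →
                  T i ▷ vector w ≈ᵗ κ p ▷ vector w +ᵗ κ q ▷ vector (swap i w)
    T-vector-gt i w e = transᵗ (▷-congˡ (T i) (vector-descent i w e))
      (transᵗ (symᵗ (▷-⊛ (T i) (T i) x))
      (transᵗ (▷-congʳ (quadratic i) x)
      (transᵗ (▷-⊕ (κ p ⊛ T i) (κ q) x)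
      (+-cong (transᵗ (▷-⊛ (κ p) (T i) x) (▷-congˡ (κ p) (symᵗ (vector-descent i w e)))) reflᵗ))))
      where x = vector (swap i w)

    private
      gt-eq-o : ∀ {o} → Consistent gt eq o → o ≡ gt
      gt-eq-o (eqʳ _) = refl

      -- For the sorted word this is the relation `balanced`; the condition on the content makes
      -- that word equal to `v₀`. Otherwise take a descent j. If it is far from i, `T i` commutes
      -- past `T j`. If it is adjacent, a third letter moves past the two equal ones, and the braid
      -- relation turns `T i` into `T j` acting on a word of smaller weight whose equal letters
      -- stand at j.
      T-vector-eq-acc : ∀ i (w : Word n) → Acc _<_ (weight w) → toList w ↭ toList v₀ → orderAt i w ≡ eq →
                        T i ▷ vector w ≈ᵗ κ -1ᴷ ▷ vector w
      T-vector-eq-acc i w (acc rs) w∈ e with descent? w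
      ... | inj₂ s with refl ← sorted-unique w v₀ s (blockWord-sorted n μ) w∈ =
        transᵗ (▷-congˡ (T i) x≈) (transᵗ T1 (symᵗ (▷-congˡ (κ -1ᴷ) x≈)))
        where
        x≈ : vector w ≈ᵗ κ K.1# ⊗ K.1#
        x≈ = standard-unique (vector-standard w) (base s)
        g : YoungGen
        -- Equal neighbours in `v₀` are positions of one block, so `T i` can be moved across the
        -- tensor sign.
        g = i , order-eq _ _ (≡.trans (≡.sym (orderAt-tabulate {n} (block μ) i)) e)
        T1 : (T i ⊛ κ K.1#) ⊗ K.1# ≈ᵗ (κ -1ᴷ ⊛ κ K.1#) ⊗ K.1#
        T1 = transᵗ (⊗-congˡ (symᴴ (κ-central K.1# (T i))))
          (transᵗ (balanced (κ K.1#) (T g) K.1#)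
          (symᵗ (transᵗ (⊗-congˡ (κ-central -1ᴷ (κ K.1#)))
            (balanced (κ K.1#) (κ -1ᴷ) K.1#))))
      ... | inj₁ (j , d) with separation i j
      ...   | same refl = contradiction (≡.trans (≡.sym e) d) λ ()
      ...   | distant f f′ = begin
        T i ▷ vector w            ≈⟨ ▷-congˡ (T i) (vector-descent j w d) ⟩
        T i ▷ T j ▷ x             ≈⟨ TT i j f x ⟩
        T j ▷ T i ▷ x             ≈⟨ ▷-congˡ (T j) (T-vector-eq-acc i (swap j w) (rs (weight-swap j w d))
                                       (Perm.↭-trans (swap-↭ j w) w∈) (≡.trans (orderAt-far i j f w) e)) ⟩
        T j ▷ κ -1ᴷ ▷ x           ≈⟨ IsLinear.φ-*ₗ (▷-linear (T j)) -1ᴷ x ⟩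
        κ -1ᴷ ▷ T j ▷ x           ≈⟨ ▷-congˡ (κ -1ᴷ) (symᵗ (vector-descent j w d)) ⟩
        κ -1ᴷ ▷ vector w          ∎
        where
        open import Relation.Binary.Reasoning.Setoid (AbelianGroup.setoid induced-+-abelianGroup)
        x = vector (swap j w)
      ...   | adjacent a a′ = begin
        T i ▷ vector w            ≈⟨ ▷-congˡ (T i) w≈ ⟩
        T i ▷ T j ▷ T i ▷ x       ≈⟨ TTT i j a x ⟩
        T j ▷ T i ▷ T j ▷ x       ≈⟨ ▷-congˡ (T j) (▷-congˡ (T i)
                                       (T-vector-eq-acc j u (rs (ℕ.<-trans u< (weight-swap j w d)))
                                         (Perm.↭-trans (swap-↭ i (swap j w)) (Perm.↭-trans (swap-↭ j w) w∈))
                                         (≡.trans movedⁱ e))) ⟩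
        T j ▷ T i ▷ κ -1ᴷ ▷ x     ≈⟨ ▷-congˡ (T j) (IsLinear.φ-*ₗ (▷-linear (T i)) -1ᴷ x) ⟩
        T j ▷ κ -1ᴷ ▷ T i ▷ x     ≈⟨ IsLinear.φ-*ₗ (▷-linear (T j)) -1ᴷ (T i ▷ x) ⟩
        κ -1ᴷ ▷ T j ▷ T i ▷ x     ≈⟨ ▷-congˡ (κ -1ᴷ) (symᵗ w≈) ⟩
        κ -1ᴷ ▷ vector w          ∎
        where
        open import Relation.Binary.Reasoning.Setoid (AbelianGroup.setoid induced-+-abelianGroup)
        open BraidPattern (braidPattern i j a w)
        u = swap i (swap j w)
        x = vector u
        o≡gt : orderAt i (swap j w) ≡ gt
        o≡gt = gt-eq-o (≡.subst₂ (λ o o′ → Consistent o o′ (orderAt i (swap j w))) d e (consistent-comm triple))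
        u< : weight u < weight (swap j w)
        u< = weight-swap i (swap j w) o≡gt
        w≈ : vector w ≈ᵗ T j ▷ T i ▷ x
        w≈ = transᵗ (vector-descent j w d) (▷-congˡ (T j) (vector-descent i (swap j w) o≡gt))

    T-vector-eq : ∀ i w → toList w ↭ toList v₀ → orderAt i w ≡ eq →
                  T i ▷ vector w ≈ᵗ κ -1ᴷ ▷ vector w
    T-vector-eq i w = T-vector-eq-acc i w (<-wellFounded _)

open SortedWords

-- Enumerating the rearrangements of a word

module Enumeration where
  open import Relation.Binary.PropositionalEquality using (refl; sym; trans; cong)

  lookup-injective : ∀ {A : Set} {xs : List A} → Unique xs → ∀ i j → lookup xs i ≡ lookup xs j → i ≡ j
  lookup-injective (x∉ ∷ u) zero    zero    e = refl
  lookup-injective (x∉ ∷ u) zero    (suc j) e = contradiction e (All.lookup x∉ (∈-lookup j))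
  lookup-injective (x∉ ∷ u) (suc i) zero    e = contradiction (sym e) (All.lookup x∉ (∈-lookup i))
  lookup-injective (x∉ ∷ u) (suc i) (suc j) e = cong suc (lookup-injective u i j e)

  infix 4 _↭?_

  _↭?_ : (xs ys : List ℕ) → Dec (xs ↭ ys)
  xs ↭? ys = map′
    (λ e → Perm.↭-trans (Perm.↭-sym (sort-↭ xs)) (Perm.↭-trans (Perm.↭-reflexive e) (sort-↭ ys)))
    (λ p → Pointwise-≡⇒≡ (↗↭↗⇒≋ ℕ.≤-totalOrder (sort-↗ xs) (sort-↗ ys)
      (Perm.↭⇒↭ₛ (Perm.↭-trans (sort-↭ xs) (Perm.↭-trans p (Perm.↭-sym (sort-↭ ys)))))))
    (List.≡-dec ℕ._≟_ (sort xs) (sort ys))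
    where open Sort ℕ.≤-decTotalOrder

  wordsBelow : ℕ → ∀ n → List (Word n)
  wordsBelow L zero    = [] ∷ []
  wordsBelow L (suc n) = cartesianProductWith _∷_ (upTo L) (wordsBelow L n)

  wordsBelow-unique : ∀ L n → Unique (wordsBelow L n)
  wordsBelow-unique L zero    = [] ∷ []
  wordsBelow-unique L (suc n) =
    Unique.cartesianProductWith⁺ _∷_ Vec.∷-injective (Unique.upTo⁺ L) (wordsBelow-unique L n)

  wordsBelow-complete : ∀ {L n} (w : Word n) → All (_< L) (toList w) → w ∈ wordsBelow L n
  wordsBelow-complete []      []       = here refl
  wordsBelow-complete (a ∷ w) (p ∷ ps) =
    ∈-cartesianProductWith⁺ _∷_ (∈-upTo⁺ p) (wordsBelow-complete w ps)

  all-≤-sum : ∀ xs → All (_≤ ListAction.sum xs) xs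
  all-≤-sum []       = []
  all-≤-sum (x ∷ xs) = ℕ.m≤m+n x _ ∷ All.map (λ p → ℕ.≤-trans p (ℕ.m≤n+m _ x)) (all-≤-sum xs)

  record Rearrangements {n} (v : Word n) : Set where
    field
      {size}   : ℕ
      word     : Fin size → Word n
      injective : ∀ i j → word i ≡ word j → i ≡ j
      sound     : ∀ i → toList (word i) ↭ toList v
      complete  : ∀ w → toList w ↭ toList v → ∃ λ i → word i ≡ w

    index : ∀ w → toList w ↭ toList v → Fin size
    index w p = proj₁ (complete w p)

    word-index : ∀ w p → word (index w p) ≡ w
    word-index w p = proj₂ (complete w p)

    swapIndex : Fin (pred n) → Fin size → Fin size
    swapIndex i k = index (swap i (word k)) (Perm.↭-trans (swap-↭ i (word k)) (sound k))

    word-swapIndex : ∀ i k → word (swapIndex i k) ≡ swap i (word k)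
    word-swapIndex i k = word-index (swap i (word k)) _

    swapPermutation : Fin (pred n) → Permutation′ size
    swapPermutation i = permutation (swapIndex i) (swapIndex i) involutive involutive
      where
      involutive : ∀ k → swapIndex i (swapIndex i k) ≡ k
      involutive k = injective _ _ (trans (word-swapIndex i (swapIndex i k))
        (trans (cong (swap i) (word-swapIndex i k)) (swap-involutive i (word k))))

  abstract
    rearrangements : ∀ {n} (v : Word n) → Rearrangements v
    rearrangements {n} v = record
      { word      = lookup list
      ; injective = lookup-injective (Unique.filter⁺ P? (wordsBelow-unique L n))
      ; sound     = λ i → proj₂ (∈-filter⁻ P? {xs = wordsBelow L n} (∈-lookup i))
      ; complete  = λ w p →
          let w∈ = ∈-filter⁺ P? (wordsBelow-complete w (All-resp-↭ (Perm.↭-sym p) bound)) p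
          in Any.index w∈ , sym (lookup-index w∈)
      }
      where
      L : ℕ
      -- A letter is at most the sum of all letters, and the sum is the same for every
      -- rearrangement; the successor makes the bound strict.
      L = suc (ListAction.sum (toList v))
      P? : (w : Word n) → Dec (toList w ↭ toList v)
      P? w = toList w ↭? toList v
      list : List (Word n)
      list = filter P? (wordsBelow L n)
      bound : All (_< L) (toList v)
      bound = All.map s≤s (all-≤-sum (toList v))

open Enumeration

module SingleTerm (M : CommutativeMonoid 0ℓ 0ℓ) where
  open CommutativeMonoid M
  open import Algebra.Properties.CommutativeMonoid.Sum M using (sum; sum-cong-≋; sum-replicate-zero)

  sum-zero : ∀ {d} (f : Vector Carrier d) → (∀ j → f j ≈ ε) → sum f ≈ ε
  sum-zero {d} f z = trans (sum-cong-≋ z) (sum-replicate-zero d)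

  sum-single : ∀ {d} (f : Vector Carrier d) k → (∀ j → j ≢ k → f j ≈ ε) → sum f ≈ f k
  sum-single f zero    z =
    trans (∙-congˡ (sum-zero _ (λ j → z (suc j) λ ()))) (identityʳ (f zero))
  sum-single f (suc k) z = trans
    (∙-cong (z zero λ ()) (sum-single _ k (λ j j≢k → z (suc j) (λ e → j≢k (Fin.suc-injective e)))))
    (identityˡ (f (suc k)))

-- The basis of the induced module and its character

module StandardBasis (n : ℕ) (μ : List ℕ) where
  open import Relation.Binary.PropositionalEquality using (refl)
  open Hecke n
  open Parabolic μ
  open InducedModule n μ
  open StandardVectors n μ
  open HeckeAction n
  open Rearrangements (rearrangements v₀) public
  open import Algebra.Properties.Ring F.ring using (-1*x≈-x)
  open import Algebra.Properties.Semiring.Sum F.semiring using (sum; sum-cong-≋)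
  open import Algebra.Properties.CommutativeMonoid.Sum
    (AbelianGroup.commutativeMonoid induced-+-abelianGroup) using () renaming (∑-permute to ∑ᴹ-permute)
  open import Relation.Binary.Reasoning.Setoid (AbelianGroup.setoid induced-+-abelianGroup)

  scale-congʳ : ∀ {c d} x → c ≃ d → κ c ▷ x ≈ᵗ κ d ▷ x
  scale-congʳ {c} {d} x e = ▷-congʳ (κ-cong {c} {d} (e .equal)) x

  scale-* : ∀ c d x → κ (c K.* d) ▷ x ≈ᵗ κ c ▷ κ d ▷ x
  scale-* c d x = transᵗ (▷-congʳ (κ-* c d) x) (▷-⊛ (κ c) (κ d) x)

  scale-+ : ∀ c d x → κ (c K.+ d) ▷ x ≈ᵗ κ c ▷ x +ᵗ κ d ▷ x
  scale-+ c d x = transᵗ (▷-congʳ (κ-+ c d) x) (▷-⊕ (κ c) (κ d) x)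

  -- Only the values at rearrangements of `v₀` are read. On functions supported there it is inverse
  -- to `coordinates`.
  expand : Tensor → Induced
  expand v = sumᴹ (λ k → κ (v (word k)) ▷ vector (word k))

  expand-cong : ∀ {u v} → u ≋ v → expand u ≈ᵗ expand v
  expand-cong e = sumᴹ-cong (λ k → scale-congʳ (vector (word k)) (e (word k)))

  expand-+ : ∀ u v → expand (λ w → u w K.+ v w) ≈ᵗ expand u +ᵗ expand v
  expand-+ u v = transᵗ (sumᴹ-cong (λ k → scale-+ (u (word k)) (v (word k)) (vector (word k))))
    (∑ᴹ-distrib-+ (λ k → κ (u (word k)) ▷ vector (word k)) (λ k → κ (v (word k)) ▷ vector (word k)))

  expand-* : ∀ c v → expand (λ w → c K.* v w) ≈ᵗ κ c ▷ expand v
  expand-* c v = transᵗ (sumᴹ-cong (λ k → scale-* c (v (word k)) (vector (word k))))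
    (symᵗ (*ₗ-distribˡ-sumᴹ c (λ k → κ (v (word k)) ▷ vector (word k))))

  scale--1 : ∀ x → κ -1ᴷ ▷ x ≈ᵗ -ᵗ x
  scale--1 x = inverseˡ-unique _ _ (transᵗ (+-cong reflᵗ (symᵗ (▷-identity x)))
    (transᵗ (symᵗ (scale-+ -1ᴷ K.1# x))
    (transᵗ (scale-congʳ {d = K.0#} x (F.-‿inverseˡ K.1#)) (▷-zero x))))
    where open import Algebra.Properties.AbelianGroup induced-+-abelianGroup using (inverseˡ-unique)

  expand-neg : ∀ v → expand (λ w → K.- v w) ≈ᵗ -ᵗ expand v
  expand-neg v = transᵗ (expand-cong (λ w → F.sym (-1*x≈-x (v w))))
    (transᵗ (expand-* -1ᴷ v) (scale--1 (expand v)))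

  T-vector : ∀ i w → toList w ↭ toList v₀ → T i ▷ vector w ≈ᵗ
    κ (diagonal (orderAt i w)) ▷ vector w +ᵗ κ (offDiagonal (orderAt i w)) ▷ vector (swap i w)
  T-vector i w w∈ with orderAt i w in e
  ... | lt = transᵗ (T-vector-lt i w e) (symᵗ (transᵗ (+-cong (▷-zero _) (▷-identity _)) (+-identityˡ _)))
  ... | eq = transᵗ (T-vector-eq i w w∈ e)
    (symᵗ (transᵗ (+-cong reflᵗ (▷-zero _)) (transᵗ (+-comm _ _) (+-identityˡ _))))
  ... | gt = T-vector-gt i w e

  -- `T i` sends each standard vector to a combination of itself and its swapped partner, so the sum
  -- splits into a diagonal and a moved part. Reindexing the moved part by the swap turns the
  -- columns of the matrix of `T i` into rows, which `mix-matrix` identifies with `T· i`.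
  expand-T : ∀ i v → expand (T· i v) ≈ᵗ T i ▷ expand v
  expand-T i v = symᵗ (begin
    T i ▷ expand v
      ≈⟨ IsLinear.φ-sum (▷-linear (T i)) (λ k → v (word k)) (λ k → vector (word k)) ⟩
    sumᴹ (λ k → κ (v (word k)) ▷ T i ▷ vector (word k))
      ≈⟨ sumᴹ-cong (λ k → ▷-congˡ (κ (v (word k))) (T-vector i (word k) (sound k))) ⟩
    sumᴹ (λ k → κ (v (word k)) ▷ κ (diagonal (o k)) ▷ vector (word k) +ᵗ
                κ (v (word k)) ▷ κ (offDiagonal (o k)) ▷ vector (swap i (word k)))
      ≈⟨ ∑ᴹ-distrib-+ (λ k → κ (v (word k)) ▷ κ (diagonal (o k)) ▷ vector (word k))
                      (λ k → moved (word k)) ⟩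
    sumᴹ (λ k → κ (v (word k)) ▷ κ (diagonal (o k)) ▷ vector (word k)) +ᵗ
    sumᴹ (λ k → moved (word k))
      ≈⟨ +-cong (sumᴹ-cong (λ k → symᵗ (scale-* (v (word k)) (diagonal (o k)) (vector (word k))))) reindex ⟩
    sumᴹ (λ k → κ (v (word k) K.* diagonal (o k)) ▷ vector (word k)) +ᵗ
    sumᴹ (λ k → κ (v (swap i (word k)) K.* offDiagonal (flip (o k))) ▷ vector (word k))
      ≈⟨ symᵗ (∑ᴹ-distrib-+ (λ k → κ (v (word k) K.* diagonal (o k)) ▷ vector (word k))
           (λ k → κ (v (swap i (word k)) K.* offDiagonal (flip (o k))) ▷ vector (word k))) ⟩
    sumᴹ (λ k → κ (v (word k) K.* diagonal (o k)) ▷ vector (word k) +ᵗ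
                κ (v (swap i (word k)) K.* offDiagonal (flip (o k))) ▷ vector (word k))
      ≈⟨ sumᴹ-cong (λ k → symᵗ (scale-+ (v (word k) K.* diagonal (o k))
           (v (swap i (word k)) K.* offDiagonal (flip (o k))) (vector (word k)))) ⟩
    sumᴹ (λ k → κ (v (word k) K.* diagonal (o k) K.+ v (swap i (word k)) K.* offDiagonal (flip (o k)))
                ▷ vector (word k))
      ≈⟨ sumᴹ-cong (λ k → scale-congʳ (vector (word k)) (mix-matrix (o k) (v (word k)) (v (swap i (word k))))) ⟩
    expand (T· i v) ∎)
    where
    o : Fin size → Order
    o k = orderAt i (word k)

    moved : Word n → Induced
    moved w = κ (v w) ▷ κ (offDiagonal (orderAt i w)) ▷ vector (swap i w)

    moved-swap : ∀ w → moved (swap i w) ≈ᵗ κ (v (swap i w) K.* offDiagonal (flip (orderAt i w))) ▷ vector w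
    moved-swap w rewrite orderAt-swap i w | swap-involutive i w =
      symᵗ (scale-* (v (swap i w)) (offDiagonal (flip (orderAt i w))) (vector w))

    reindex : sumᴹ (λ k → moved (word k)) ≈ᵗ
              sumᴹ (λ k → κ (v (swap i (word k)) K.* offDiagonal (flip (o k))) ▷ vector (word k))
    reindex = transᵗ (∑ᴹ-permute (λ k → moved (word k)) (swapPermutation i))
      (sumᴹ-cong (λ k → ≡.subst
        (λ w → moved w ≈ᵗ κ (v (swap i (word k)) K.* offDiagonal (flip (o k))) ▷ vector (word k))
        (≡.sym (word-swapIndex i k)) (moved-swap (word k))))

  expand-act : ∀ a v → expand (act a v) ≈ᵗ a ▷ expand v
  expand-act (T i)   v = expand-T i v
  expand-act (κ c)   v = expand-* c v
  expand-act (a ⊕ b) v = transᵗ (expand-+ (act a v) (act b v))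
    (transᵗ (+-cong (expand-act a v) (expand-act b v)) (symᵗ (▷-⊕ a b _)))
  expand-act (a ⊛ b) v = transᵗ (expand-act a (act b v))
    (transᵗ (▷-congˡ a (expand-act b v)) (symᵗ (▷-⊛ a b _)))
  expand-act (⊖ a)   v = transᵗ (expand-neg (act a v)) (transᵗ (neg-cong (expand-act a v)) (symᵗ (▷-⊖ a _)))

  -- The map supplied by the universal property of induction: `1 ⊗ 1` goes to the delta function at
  -- `v₀`, and equivariance dictates the rest.
  coordinates : Induced → Tensor
  coordinates (a ⊗ k)  w = k K.* act a (δ v₀) w
  coordinates 0ᵗ       w = K.0#
  coordinates (x +ᵗ y) w = coordinates x w K.+ coordinates y w
  coordinates (-ᵗ x)   w = K.- coordinates x w

  -- Young generators sit at equal neighbours of `v₀`, where T_i acts by -1, so the delta function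
  -- spans a sign module. This is what makes `coordinates` compatible with `balanced`.
  act-include : ∀ b → act (include b) (δ v₀) ≋ λ w → sgn b K.* δ v₀ w
  act-include (T (i , e)) = T·-δ-eq i v₀
    (≡.trans (orderAt-tabulate {n} (block μ) i)
      (≡.trans (≡.cong (order (block μ (toℕ i))) (≡.sym e)) (order-refl (block μ (toℕ i)))))
  act-include (κ c)   w = F.refl
  act-include (a ⊕ b) w = F.trans (F.+-cong (act-include a w) (act-include b w))
    (F.sym (F.distribʳ (δ v₀ w) (sgn a) (sgn b)))
  act-include (a ⊛ b) w = F.trans (act-cong (include a) (act-include b) w)
    (F.trans (act-* (include a) (sgn b) (δ v₀) w)
    (F.trans (F.*-congˡ {x = sgn b} (act-include a w))
    (F.trans (F.sym (F.*-assoc (sgn b) (sgn a) (δ v₀ w)))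
      (F.*-congʳ {x = δ v₀ w} (F.*-comm (sgn b) (sgn a))))))
  act-include (⊖ a)   w = F.trans (F.-‿cong (act-include a w)) (-‿distribˡ-* (sgn a) (δ v₀ w))
    where open import Algebra.Properties.Ring F.ring using (-‿distribˡ-*)

  coordinates-cong : ∀ {x y} → x ≈ᵗ y → coordinates x ≋ coordinates y
  coordinates-cong reflᵗ          w = F.refl
  coordinates-cong (symᵗ e)       w = F.sym (coordinates-cong e w)
  coordinates-cong (transᵗ e f)   w = F.trans (coordinates-cong e w) (coordinates-cong f w)
  coordinates-cong (+-cong e f)   w = F.+-cong (coordinates-cong e w) (coordinates-cong f w)
  coordinates-cong (neg-cong e)   w = F.-‿cong (coordinates-cong e w)
  coordinates-cong (⊗-cong {k = k} {k′} e f) w = F.*-cong (mk≃ {k} {k′} f) (act-≈ e (δ v₀) w)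
  coordinates-cong (+-assoc x y z)    w = F.+-assoc (coordinates x w) (coordinates y w) (coordinates z w)
  coordinates-cong (+-comm x y)       w = F.+-comm (coordinates x w) (coordinates y w)
  coordinates-cong (+-identityˡ x)    w = F.+-identityˡ (coordinates x w)
  coordinates-cong (neg-inverseˡ x)   w = F.-‿inverseˡ (coordinates x w)
  coordinates-cong (⊗-distribʳ a b k) w = F.distribˡ k (act a (δ v₀) w) (act b (δ v₀) w)
  coordinates-cong (⊗-distribˡ a k l) w = F.distribʳ (act a (δ v₀) w) k l
  coordinates-cong (balanced a b k)   w = F.trans
    (F.*-congˡ {x = k} (F.trans (act-cong a (act-include b) w) (act-* a (sgn b) (δ v₀) w)))
    (F.trans (F.sym (F.*-assoc k (sgn b) (act a (δ v₀) w)))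
      (F.*-congʳ {x = act a (δ v₀) w} (F.*-comm k (sgn b))))

  coordinates-▷ : ∀ h x → coordinates (h ▷ x) ≋ act h (coordinates x)
  coordinates-▷ h (a ⊗ k)  w = F.sym (act-* h k (act a (δ v₀)) w)
  coordinates-▷ h 0ᵗ       w = F.sym (F.trans
    (act-cong h (λ w → F.sym (F.zeroˡ K.0#)) w)
    (F.trans (act-* h K.0# (λ _ → K.0#) w) (F.zeroˡ (act h (λ _ → K.0#) w))))
  coordinates-▷ h (x +ᵗ y) w = F.trans (F.+-cong (coordinates-▷ h x w) (coordinates-▷ h y w))
    (F.sym (act-+ h (coordinates x) (coordinates y) w))
  coordinates-▷ h (-ᵗ x)   w = F.trans (F.-‿cong (coordinates-▷ h x w))
    (F.sym (F.trans (act-cong h (λ w → F.sym (-1*x≈-x (coordinates x w))) w)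
      (F.trans (act-* h -1ᴷ (coordinates x) w) (-1*x≈-x (act h (coordinates x) w)))))

  private
    coordinates-base : coordinates (κ K.1# ⊗ K.1#) ≋ δ v₀
    coordinates-base w = F.trans (F.*-identityˡ (K.1# K.* δ v₀ w)) (F.*-identityˡ (δ v₀ w))

    coordinates-vector-acc : ∀ (w : Word n) → Acc ℕ._<_ (weight w) → toList w ↭ toList v₀ →
                             coordinates (vector w) ≋ δ w
    coordinates-vector-acc w (acc rs) w∈ u with descent? w
    ... | inj₂ s with refl ← sorted-unique w v₀ s (blockWord-sorted n μ) w∈ =
      F.trans (coordinates-cong (standard-unique (vector-standard w) (base s)) u) (coordinates-base u)
    ... | inj₁ (i , d) = F.trans (coordinates-cong (vector-descent i w d) u)
      (F.trans (coordinates-▷ (T i) (vector (swap i w)) u)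
      (F.trans (T·-cong i (coordinates-vector-acc (swap i w) (rs (weight-swap i w d))
                            (Perm.↭-trans (swap-↭ i w) w∈)) u)
        (T·-δ-gt i w d u)))

  coordinates-vector : ∀ w → toList w ↭ toList v₀ → coordinates (vector w) ≋ δ w
  coordinates-vector w = coordinates-vector-acc w (<-wellFounded _)

  expand-δ : expand (δ v₀) ≈ᵗ κ K.1# ⊗ K.1#
  expand-δ = begin
    expand (δ v₀)                              ≈⟨ sum-single _ k₀ vanish ⟩
    κ (δ v₀ (word k₀)) ▷ vector (word k₀)      ≈⟨ ≡.subst (λ w → κ (δ v₀ w) ▷ vector w ≈ᵗ κ K.1# ▷ vector v₀)
                                                    (≡.sym k₀-word) (scale-congʳ (vector v₀) (δ-≡ {u = v₀} refl)) ⟩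
    κ K.1# ▷ vector v₀                         ≈⟨ ▷-identity (vector v₀) ⟩
    vector v₀                                  ≈⟨ standard-unique (vector-standard v₀) (base (blockWord-sorted n μ)) ⟩
    κ K.1# ⊗ K.1#                              ∎
    where
    open SingleTerm (AbelianGroup.commutativeMonoid induced-+-abelianGroup)
    k₀ = index v₀ Perm.↭-refl
    k₀-word = word-index v₀ Perm.↭-refl
    vanish : ∀ k → k ≢ k₀ → κ (δ v₀ (word k)) ▷ vector (word k) ≈ᵗ 0ᵗ
    vanish k k≢ = transᵗ
      (scale-congʳ (vector (word k)) (δ-≢ (λ e → k≢ (injective _ _ (≡.trans e (≡.sym k₀-word))))))
      (▷-zero (vector (word k)))

  -- The element `1 ⊗ 1` generates the module and is recovered by `expand-δ`. Equivariance of
  -- `expand` carries this over to every `a ⊗ k`, and `balanced` for a scalar moves `k` between the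
  -- algebra and the tensor factor.
  expansion : ∀ x → x ≈ᵗ expand (coordinates x)
  expansion (a ⊗ k)  = symᵗ (begin
    expand (λ w → k K.* act a (δ v₀) w)  ≈⟨ expand-* k (act a (δ v₀)) ⟩
    κ k ▷ expand (act a (δ v₀))          ≈⟨ ▷-congˡ (κ k) (expand-act a (δ v₀)) ⟩
    κ k ▷ a ▷ expand (δ v₀)              ≈⟨ ▷-congˡ (κ k) (▷-congˡ a expand-δ) ⟩
    (κ k ⊛ (a ⊛ κ K.1#)) ⊗ K.1#          ≈⟨ ⊗-congˡ (⊛-cong reflᴴ (⊛-identityʳ a)) ⟩
    (κ k ⊛ a) ⊗ K.1#                     ≈⟨ ⊗-congˡ (κ-central k a) ⟩
    (a ⊛ κ k) ⊗ K.1#                     ≈⟨ balanced a (κ k) K.1# ⟩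
    a ⊗ (k K.* K.1#)                     ≈⟨ ⊗-congʳ a (F.*-identityʳ k) ⟩
    a ⊗ k                                ∎)
  expansion 0ᵗ       = symᵗ (transᵗ (expand-cong (λ w → F.sym (F.zeroˡ K.0#)))
    (transᵗ (expand-* K.0# (λ _ → K.0#)) (▷-zero (expand (λ _ → K.0#)))))
  expansion (x +ᵗ y) = transᵗ (+-cong (expansion x) (expansion y))
    (symᵗ (expand-+ (coordinates x) (coordinates y)))
  expansion (-ᵗ x)   = transᵗ (neg-cong (expansion x)) (symᵗ (expand-neg (coordinates x)))

  coordinates-sum : ∀ {d} (x : Vector Induced d) w →
                    coordinates (sumᴹ x) w F.≈ sum (λ k → coordinates (x k) w)
  coordinates-sum {zero}  x w = F.refl
  coordinates-sum {suc d} x w = F.+-congˡ {coordinates (x zero) w} (coordinates-sum (λ k → x (suc k)) w)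

  coordinates-combination : ∀ (c : Vector K.Carrier size) j →
    coordinates (sumᴹ (λ k → κ (c k) ▷ vector (word k))) (word j) F.≈ c j
  coordinates-combination c j =
    F.trans (coordinates-sum (λ k → κ (c k) ▷ vector (word k)) (word j))
    (F.trans (sum-cong-≋ term) (F.trans (sum-single (λ k → c k K.* δ (word k) (word j)) j vanish)
      (F.trans (F.*-congˡ {c j} (δ-≡ {u = word j} refl)) (F.*-identityʳ (c j)))))
    where
    open SingleTerm F.+-commutativeMonoid
    term : ∀ k → coordinates (κ (c k) ▷ vector (word k)) (word j) F.≈ c k F.* δ (word k) (word j)
    term k = F.trans (coordinates-▷ (κ (c k)) (vector (word k)) (word j))
      (F.*-congˡ {c k} (coordinates-vector (word k) (sound k) (word j)))
    vanish : ∀ k → k ≢ j → c k F.* δ (word k) (word j) F.≈ K.0#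
    vanish k k≢j = F.trans (F.*-congˡ {c k} (δ-≢ (λ e → k≢j (injective _ _ (≡.sym e)))))
      (F.zeroʳ (c k))

  standardBasis : Basis size
  standardBasis = record
    { basis       = λ k → vector (word k)
    ; coordinate  = λ x k → coordinates x (word k)
    ; expansion   = expansion
    ; independent = λ c e j → F.trans (F.sym (coordinates-combination c j)) (coordinates-cong e (word j))
    }

  abstract
    character : H → K.Carrier
    character h = trace inducedModule (basis⇒finiteBasis standardBasis) (h ▷_)

    character-isInducedSignCharacter : IsInducedSignCharacter character
    character-isInducedSignCharacter = trace-isInducedSignCharacter standardBasis

    -- Moves the trace from the presented module to functions on words, where the diagonal entries
    -- can be evaluated at q = 0.
    character-formula : ∀ h → character h ≃ sum (λ k → act h (δ (word k)) (word k))
    character-formula h = sum-cong-≋ λ k → F.trans (coordinates-▷ h (vector (word k)) (word k))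
      (act-cong h (coordinates-vector (word k) (sound k)) (word k))

-- Linear systems that are unitriangular modulo q

allPairs-restrict : ∀ {A : Set} {P : A → Set} {R : A → A → Set} {xs} →
                    All P xs → AllPairs R xs → AllPairs (λ x y → R x y × P y) xs
allPairs-restrict []       []       = []
allPairs-restrict (p ∷ ps) (r ∷ rs) = All.zip (r , ps) ∷ allPairs-restrict ps rs

module Elimination
  (R : CommutativeRing 0ℓ 0ℓ)
  (Residue : CommutativeRing.Carrier R → ℚ → Set)
  (residue-+ : ∀ {x y r s} → Residue x r → Residue y s → Residue (CommutativeRing._+_ R x y) (r ℚ.+ s))
  (residue-* : ∀ {x y r s} → Residue x r → Residue y s → Residue (CommutativeRing._*_ R x y) (r ℚ.* s))
  (residue-neg : ∀ {x r} → Residue x r → Residue (CommutativeRing.-_ R x) (ℚ.- r))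
  (unit : ∀ {x} → Residue x 1ℚ → ∃ λ y → CommutativeRing._≈_ R (CommutativeRing._*_ R x y) (CommutativeRing.1# R))
  {H : Set} (origin : H) (_⊞_ : H → H → H) (_·_ : CommutativeRing.Carrier R → H → H)
  where

  open CommutativeRing R hiding (_-_)
  open import Algebra.Properties.Ring ring using (-‿distribˡ-*)
  open import Relation.Binary.Reasoning.Setoid setoid
  open import Algebra.Solver.Ring.NaturalCoefficients.Default commutativeSemiring

  record Linear (e : H → Carrier) : Set where
    field
      additive    : ∀ x y → e (x ⊞ y) ≈ e x + e y
      homogeneous : ∀ c x → e (c · x) ≈ c * e x

  open Linear

  -- A cross-multiplied row operation: if `a` and `z` are the values of `e₀` and `e` at the pivot
  -- vector, the new functional vanishes there. It remains a functional on all of H, so the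
  -- recursion can treat it like the original ones.
  eliminated : Carrier → Carrier → (H → Carrier) → (H → Carrier) → H → Carrier
  eliminated a z e e₀ x = a * e x + - z * e₀ x

  eliminated-linear : ∀ a z {e e₀} → Linear e → Linear e₀ → Linear (eliminated a z e e₀)
  eliminated-linear a z {e} {e₀} l l₀ = record
    { additive = λ x y → trans
        (+-cong (*-congˡ (additive l x y)) (*-congˡ (additive l₀ x y)))
        (solve 6 (λ a z s t u v → a :* (s :+ t) :+ z :* (u :+ v) :=
          (a :* s :+ z :* u) :+ (a :* t :+ z :* v)) refl a (- z) (e x) (e y) (e₀ x) (e₀ y))
    ; homogeneous = λ c x → trans
        (+-cong (*-congˡ (homogeneous l c x)) (*-congˡ (homogeneous l₀ c x)))
        (solve 5 (λ a z c s u → a :* (c :* s) :+ z :* (c :* u) := c :* (a :* s :+ z :* u))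
          refl a (- z) c (e x) (e₀ x)) }

  cancel : ∀ {a y u v} → a * y ≈ 1# → a * u ≈ a * v → u ≈ v
  cancel {a} {y} {u} {v} ay≈1 e = begin
    u             ≈⟨ restore u ⟩
    y * (a * u)   ≈⟨ *-congˡ e ⟩
    y * (a * v)   ≈⟨ sym (restore v) ⟩
    v             ∎
    where
    restore : ∀ x → x ≈ y * (a * x)
    restore x = begin
      x             ≈⟨ sym (*-identityˡ x) ⟩
      1# * x        ≈⟨ *-congʳ (sym ay≈1) ⟩
      a * y * x     ≈⟨ solve 3 (λ a y x → a :* y :* x := y :* (a :* x)) refl a y x ⟩
      y * (a * x)   ∎

  -- Here `u` and `w` are the values of a functional and of the pivot functional at the partial
  -- solution; adding t times the pivot vector raises them by t z and t a. The eliminated equation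
  -- is blind to this change, so combined with the corrected pivot equation it gives back the
  -- original equation times `a`.
  back-substitute : ∀ a z u w t c₀ c → a * u + - z * w ≈ a * c + - z * c₀ → w + t * a ≈ c₀ →
                    a * (u + t * z) ≈ a * c
  back-substitute a z u w t c₀ c e e₀ = begin
    a * (u + t * z)                             ≈⟨ sym (+-identityʳ _) ⟩
    a * (u + t * z) + 0#                        ≈⟨ +-congˡ (sym (trans (*-congʳ (-‿inverseˡ z)) (zeroˡ w))) ⟩
    a * (u + t * z) + (- z + z) * w             ≈⟨ solve 6 (λ a z z′ u t w →
                                                     a :* (u :+ t :* z) :+ (z′ :+ z) :* w :=
                                                     (a :* u :+ z′ :* w) :+ z :* (w :+ t :* a)) refl a z (- z) u t w ⟩
    (a * u + - z * w) + z * (w + t * a)         ≈⟨ +-cong e (*-congˡ e₀) ⟩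
    (a * c + - z * c₀) + z * c₀                 ≈⟨ solve 4 (λ z z′ x c₀ →
                                                     (x :+ z′ :* c₀) :+ z :* c₀ := x :+ (z′ :+ z) :* c₀)
                                                     refl z (- z) (a * c) c₀ ⟩
    a * c + (- z + z) * c₀                      ≈⟨ +-congˡ (trans (*-congʳ (-‿inverseˡ z)) (zeroˡ c₀)) ⟩
    a * c + 0#                                  ≈⟨ +-identityʳ _ ⟩
    a * c                                       ∎

  pivot-correction : ∀ {a y} w c₀ → a * y ≈ 1# → w + (y * (c₀ + - w)) * a ≈ c₀
  pivot-correction {a} {y} w c₀ ay≈1 = begin
    w + (y * (c₀ + - w)) * a   ≈⟨ +-congˡ (solve 3 (λ a y x → y :* x :* a := a :* y :* x) refl a y (c₀ + - w)) ⟩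
    w + (a * y) * (c₀ + - w)   ≈⟨ +-congˡ (trans (*-congʳ ay≈1) (*-identityˡ _)) ⟩
    w + (c₀ + - w)             ≈⟨ solve 3 (λ w c w′ → w :+ (c :+ w′) := c :+ (w′ :+ w)) refl w c₀ (- w) ⟩
    c₀ + (- w + w)             ≈⟨ trans (+-congˡ (-‿inverseˡ w)) (+-identityʳ c₀) ⟩
    c₀                         ∎

  -- The pivot has residue 1 and the multiplier residue 0, so on residues the row operation is the
  -- identity and unitriangularity survives. `y` comes from the side of the triangle without
  -- prescribed residues; whatever its residue `s` is, it gets multiplied by 0.
  residue-eliminated : ∀ {a x z y r s} → Residue a 1ℚ → Residue x r → Residue z 0ℚ → Residue y s →
                       Residue (a * x + - z * y) r
  residue-eliminated {r = r} {s} ra rx rz ry =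
    ≡.subst (Residue _) value (residue-+ (residue-* ra rx) (residue-* (residue-neg rz) ry))
    where
    value : 1ℚ ℚ.* r ℚ.+ (ℚ.- 0ℚ) ℚ.* s ≡ r
    value = ≡.trans (≡.cong₂ ℚ._+_ (ℚ.*-identityˡ r) (ℚ.*-zeroˡ s)) (ℚ.+-identityʳ r)

  -- Gaussian elimination; keeping the pivots as factors instead of
  -- dividing by them keeps all the entries in the domain of the residue.
  solvable : ∀ {I : Set} (L : List I) (e : I → H → Carrier) → (∀ i → Linear (e i)) → (g : I → H) →
             (∀ i j → ∃ (Residue (e j (g i)))) →
             AllPairs (λ i j → Residue (e j (g i)) 0ℚ) L →
             All (λ i → Residue (e i (g i)) 1ℚ) L →
             (c : I → Carrier) → ∃ λ x → All (λ i → e i x ≈ c i) L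
  solvable []       e l g integral []           []           c = origin , []
  solvable (k ∷ L) e l g integral (zs ∷ upper) (diag ∷ diags) c = x , pivot ∷ All.map others (proj₂ ih)
    where
    a = e k (g k)
    e′ = λ j → eliminated a (e j (g k)) (e j) (e k)
    ih = solvable L e′ (λ j → eliminated-linear a (e j (g k)) (l j) (l k)) g
      (λ i j → _ , residue-+ (residue-* diag (proj₂ (integral i j)))
                             (residue-* (residue-neg (proj₂ (integral k j))) (proj₂ (integral i k))))
      (AllPairs.map (λ {i} {j} (r , z) → residue-eliminated diag r z (proj₂ (integral i k)))
        (allPairs-restrict zs upper))
      (All.zipWith (λ {i} (z , d) → residue-eliminated diag d z (proj₂ (integral i k))) (zs , diags))
      (λ j → a * c j + - e j (g k) * c k)
    x′ = proj₁ ih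
    y = proj₁ (unit diag)
    t = y * (c k + - e k x′)
    -- The functionals `e′` vanish at `g k`, so this summand leaves their equations intact and `t`
    -- is free to repair the pivot equation.
    x = x′ ⊞ (t · g k)
    value : ∀ j → e j x ≈ e j x′ + t * e j (g k)
    value j = trans (additive (l j) x′ (t · g k)) (+-congˡ (homogeneous (l j) t (g k)))
    pivot : e k x ≈ c k
    pivot = trans (value k) (pivot-correction (e k x′) (c k) (proj₂ (unit diag)))
    others : ∀ {j} → e′ j x′ ≈ a * c j + - e j (g k) * c k → e j x ≈ c j
    others {j} h = trans (value j) (cancel (proj₂ (unit diag))
      (back-substitute a (e j (g k)) (e j x′) (e k x′) t (c k) (c j) h
        (pivot-correction (e k x′) (c k) (proj₂ (unit diag)))))

-- Column reading words of partitions

module ColumnWords where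
  open import Data.Nat.Base using (_+_; _∸_)
  open import Relation.Binary.PropositionalEquality

  -- The letters of the sorted word, built by adding a new first row and raising the older letters.
  -- The recursion runs parallel to that of `columns`, which makes the two comparable.
  flatten : List ℕ → List ℕ
  flatten []      = []
  flatten (l ∷ μ) = replicate l 0 ++ List.map suc (flatten μ)

  applyUpTo-+ : ∀ {A : Set} (f : ℕ → A) m n → applyUpTo f (m + n) ≡ applyUpTo f m ++ applyUpTo (λ k → f (m + k)) n
  applyUpTo-+ f zero    n = refl
  applyUpTo-+ f (suc m) n = cong (f 0 ∷_) (applyUpTo-+ (λ k → f (suc k)) m n)

  applyUpTo-cong : ∀ {A : Set} {f g : ℕ → A} n → (∀ k → k < n → f k ≡ g k) → applyUpTo f n ≡ applyUpTo g n
  applyUpTo-cong zero    e = refl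
  applyUpTo-cong (suc n) e = cong₂ _∷_ (e 0 ℕ.z<s) (applyUpTo-cong n (λ k p → e (suc k) (s≤s p)))

  applyUpTo-const : ∀ {A : Set} (a : A) n → applyUpTo (λ _ → a) n ≡ replicate n a
  applyUpTo-const a zero    = refl
  applyUpTo-const a (suc n) = cong (a ∷_) (applyUpTo-const a n)

  toList-tabulate : ∀ {A : Set} (f : ℕ → A) n → toList (tabulate {n = n} (λ k → f (toℕ k))) ≡ applyUpTo f n
  toList-tabulate f zero    = refl
  toList-tabulate f (suc n) = cong (f 0 ∷_) (toList-tabulate (λ k → f (suc k)) n)

  block-here : ∀ l μ k → k < l → block (l ∷ μ) k ≡ 0
  block-here l μ k k<l with k ℕ.<ᵇ l | ℕ.<ᵇ-reflects-< k l
  ... | true  | _       = refl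
  ... | false | ofⁿ k≮l = contradiction k<l k≮l

  block-there : ∀ l μ k → block (l ∷ μ) (l + k) ≡ suc (block μ k)
  block-there l μ k with (l + k) ℕ.<ᵇ l | ℕ.<ᵇ-reflects-< (l + k) l
  ... | true  | ofʸ l+k<l = contradiction l+k<l (ℕ.≤⇒≯ (ℕ.m≤m+n l k))
  ... | false | _         = cong (λ k → suc (block μ k)) (ℕ.m+n∸m≡n l k)

  applyUpTo-block : ∀ μ → applyUpTo (block μ) (ListAction.sum μ) ≡ flatten μ
  applyUpTo-block []      = refl
  applyUpTo-block (l ∷ μ) = trans (applyUpTo-+ (block (l ∷ μ)) l (ListAction.sum μ)) (cong₂ _++_
    (trans (applyUpTo-cong l (block-here l μ)) (applyUpTo-const 0 l))
    (trans (applyUpTo-cong (ListAction.sum μ) (λ k _ → block-there l μ k))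
      (trans (sym (List.map-applyUpTo (block μ) suc (ListAction.sum μ))) (cong (List.map suc) (applyUpTo-block μ)))))

  toList-blockWord : ∀ {n} μ → ListAction.sum μ ≡ n → toList (blockWord n μ) ≡ flatten μ
  toList-blockWord μ refl = trans (toList-tabulate (block μ) (ListAction.sum μ)) (applyUpTo-block μ)

  private
    runs-injective : ∀ k l x y → replicate k 0 ++ List.map suc x ≡ replicate l 0 ++ List.map suc y → k ≡ l × x ≡ y
    runs-injective zero    zero    x       y       e = refl , List.map-injective ℕ.suc-injective e
    runs-injective zero    (suc l) []      y       ()
    runs-injective zero    (suc l) (_ ∷ _) y       ()
    runs-injective (suc k) zero    x       []      ()
    runs-injective (suc k) zero    x       (_ ∷ _) ()
    runs-injective (suc k) (suc l) x       y       e with runs-injective k l x y (List.∷-injectiveʳ e)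
    ... | refl , x≡y = refl , x≡y

  flatten-injective : ∀ {μ ν} → All (0 <_) μ → All (0 <_) ν → flatten μ ≡ flatten ν → μ ≡ ν
  flatten-injective []            []            e = refl
  flatten-injective []            (s≤s _ ∷ _)   ()
  flatten-injective (s≤s _ ∷ _)   []            ()
  flatten-injective {k ∷ μ} {l ∷ ν} (_ ∷ ps) (_ ∷ qs) e with runs-injective k l (flatten μ) (flatten ν) e
  ... | refl , e′ = cong (k ∷_) (flatten-injective ps qs e′)

  -- The reading word 0 1 … μ′₁-1, 0 1 … μ′₂-1, … of the columns of the
  -- diagram of μ, built row by row: a new first row raises the letters, puts
  -- a 0 in front of each old column and adds columns of height one.
  raise : List ℕ → List ℕ
  raise []          = []
  raise (zero  ∷ w) = 0 ∷ 1 ∷ raise w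
  raise (suc a ∷ w) = suc (suc a) ∷ raise w

  largest : List ℕ → ℕ
  largest []      = 0
  largest (l ∷ μ) = l

  columns : List ℕ → List ℕ
  columns []      = []
  columns (l ∷ μ) = raise (columns μ) ++ replicate (l ∸ largest μ) 0

  zeros : List ℕ → ℕ
  zeros []          = 0
  zeros (zero  ∷ w) = suc (zeros w)
  zeros (suc _ ∷ w) = zeros w

  zeros-↭ : ∀ {u w} → u ↭ w → zeros u ≡ zeros w
  zeros-↭ Perm.refl                       = refl
  zeros-↭ (Perm.prep zero p)              = cong suc (zeros-↭ p)
  zeros-↭ (Perm.prep (suc _) p)           = zeros-↭ p
  zeros-↭ (Perm.swap zero zero p)         = cong (λ k → suc (suc k)) (zeros-↭ p)
  zeros-↭ (Perm.swap zero (suc _) p)      = cong suc (zeros-↭ p)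
  zeros-↭ (Perm.swap (suc _) zero p)      = cong suc (zeros-↭ p)
  zeros-↭ (Perm.swap (suc _) (suc _) p)   = zeros-↭ p
  zeros-↭ (Perm.trans p r)                = trans (zeros-↭ p) (zeros-↭ r)

  zeros-runs : ∀ l w → zeros (replicate l 0 ++ List.map suc w) ≡ l
  zeros-runs zero    []      = refl
  zeros-runs zero    (a ∷ w) = zeros-runs zero w
  zeros-runs (suc l) w       = cong suc (zeros-runs l w)

  zeros-flatten : ∀ μ → zeros (flatten μ) ≡ largest μ
  zeros-flatten []      = refl
  zeros-flatten (l ∷ μ) = zeros-runs l (flatten μ)

  raise-↭ : ∀ w → raise w ↭ replicate (zeros w) 0 ++ List.map suc w
  raise-↭ []          = ↭-refl
  raise-↭ (zero  ∷ w) = Perm.prep 0 (↭-trans (Perm.prep 1 (raise-↭ w))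
    (↭-sym (shift 1 (replicate (zeros w) 0) (List.map suc w))))
  raise-↭ (suc a ∷ w) = ↭-trans (Perm.prep (suc (suc a)) (raise-↭ w))
    (↭-sym (shift (suc (suc a)) (replicate (zeros w) 0) (List.map suc w)))

  replicate-+ : ∀ k l → replicate k 0 ++ replicate l 0 ≡ replicate (k + l) 0
  replicate-+ zero    l = refl
  replicate-+ (suc k) l = cong (0 ∷_) (replicate-+ k l)

  largest-≤ : ∀ {l μ} → Linked ℕ._≥_ (l ∷ μ) → largest μ ≤ l
  largest-≤ [-]     = z≤n
  largest-≤ (p ∷ _) = p

  -- Each column starts with its only 0, so the old word has `largest μ` zeros and `raise` inserts
  -- that many new ones. The added columns of height one bring the number of zeros up to l, since in
  -- a partition `largest μ` is at most l.
  columns-↭ : ∀ {μ} → Linked ℕ._≥_ μ → columns μ ↭ flatten μ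
  columns-↭ {[]}    _ = ↭-refl
  columns-↭ {l ∷ μ} p = begin
    raise (columns μ) ++ replicate (l ∸ h) 0
      ↭⟨ ++⁺ʳ _ (raise-↭ (columns μ)) ⟩
    (replicate (zeros (columns μ)) 0 ++ List.map suc (columns μ)) ++ replicate (l ∸ h) 0
      ≡⟨ cong (λ z → (replicate z 0 ++ List.map suc (columns μ)) ++ replicate (l ∸ h) 0)
           (trans (zeros-↭ ih) (zeros-flatten μ)) ⟩
    (replicate h 0 ++ List.map suc (columns μ)) ++ replicate (l ∸ h) 0
      ↭⟨ ++⁺ʳ _ (++⁺ˡ (replicate h 0) (map⁺ suc ih)) ⟩
    (replicate h 0 ++ List.map suc (flatten μ)) ++ replicate (l ∸ h) 0
      ↭⟨ ++-comm (replicate h 0 ++ List.map suc (flatten μ)) (replicate (l ∸ h) 0) ⟩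
    replicate (l ∸ h) 0 ++ replicate h 0 ++ List.map suc (flatten μ)
      ≡⟨ sym (List.++-assoc (replicate (l ∸ h) 0) (replicate h 0) _) ⟩
    (replicate (l ∸ h) 0 ++ replicate h 0) ++ List.map suc (flatten μ)
      ≡⟨ cong (_++ List.map suc (flatten μ)) (trans (replicate-+ (l ∸ h) h)
           (cong (λ k → replicate k 0) (ℕ.m∸n+n≡m (largest-≤ p)))) ⟩
    replicate l 0 ++ List.map suc (flatten μ) ∎
    where
    open PermutationReasoning
    h = largest μ
    ih : columns μ ↭ flatten μ
    ih = columns-↭ (Linked.tail p)

  Climbing : ℕ → List ℕ → Set
  Climbing a []      = ⊤
  Climbing a (b ∷ w) = (b ≡ 0 ⊎ b ≡ suc a) × Climbing b w

  StartsClimbing : List ℕ → Set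
  StartsClimbing []      = ⊤
  StartsClimbing (a ∷ w) = a ≡ 0 × Climbing a w

  climbing-zeros : ∀ a k → Climbing a (replicate k 0)
  climbing-zeros a zero    = tt
  climbing-zeros a (suc k) = inj₁ refl , climbing-zeros 0 k

  -- The preceding letter becomes `suc a` because `raise` replaces each letter by its successor; a
  -- letter 0 also receives a new 0 in front, which restarts the climb.
  climbing-raise : ∀ a w k → Climbing a w → Climbing (suc a) (raise w ++ replicate k 0)
  climbing-raise a []          k _                 = climbing-zeros (suc a) k
  climbing-raise a (zero  ∷ w) k (_ , c)           = inj₁ refl , inj₂ refl , climbing-raise 0 w k c
  climbing-raise a (suc b ∷ w) k (inj₂ refl , c)   = inj₂ refl , climbing-raise (suc b) w k c

  columns-climbing : ∀ μ → StartsClimbing (columns μ)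
  columns-climbing []      = tt
  columns-climbing (l ∷ μ) = starts-raise (columns μ) (columns-climbing μ)
    where
    starts-zeros : ∀ k → StartsClimbing (replicate k 0)
    starts-zeros zero    = tt
    starts-zeros (suc k) = refl , climbing-zeros 0 k
    starts-raise : ∀ w → StartsClimbing w → StartsClimbing (raise w ++ replicate (l ∸ largest μ) 0)
    starts-raise []         _       = starts-zeros (l ∸ largest μ)
    starts-raise (zero ∷ w) (_ , c) = refl , inj₂ refl , climbing-raise 0 w _ c

  -- For a partition of n the column word has exactly n letters, so neither the filler 0 nor the
  -- truncation takes effect there.
  pad : ∀ n → List ℕ → Word n
  pad zero    w       = []
  pad (suc n) []      = 0 ∷ pad n []
  pad (suc n) (a ∷ w) = a ∷ pad n w

  toList-pad : ∀ n w → length w ≡ n → toList (pad n w) ≡ w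
  toList-pad zero    []      e = refl
  toList-pad (suc n) (a ∷ w) e = cong (a ∷_) (toList-pad n w (ℕ.suc-injective e))

  columnWord : ∀ n → List ℕ → Word n
  columnWord n μ = pad n (columns μ)

  length-flatten : ∀ μ → length (flatten μ) ≡ ListAction.sum μ
  length-flatten μ = trans (cong length (sym (applyUpTo-block μ))) (List.length-applyUpTo (block μ) (ListAction.sum μ))

  toList-columnWord : ∀ {n μ} → μ ⊢ n → toList (columnWord n μ) ≡ columns μ
  toList-columnWord {n} {μ} (p , _ , e) =
    toList-pad n (columns μ) (trans (↭-length (columns-↭ p)) (trans (length-flatten μ) e))

  columnWord-↭ : ∀ {n μ} → μ ⊢ n → toList (columnWord n μ) ↭ toList (blockWord n μ)
  columnWord-↭ {n} {μ} ⊢μ@(p , _ , e) = ↭-trans (↭-reflexive (toList-columnWord ⊢μ))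
    (↭-trans (columns-↭ p) (↭-reflexive (sym (toList-blockWord μ e))))

  infix 4 _⊑_

  _⊑_ : ∀ {n} → Word n → Word n → Set
  u ⊑ w = ∀ i → orderAt i u ≡ lt → orderAt i w ≡ lt

  data _≤ʷ_ : ∀ {n} → Word n → Word n → Set where
    []  : [] ≤ʷ []
    _∷_ : ∀ {n a b} {u w : Word n} → a ≤ b → u ≤ʷ w → (a ∷ u) ≤ʷ (b ∷ w)

  ≤ʷ-sum : ∀ {n} {u w : Word n} → u ≤ʷ w → ListAction.sum (toList u) ≤ ListAction.sum (toList w)
  ≤ʷ-sum []       = z≤n
  ≤ʷ-sum (p ∷ ps) = ℕ.+-mono-≤ p (≤ʷ-sum ps)

  -- The letterwise differences are nonnegative and their total is at most 0.
  ≤ʷ-antisym : ∀ {n} {u w : Word n} → u ≤ʷ w → ListAction.sum (toList w) ≤ ListAction.sum (toList u) → u ≡ w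
  ≤ʷ-antisym []                   _ = refl
  ≤ʷ-antisym {u = a ∷ u} {w = b ∷ w} (p ∷ ps) s = cong₂ _∷_ a≡b (≤ʷ-antisym ps
    (ℕ.+-cancelˡ-≤ a _ _ (subst (λ b → b + _ ≤ a + _) (sym a≡b) s)))
    where
    a≡b : a ≡ b
    a≡b = ℕ.≤-antisym p (ℕ.+-cancelʳ-≤ (ListAction.sum (toList w)) b a
      (ℕ.≤-trans s (ℕ.+-monoʳ-≤ a (≤ʷ-sum ps))))

  -- The induction keeps the previous letter of u below that of w. A letter 0 of u is below
  -- anything. A letter `suc a` of u completes an ascent, so w also ascends there from some b ≥ a,
  -- and its next letter is at least `suc a`.
  climbing-least : ∀ {n a b} (u w : Word n) → Climbing a (toList u) → a ≤ b → (a ∷ u) ⊑ (b ∷ w) → u ≤ʷ w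
  climbing-least []      []      _ _ _ = []
  climbing-least (_ ∷ u) (c ∷ w) (inj₁ refl , cl) a≤b asc =
    z≤n ∷ climbing-least u w cl z≤n (λ i → asc (suc i))
  climbing-least {a = a} {b} (_ ∷ u) (c ∷ w) (inj₂ refl , cl) a≤b asc =
    a<c ∷ climbing-least u w cl a<c (λ i → asc (suc i))
    where
    a<c : a < c
    a<c = ℕ.≤-<-trans a≤b (order-lt b c (asc zero (order-<⇒lt (ℕ.n<1+n a))))

  startsClimbing-least : ∀ {n} (u w : Word n) → StartsClimbing (toList u) → u ⊑ w → u ≤ʷ w
  startsClimbing-least []      []      _           _   = []
  startsClimbing-least (_ ∷ u) (b ∷ w) (refl , cl) asc = z≤n ∷ climbing-least u w cl z≤n asc

  -- The statistic known as n(μ), the sum of (i - 1) μᵢ, which is the sum of the letters of every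
  -- word of content μ. Unlike the dominance order it compares any two partitions, so they can be
  -- listed along it.
  rank : List ℕ → ℕ
  rank μ = ListAction.sum (flatten μ)

  -- The column word of ν lies letterwise below w, so rank ν is at most the sum of w, which is rank
  -- μ. By hypothesis the sums then agree, hence so do the words, and their common sorted
  -- rearrangement determines the partition.
  columnWord-extremal : ∀ {n μ ν} → μ ⊢ n → ν ⊢ n → rank μ ≤ rank ν →
    ∀ w → toList w ↭ toList (blockWord n μ) → columnWord n ν ⊑ w → w ≡ columnWord n ν × μ ≡ ν
  columnWord-extremal {n} {μ} {ν} ⊢μ@(_ , μ>0 , eμ) ⊢ν@(pν , ν>0 , eν) rμ≤rν w w∈ asc =
    sym u≡w , flatten-injective μ>0 ν>0 (trans (sym (toList-blockWord μ eμ))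
      (trans (cong toList same-block) (toList-blockWord ν eν)))
    where
    u = columnWord n ν
    u≤w : u ≤ʷ w
    u≤w = startsClimbing-least u w (subst StartsClimbing (sym (toList-columnWord ⊢ν)) (columns-climbing ν)) asc
    sum-w : ListAction.sum (toList w) ≡ rank μ
    sum-w = trans (sum-↭ w∈) (cong ListAction.sum (toList-blockWord μ eμ))
    sum-u : ListAction.sum (toList u) ≡ rank ν
    sum-u = trans (sum-↭ (columnWord-↭ ⊢ν)) (cong ListAction.sum (toList-blockWord ν eν))
    u≡w : u ≡ w
    u≡w = ≤ʷ-antisym u≤w (subst₂ _≤_ (sym sum-w) (sym sum-u) rμ≤rν)
    same-block : blockWord n μ ≡ blockWord n ν
    same-block = sorted-unique _ _ (blockWord-sorted n μ) (blockWord-sorted n ν)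
      (↭-trans (↭-sym w∈) (↭-trans (↭-reflexive (cong toList (sym u≡w))) (columnWord-↭ ⊢ν)))

open ColumnWords

-- Character values at q = 0

module CharacterResidues where
  open import Relation.Binary.PropositionalEquality using (refl)
  open import Algebra.Properties.CommutativeMonoid.Sum ℚ.+-0-commutativeMonoid using () renaming (sum to sumℚ)
  open import Algebra.Properties.Semiring.Sum F.semiring using (sum)

  lt? : ∀ o → Dec (o ≡ lt)
  lt? lt = yes refl
  lt? eq = no λ ()
  lt? gt = no λ ()

  ascents : ∀ {n} → Word n → List (Fin (pred n))
  ascents {n} u = filter (λ i → lt? (orderAt i u)) (allFin (pred n))

  constantTerm-sum : ∀ {d} (x : Vector K.Carrier d) (r : Vector ℚ d) →
                     (∀ k → ConstantTerm (x k) (r k)) → ConstantTerm (sum x) (sumℚ r)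
  constantTerm-sum {zero}  x r c = constantTerm-0
  constantTerm-sum {suc d} x r c = constantTerm-+ {x zero} (c zero)
    (constantTerm-sum (λ k → x (suc k)) (λ k → r (suc k)) (λ k → c (suc k)))

  constantTerm--1 : ConstantTerm -1ᴷ (ℚ.- 1ℚ)
  constantTerm--1 = constantTerm-neg {K.1#} constantTerm-1

  constantTerm-p : ConstantTerm p (ℚ.- 1ℚ)
  constantTerm-p = constantTerm-+ {q} { -1ᴷ} constantTerm-q constantTerm--1

  module ConstantTerms (n : ℕ) where
    open Hecke n
    open HeckeAction n

    -- At q = 0 the factor 1 + T_i is an idempotent of the 0-Hecke algebra: it
    -- kills the words with w_i ≥ w_{i+1}, and adds to any other word w a word
    -- with more inversions.
    product : List Gen → H
    product = foldr (λ i h → (κ K.1# ⊕ T i) ⊛ h) (κ K.1#)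

    -- The action of 1 + T_i at q = 0.
    reduce : Order → ℚ → ℚ → ℚ
    reduce lt r s = r
    reduce eq r s = 0ℚ
    reduce gt r s = s

    -- The effect of `reduce` on a leading coefficient, where the swapped word of a descent
    -- contributes 0.
    keep : Order → ℚ → ℚ
    keep lt r = r
    keep eq r = 0ℚ
    keep gt r = 0ℚ

    survive : List Gen → Word n → ℚ
    survive J w = foldr (λ i → keep (orderAt i w)) 1ℚ J

    -- The residue is the value of v at q = 0.
    record Leading (w : Word n) (v : Tensor) (r : ℚ) : Set where
      field
        residue      : Word n → ℚ
        constantTerm : ∀ u → ConstantTerm (v u) (residue u)
        lower        : ∀ u → u ≢ w → weight u ℕ.≤ weight w → residue u ≡ 0ℚ
        leading      : residue w ≡ r

    constantTerm-mix : ∀ o {x y r s} → ConstantTerm x r → ConstantTerm y s →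
                       ConstantTerm (K.1# K.* x K.+ mix o x y) (reduce o r s)
    constantTerm-mix lt {x} {y} {r} {s} cx cy = ≡.subst (ConstantTerm _)
      (solve 2 (λ r s → con 1ℚ :* r :+ con 0ℚ :* s := r) refl r s)
      (constantTerm-+ {K.1# K.* x} {q K.* y} (constantTerm-* {K.1#} {x} constantTerm-1 cx)
        (constantTerm-* {q} {y} constantTerm-q cy))
      where open ℚSolver.+-*-Solver
    constantTerm-mix eq {x} {y} {r} {s} cx cy = ≡.subst (ConstantTerm _)
      (solve 1 (λ r → con 1ℚ :* r :+ con (ℚ.- 1ℚ) :* r := con 0ℚ) refl r)
      (constantTerm-+ {K.1# K.* x} { -1ᴷ K.* x} (constantTerm-* {K.1#} {x} constantTerm-1 cx)
        (constantTerm-* { -1ᴷ} {x} constantTerm--1 cx))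
      where open ℚSolver.+-*-Solver
    constantTerm-mix gt {x} {y} {r} {s} cx cy = ≡.subst (ConstantTerm _)
      (solve 2 (λ r s → con 1ℚ :* r :+ (s :+ con (ℚ.- 1ℚ) :* r) := s) refl r s)
      (constantTerm-+ {K.1# K.* x} {y K.+ p K.* x} (constantTerm-* {K.1#} {x} constantTerm-1 cx)
        (constantTerm-+ {y} {p K.* x} cy (constantTerm-* {p} {x} constantTerm-p cx)))
      where open ℚSolver.+-*-Solver

    leading-δ : ∀ w → Leading w (act (κ K.1#) (δ w)) 1ℚ
    leading-δ w = record
      { residue      = residue
      ; constantTerm = λ u → constantTerm-≃ (F.sym (F.*-identityˡ (δ w u))) (at u (u ≟ʷ w))
      ; lower        = λ u u≢w _ → vanish u u≢w
      ; leading      = value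
      }
      where
      residue : Word n → ℚ
      residue u = if does (u ≟ʷ w) then 1ℚ else 0ℚ
      vanish : ∀ u → u ≢ w → residue u ≡ 0ℚ
      vanish u u≢w = ≡.cong (if_then 1ℚ else 0ℚ) (dec-false (u ≟ʷ w) u≢w)
      value : residue w ≡ 1ℚ
      value = ≡.cong (if_then 1ℚ else 0ℚ) (dec-true (w ≟ʷ w) refl)
      at : ∀ u → Dec (u ≡ w) → ConstantTerm (δ w u) (residue u)
      at u (yes refl) = ≡.subst (ConstantTerm _) (≡.sym value)
        (constantTerm-≃ (F.sym (δ-≡ {u = w} refl)) constantTerm-1)
      at u (no u≢w) = ≡.subst (ConstantTerm _) (≡.sym (vanish u u≢w))
        (constantTerm-≃ (F.sym (δ-≢ u≢w)) constantTerm-0)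

    -- At a word u with a descent at i the new value is the old one at `swap i u`. That word has
    -- smaller weight than u, so the value vanishes as long as u is no heavier than w. Thus nothing
    -- new appears up to the weight of w, and the coefficient of w persists only if w ascends at i.
    leading-step : ∀ i {w v r} → Leading w v r → Leading w (act (κ K.1# ⊕ T i) v) (keep (orderAt i w) r)
    leading-step i {w} {v} {r} L = record
      { residue      = ρ
      ; constantTerm = λ u → constantTerm-mix (orderAt i u) (constantTerm u) (constantTerm (swap i u))
      ; lower        = lower′
      ; leading      = leading′
      }
      where
      open Leading L
      ρ : Word n → ℚ
      ρ u = reduce (orderAt i u) (residue u) (residue (swap i u))
      below : ∀ u → orderAt i u ≡ gt → weight u ℕ.≤ weight w → residue (swap i u) ≡ 0ℚ
      below u d u≤w = lower (swap i u) (λ e → ℕ.<-irrefl (≡.cong weight e) su<w) (ℕ.<⇒≤ su<w)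
        where su<w = ℕ.<-≤-trans (weight-swap i u d) u≤w
      lower′ : ∀ u → u ≢ w → weight u ℕ.≤ weight w → ρ u ≡ 0ℚ
      lower′ u u≢w u≤w with orderAt i u in e
      ... | lt = lower u u≢w u≤w
      ... | eq = refl
      ... | gt = below u e u≤w
      leading′ : ρ w ≡ keep (orderAt i w) r
      leading′ with orderAt i w in e
      ... | lt = leading
      ... | eq = refl
      ... | gt = below w e ℕ.≤-refl

    leading-product : ∀ J w → Leading w (act (product J) (δ w)) (survive J w)
    leading-product []      w = leading-δ w
    leading-product (i ∷ J) w = leading-step i (leading-product J w)

    survive-ascents : ∀ J w → All (λ i → orderAt i w ≡ lt) J → survive J w ≡ 1ℚ
    survive-ascents []      w []       = refl
    survive-ascents (i ∷ J) w (e ∷ es) = ≡.trans (≡.cong (λ o → keep o (survive J w)) e) (survive-ascents J w es)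

    survive-dichotomy : ∀ J w → survive J w ≡ 0ℚ ⊎ All (λ i → orderAt i w ≡ lt) J
    survive-dichotomy []      w = inj₂ []
    survive-dichotomy (i ∷ J) w with orderAt i w in e | survive-dichotomy J w
    ... | lt | inj₁ z  = inj₁ z
    ... | lt | inj₂ es = inj₂ (e ∷ es)
    ... | eq | _       = inj₁ refl
    ... | gt | _       = inj₁ refl

    detector : List ℕ → H
    detector ν = product (ascents (columnWord n ν))

    module _ (μ ν : List ℕ) where
      open StandardBasis n μ

      private
        u = columnWord n ν
        J = ascents u

        r : Fin size → ℚ
        r k = survive J (word k)

      constantTerm-character : ConstantTerm (character (detector ν)) (sumℚ r)
      constantTerm-character = constantTerm-≃ (F.sym (character-formula (detector ν)))
        (constantTerm-sum (λ k → act (detector ν) (δ (word k)) (word k)) r λ k →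
          let open Leading (leading-product J (word k)) in
          ≡.subst (ConstantTerm _) leading (constantTerm (word k)))

      private
        ⊑-ascents : ∀ {w} → All (λ i → orderAt i w ≡ lt) J → u ⊑ w
        ⊑-ascents es i e = All.lookup es (∈-filter⁺ (λ i → lt? (orderAt i u)) (∈-allFin i) e)

        open SingleTerm ℚ.+-0-commutativeMonoid

      constantTerm-off-diagonal : μ ⊢ n → ν ⊢ n → rank μ ℕ.≤ rank ν → μ ≢ ν →
                                  ConstantTerm (character (detector ν)) 0ℚ
      constantTerm-off-diagonal ⊢μ ⊢ν μ≤ν μ≢ν =
        ≡.subst (ConstantTerm _) (sum-zero r vanish) constantTerm-character
        where
        vanish : ∀ k → r k ≡ 0ℚ
        vanish k = [ id , (λ es → contradiction
          (proj₂ (columnWord-extremal ⊢μ ⊢ν μ≤ν (word k) (sound k) (⊑-ascents es))) μ≢ν)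
          ]′ (survive-dichotomy J (word k))

    constantTerm-diagonal : ∀ μ → μ ⊢ n → ConstantTerm (StandardBasis.character n μ (detector μ)) 1ℚ
    constantTerm-diagonal μ ⊢μ = ≡.subst (ConstantTerm _)
      (≡.trans (sum-single (λ k → survive J (word k)) k₀ vanish)
        (≡.trans (≡.cong (survive J) k₀-word) (survive-ascents J u (all-filter (λ i → lt? (orderAt i u)) (allFin (pred n))))))
      (constantTerm-character μ μ)
      where
      open StandardBasis n μ
      open SingleTerm ℚ.+-0-commutativeMonoid
      u = columnWord n μ
      J = ascents u
      k₀ = index u (columnWord-↭ ⊢μ)
      k₀-word = word-index u (columnWord-↭ ⊢μ)
      vanish : ∀ k → k ≢ k₀ → survive J (word k) ≡ 0ℚ
      vanish k k≢k₀ = [ id , (λ es → contradiction (injective k k₀ (≡.trans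
        (proj₁ (columnWord-extremal ⊢μ ⊢μ ℕ.≤-refl (word k) (sound k)
          (λ i e → All.lookup es (∈-filter⁺ (λ i → lt? (orderAt i u)) (∈-allFin i) e))))
        (≡.sym k₀-word))) k≢k₀) ]′ (survive-dichotomy J (word k))

open CharacterResidues

-- Coefficients of Y and interpolation of characters

module Interpolation where
  open import Data.Nat.Base using (_+_)
  open import Relation.Binary.PropositionalEquality using (refl)

  words-length : ∀ letters l {w} → w ∈ words letters l → length w ≡ l
  words-length letters zero    (here refl) = refl
  words-length letters (suc l) w∈ with ∈-cartesianProductWith⁻ _∷_ letters (words letters l) w∈
  ... | _ , _ , _ , v∈ , refl = ≡.cong suc (words-length letters l v∈)

  words-unique : ∀ {letters} → Unique letters → ∀ l → Unique (words letters l)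
  words-unique u zero    = [] ∷ []
  words-unique u (suc l) = Unique.cartesianProductWith⁺ _∷_ List.∷-injective u (words-unique u l)

  words-complete : ∀ {letters} w → All (_∈ letters) w → w ∈ words letters (length w)
  words-complete []      []       = here refl
  words-complete (a ∷ w) (p ∷ ps) = ∈-cartesianProductWith⁺ _∷_ p (words-complete w ps)

  partitions-unique : ∀ n → Unique (partitions n)
  partitions-unique n = Unique.filter⁺ (_⊢? n) {xs = concatMap (words letters) (upTo (suc n))}
    (Unique.concat⁺ {xss = List.map (words letters) (upTo (suc n))} each-unique pairwise-disjoint)
    where
    letters : List ℕ
    letters = applyUpTo suc n
    letters-unique : Unique letters
    letters-unique = Unique.applyUpTo⁺₁ suc n (λ i<j _ e → ℕ.<-irrefl (ℕ.suc-injective e) i<j)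
    disjoint : ∀ {k l} → k ≢ l → Disjoint (words letters k) (words letters l)
    disjoint k≢l (w∈ , w∈′) = k≢l (≡.trans (≡.sym (words-length letters _ w∈)) (words-length letters _ w∈′))
    each-unique : All Unique (List.map (words letters) (upTo (suc n)))
    each-unique = All.map⁺ {xs = upTo (suc n)} (All.universal (words-unique letters-unique) (upTo (suc n)))
    pairwise-disjoint : AllPairs Disjoint (List.map (words letters) (upTo (suc n)))
    pairwise-disjoint = AllPairs.map⁺ {xs = upTo (suc n)} (AllPairs.map disjoint (Unique.upTo⁺ (suc n)))

  length-≤-sum : ∀ {μ} → All (0 <_) μ → length μ ≤ ListAction.sum μ
  length-≤-sum []       = z≤n
  length-≤-sum (p ∷ ps) = ℕ.+-mono-≤ p (length-≤-sum ps)

  partitions-complete : ∀ {n μ} → μ ⊢ n → μ ∈ partitions n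
  partitions-complete {n} {μ} ⊢μ@(_ , μ>0 , refl) = ∈-filter⁺ (_⊢? n)
    (∈-concatMap⁺ (words (applyUpTo suc n)) {xs = upTo (suc n)}
      (Any.map (λ { refl → words-complete μ (All.zipWith letter (μ>0 , all-≤-sum μ)) })
        (∈-upTo⁺ (s≤s (length-≤-sum μ>0)))))
    ⊢μ
    where
    letter : ∀ {a} → 0 < a × a ≤ n → a ∈ applyUpTo suc n
    letter {suc a} (_ , a<n) = ∈-applyUpTo⁺ suc a<n

  ∈-partitions⇒⊢ : ∀ {n μ} → μ ∈ partitions n → μ ⊢ n
  ∈-partitions⇒⊢ {n} μ∈ =
    proj₂ (∈-filter⁻ (_⊢? n) {xs = concatMap (words (applyUpTo suc n)) (upTo (suc n))} μ∈)

  private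
    module Down = Sort (Flip.decTotalOrder ℕ.≤-decTotalOrder)

  shape : List ℕ → List ℕ
  shape α = Down.sort (filter (0 ℕ.<?_) α)

  strip-zeros : ∀ α → ∃ λ k → α ↭ filter (0 ℕ.<?_) α ++ replicate k 0
  strip-zeros []          = 0 , ↭-refl
  strip-zeros (zero ∷ α)  with strip-zeros α
  ... | k , p = suc k , ↭-trans (Perm.prep 0 p) (↭-sym (shift 0 (filter (0 ℕ.<?_) α) (replicate k 0)))
  strip-zeros (suc a ∷ α) with strip-zeros α
  ... | k , p = k , Perm.prep (suc a) p

  shape-↭ : ∀ α → ∃ λ k → α ↭ shape α ++ replicate k 0
  shape-↭ α with strip-zeros α
  ... | k , p = k , ↭-trans p (++⁺ʳ (replicate k 0) (↭-sym (Down.sort-↭ _)))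

  sum-shape : ∀ α → ListAction.sum (shape α) ≡ ListAction.sum α
  sum-shape α with shape-↭ α
  ... | k , p = ≡.sym (≡.trans (sum-↭ p) (≡.trans (sum-++ (shape α) (replicate k 0))
    (≡.trans (≡.cong (ListAction.sum (shape α) +_) (sum-zeros k)) (ℕ.+-identityʳ _))))
    where
    sum-zeros : ∀ k → ListAction.sum (replicate k 0) ≡ 0
    sum-zeros zero    = refl
    sum-zeros (suc k) = sum-zeros k

  shape-⊢ : ∀ {n α} → ListAction.sum α ≡ n → shape α ⊢ n
  shape-⊢ {α = α} e = Down.sort-↗ _
    , All-resp-↭ (↭-sym (Down.sort-↭ _)) (All.all-filter (0 ℕ.<?_) α)
    , ≡.trans (sum-shape α) e

  module _ {n : ℕ} (f : SymmetricFunction ℤ[q] n) where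

    open import Algebra.Bundles.Raw using (module RawRing)
    open RawRing ℤ[q] using (_≈_)

    coefficient-padding : ∀ α k → coefficient f (α ++ replicate k 0) ≈ coefficient f α
    coefficient-padding α zero    rewrite List.++-identityʳ α = λ _ → refl
    coefficient-padding α (suc k) j =
      ≡.trans (≡.cong (λ β → Polynomial.coeff ℤ.+-*-rawRing (coefficient f β) j)
        (≡.sym (List.++-assoc α (0 ∷ []) (replicate k 0))))
      (≡.trans (coefficient-padding (α ++ 0 ∷ []) k j) (padding f α j))

    -- Up to order, α is its shape followed by zeros; symmetry absorbs the order and padding the
    -- zeros.
    coefficient-shape : ∀ α → coefficient f (shape α) ≈ coefficient f α
    coefficient-shape α j with shape-↭ α
    ... | k , p = ≡.sym (≡.trans (symmetric f p j) (coefficient-padding (shape α) k j))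

  -- The sum in `Y` with the character values and the list of partitions made variable, so that
  -- induction over the list applies.
  combination : (List ℕ → K.Carrier) → List (List ℕ) → List ℕ → K.Carrier
  combination c L α = foldr K._+_ K.0# (List.map (λ μ → c μ K.* monomial μ α) L)

  monomial-shape : ∀ α → monomial (shape α) α ≡ K.1#
  monomial-shape α = ≡.cong (if_then K.1# else K.0#)
    (dec-true (List.≡-dec ℕ._≟_ (shape α) (shape α)) refl)

  monomial-other : ∀ {μ α} → shape α ≢ μ → monomial μ α ≡ K.0#
  monomial-other {μ} {α} ne = ≡.cong (if_then K.1# else K.0#)
    (dec-false (List.≡-dec ℕ._≟_ (shape α) μ) ne)

  combination-other : ∀ c {L α} → All (shape α ≢_) L → combination c L α ≃ K.0#
  combination-other c []             = F.refl
  combination-other c {μ ∷ L} {α} (ne ∷ nes) = F.trans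
    (F.+-cong (F.trans (F.*-congˡ {c μ} (F.reflexive (monomial-other {μ} {α} ne))) (F.zeroʳ (c μ)))
      (combination-other c {L} {α} nes))
    (F.+-identityˡ K.0#)

  -- Different monomial symmetric functions share no monomials, so a single summand remains; a
  -- partition listed twice would contribute twice, which is why `partitions` is shown to be free of
  -- repetitions.
  combination-shape : ∀ c {L α} → Unique L → shape α ∈ L → combination c L α ≃ c (shape α)
  combination-shape c {μ ∷ L} {α} (μ∉ ∷ u) (here refl) = F.trans
    (F.+-cong (F.trans (F.*-congˡ {c μ} (F.reflexive (monomial-shape α))) (F.*-identityʳ (c μ)))
      (combination-other c {L} {α} μ∉))
    (F.+-identityʳ (c μ))
  combination-shape c {μ ∷ L} {α} (μ∉ ∷ u) (there π∈) = F.trans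
    (F.+-cong
      (F.trans (F.*-congˡ {c μ} (F.reflexive (monomial-other {μ} {α} λ e → All.lookup μ∉ π∈ (≡.sym e)))) (F.zeroʳ (c μ)))
      (combination-shape c {L} {α} u π∈))
    (F.+-identityˡ (c (shape α)))

  module Characters (n : ℕ) where
    open Hecke n
    open HeckeAction n
    open ConstantTerms n

    ε : List ℕ → H → K.Carrier
    ε μ = StandardBasis.character n μ

    open Elimination ℚ⟨q⟩-ring ConstantTerm
      (λ {x} {y} → constantTerm-+ {x} {y}) (λ {x} {y} → constantTerm-* {x} {y}) (λ {x} → constantTerm-neg {x})
      (λ {x} c → invertible {x} c λ ())
      {H} (κ K.0#) _⊕_ (λ c h → κ c ⊛ h)

    ε-linear : ∀ μ → Linear (ε μ)
    ε-linear μ = record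
      { additive = λ g h → F.trans (character-formula (g ⊕ h))
          (F.trans (∑-distrib-+ (entry g) (entry h))
            (F.sym (F.+-cong (character-formula g) (character-formula h))))
      ; homogeneous = λ c h → F.trans (character-formula (κ c ⊛ h))
          (F.trans (F.sym (*-distribˡ-sum c (entry h)))
            (F.sym (F.*-congˡ {c} (character-formula h))))
      }
      where
      open StandardBasis n μ
      open import Algebra.Properties.Semiring.Sum F.semiring using (∑-distrib-+; *-distribˡ-sum)
      entry : H → Fin size → K.Carrier
      entry h k = act h (δ (word k)) (word k)

    private
      module ByRank = Sort (Flip.decTotalOrder (On.decTotalOrder ℕ.≤-decTotalOrder rank))

    -- Decreasing rank places each ν before the partitions at which its detector vanishes for q = 0.
    -- Partitions of equal rank may come in either order, because being distinct already gives the
    -- vanishing.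
    byRank : List (List ℕ)
    byRank = ByRank.sort (partitions n)

    byRank-⊢ : All (_⊢ n) byRank
    byRank-⊢ = All-resp-↭ (↭-sym (ByRank.sort-↭ (partitions n))) (All.tabulate ∈-partitions⇒⊢)

    byRank-triangular : AllPairs (λ ν μ → ConstantTerm (ε μ (detector ν)) 0ℚ) byRank
    byRank-triangular = AllPairs.map
      (λ {ν} {μ} ((μ≤ν , ν≢μ) , ⊢ν , ⊢μ) →
        constantTerm-off-diagonal μ ν ⊢μ ⊢ν μ≤ν (λ e → ν≢μ (≡.sym e)))
      (both byRank-⊢ (AllPairs.zip (sorted , distinct)))
      where
      sorted : AllPairs (λ ν μ → rank μ ≤ rank ν) byRank
      sorted = Linked⇒AllPairs (λ p r → ℕ.≤-trans r p) (ByRank.sort-↗ (partitions n))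
      distinct : Unique byRank
      distinct = AllPairs-resp-↭ (λ ne e → ne (≡.sym e)) (≡.resp₂ _≢_)
        (Perm.↭⇒↭ₛ (↭-sym (ByRank.sort-↭ (partitions n)))) (partitions-unique n)
        where open import Data.List.Relation.Binary.Permutation.Setoid.Properties (≡.setoid (List ℕ)) using (AllPairs-resp-↭)
      both : ∀ {A : Set} {P : A → Set} {R : A → A → Set} {xs} → All P xs → AllPairs R xs →
             AllPairs (λ x y → R x y × P x × P y) xs
      both []       []       = []
      both (p ∷ ps) (r ∷ rs) = All.zipWith (λ (r , p′) → r , p , p′) (r , ps) ∷ both ps rs

    interpolate : ∀ c → ∃ λ g → ∀ {μ} → μ ⊢ n → ε μ g ≃ c μ
    interpolate c with solvable byRank ε ε-linear detector (λ ν μ → _ , constantTerm-character μ ν)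
                         byRank-triangular (All.map (λ {μ} → constantTerm-diagonal μ) byRank-⊢) c
    ... | g , es = g , λ ⊢μ → All.lookup (All-resp-↭ (ByRank.sort-↭ (partitions n)) es) (partitions-complete ⊢μ)

    Y-coefficient : ∀ g (f : SymmetricFunction ℤ[q] n) → (∀ {μ} → μ ⊢ n → ε μ g ≃ ι (coefficient f μ)) →
                    ∀ α → Y n ε g α ≃ ι (coefficient f α)
    Y-coefficient g f e α with ListAction.sum α ℕ.≟ n
    ... | yes sum≡n = F.trans
      (combination-shape (λ μ → ε μ g) {partitions n} {α} (partitions-unique n) (partitions-complete ⊢shape))
      (F.trans (e ⊢shape) (ι-cong {coefficient f (shape α)} {coefficient f α} (coefficient-shape f α)))
      where
      ⊢shape : shape α ⊢ n
      ⊢shape = shape-⊢ {α = α} sum≡n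
    -- In a wrong degree the shape of α is a partition of another number, so it is not among those
    -- summed over, and homogeneity makes the coefficient of f vanish too.
    ... | no sum≢n = F.trans
      (combination-other (λ μ → ε μ g) {partitions n} {α} (All.tabulate λ { μ∈ refl →
        sum≢n (≡.trans (≡.sym (sum-shape α)) (proj₂ (proj₂ (∈-partitions⇒⊢ μ∈)))) }))
      (F.sym (ι-cong {coefficient f α} {[]} (homogeneous f α sum≢n)))

open Interpolation

proposition2p3 : (n : ℕ) →
    ∃[ ε ] ((∀ μ → μ ⊢ n → Hecke.Parabolic.IsInducedSignCharacter n μ (ε μ)) ×
    ((f : SymmetricFunction ℤ[q] n) →
    ∃[ g ] ((α : List ℕ) → Y n ε g α K.≈ ι (coefficient f α))))
proposition2p3 n = ε
  , (λ μ _ → StandardBasis.character-isInducedSignCharacter n μ)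
  , λ f → let g , e = interpolate (λ μ → ι (coefficient f μ)) in g , λ α → equal (Y-coefficient g f e α)
  where open Characters n
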